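{- Let $\alpha\in[0,1)$ be rational and let $G\in\mathfrak F_n$ (with respect to $\alpha$) with $n\geqslant 5$. If $U\in\Gamma_\alpha(G)$ has level $l$, then $l$ is odd, except possibly when $n$ is even and $c_\alpha$ is odd with $c_\alpha\geqslant 3$.
   Context: All graphs are finite, simple and undirected; $G$ is connected (standing assumption). For a graph $G$ on $n$ vertices, $A(G)$ is its adjacency matrix, $D(G)$ its diagonal degree matrix, $A_\alpha(G)=\alpha D(G)+(1-\alpha)A(G)$. For rational $\alpha\in[0,1)$, $c_\alpha$ is the smallest positive integer such that $c_\alpha\alpha$ and $c_\alpha(1-\alpha)$ are integers, and $A_{c_\alpha}(G)=c_\alpha A_\alpha(G)$. $\mathbf 1$ is the all-ones vector and $\tilde W_\alpha(G)=\left[\mathbf 1,\frac{A_{c_\alpha}(G)\mathbf 1}{c_\alpha},\dots,\frac{A_{c_\alpha}(G)^{n-1}\mathbf 1}{c_\alpha}\right]$ (an integral matrix). $\mathfrak F_n$ is the set of graphs $G$ on $n$ vertices such that $\frac{\det\tilde W_\alpha(G)}{2^{\lfloor n/2\rfloor}}$ is an odd square-free integer and $\tilde W_\alpha(G)$ has rank $n$ over $\mathbb F_p$ for each odd prime $p\mid c_\alpha$. $O_n(\mathbb Q)$ is the set of $n\times n$ rational orthogonal matrices and $\Gamma_\alpha(G)=\{U\in O_n(\mathbb Q): U\mathbf 1=\mathbf 1,\ U^TA_{c_\alpha}(G)U=A_{c_\alpha}(H)\text{ for some graph }H\}$. The level of a rational orthogonal matrix $U$ is the smallest positive integer $k$ such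 that $kU$ is integral. -}

module Defs where

open import Data.Nat as ℕ using (ℕ; zero; suc; _≥_; _<_)
open import Data.Nat.Divisibility as ℕ∣ using ()
open import Data.Integer.Divisibility as ℤ∣ using ()
open import Data.Nat.Primality using (Prime)
open import Data.Integer as ℤ using (ℤ; +_)
open import Data.Rational as ℚ using (ℚ; 0ℚ; 1ℚ)
open import Data.Fin as Fin using (Fin; zero; suc; punchIn)
open import Data.Bool using (Bool; true; false; if_then_else_)
open import Data.Product using (Σ; ∃; _×_; _,_)
open import Relation.Binary.PropositionalEquality using (_≡_; _≢_)
open import Relation.Nullary using (¬_)

record Graph (n : ℕ) : Set where
  field
    adj   : Fin n → Fin n → Bool
    sym   : ∀ i j → adj i j ≡ adj j i
    irrefl : ∀ i → adj i i ≡ false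
open Graph public

data Reach {n : ℕ} (G : Graph n) : Fin n → Fin n → Set where
  here : ∀ {i} → Reach G i i
  step : ∀ {i j k} → adj G i j ≡ true → Reach G j k → Reach G i k

Connected : ∀ {n} → Graph n → Set
Connected {n} G = ∀ (i j : Fin n) → Reach G i j

sumℚ : ∀ {n} → (Fin n → ℚ) → ℚ
sumℚ {zero}  f = 0ℚ
sumℚ {suc n} f = f zero ℚ.+ sumℚ (λ i → f (suc i))

Vec : ℕ → Set
Vec n = Fin n → ℚ

Mat : ℕ → Set
Mat n = Fin n → Fin n → ℚ

_·_ : ∀ {n} → Mat n → Mat n → Mat n
(M · N) i j = sumℚ (λ k → M i k ℚ.* N k j)

_▷_ : ∀ {n} → Mat n → Vec n → Vec n
(M ▷ v) i = sumℚ (λ k → M i k ℚ.* v k)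

transpose : ∀ {n} → Mat n → Mat n
transpose M i j = M j i

δ : ∀ {n} → Fin n → Fin n → ℚ
δ i j with i Fin.≟ j
... | Relation.Nullary.yes _ = 1ℚ
... | Relation.Nullary.no  _ = 0ℚ

idMat : ∀ {n} → Mat n
idMat = δ

ones : ∀ {n} → Vec n
ones _ = 1ℚ

scale : ∀ {n} → ℚ → Mat n → Mat n
scale c M i j = c ℚ.* M i j

pow▷ : ∀ {n} → Mat n → ℕ → Vec n → Vec n
pow▷ M zero    v = v
pow▷ M (suc k) v = M ▷ pow▷ M k v

signℚ : ℕ → ℚ
signℚ zero          = 1ℚ
signℚ (suc zero)    = ℚ.- 1ℚ
signℚ (suc (suc k)) = signℚ k

det : ∀ {n} → Mat n → ℚ
det {zero}  M = 1ℚ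
det {suc n} M =
  sumℚ (λ j → signℚ (Fin.toℕ j) ℚ.* (M zero j ℚ.* det {n} (λ r c → M (suc r) (punchIn j c))))

fromBool : Bool → ℚ
fromBool true  = 1ℚ
fromBool false = 0ℚ

adjMat : ∀ {n} → Graph n → Mat n
adjMat G i j = fromBool (adj G i j)

degree : ∀ {n} → Graph n → Fin n → ℚ
degree G i = sumℚ (λ j → adjMat G i j)

degMat : ∀ {n} → Graph n → Mat n
degMat G i j = δ i j ℚ.* degree G i

Aα : ∀ {n} → ℚ → Graph n → Mat n
Aα α G i j = (α ℚ.* degMat G i j) ℚ.+ ((1ℚ ℚ.- α) ℚ.* adjMat G i j)

IsInteger : ℚ → Set
IsInteger r = ∃ λ (z : ℤ) → r ≡ (z ℚ./ 1)

ℕtoℚ : ℕ → ℚ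
ℕtoℚ k = (+ k) ℚ./ 1

Admissible : ℚ → ℕ → Set
Admissible α c = 1 ℕ.≤ c × IsInteger (ℕtoℚ c ℚ.* α) × IsInteger (ℕtoℚ c ℚ.* (1ℚ ℚ.- α))

IsCα : ℚ → ℕ → Set
IsCα α c = Admissible α c × (∀ d → Admissible α d → c ℕ.≤ d)

Ac : ∀ {n} → ℚ → ℕ → Graph n → Mat n
Ac α c G = scale (ℕtoℚ c) (Aα α G)

-- division of a rational by a positive natural (c_α ≥ 1; the value at 0 is irrelevant)
divℕ : ℚ → ℕ → ℚ
divℕ r zero    = r
divℕ r (suc m) = r ℚ.* ((+ 1) ℚ./ suc m)

W̃ : ∀ {n} → ℚ → ℕ → Graph n → Mat n
W̃ α c G i zero    = 1ℚ
W̃ α c G i (suc k) = divℕ (pow▷ (Ac α c G) (suc (Fin.toℕ k)) ones i) c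

-- Rank n over F_p of an integral matrix (entries read via their numerators):
-- the only vector over F_p in the kernel of (M mod p) is zero.

sumℤ : ∀ {n} → (Fin n → ℤ) → ℤ
sumℤ {zero}  f = + 0
sumℤ {suc n} f = f zero ℤ.+ sumℤ (λ i → f (suc i))

FullRankMod : ∀ {n} → ℕ → Mat n → Set
FullRankMod {n} p M =
  ∀ (x : Fin n → ℤ) →
    (∀ i → (+ p) ℤ∣.∣ sumℤ (λ k → ℚ.numerator (M i k) ℤ.* x k)) →
    ∀ k → (+ p) ℤ∣.∣ x k

Odd : ℕ → Set
Odd m = ¬ (2 ℕ∣.∣ m)

Even : ℕ → Set
Even m = 2 ℕ∣.∣ m

SquareFree : ℤ → Set
SquareFree z = ∀ d → 2 ℕ.≤ d → ¬ ((d ℕ.* d) ℕ∣.∣ ℤ.∣ z ∣)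

InF : ∀ {n} → ℚ → ℕ → Graph n → Set
InF {n} α c G =
  (∃ λ (z : ℤ) → det (W̃ α c G) ≡ (z ℚ./ 1) ℚ.* ((+ (2 ℕ.^ (n ℕ./ 2))) ℚ./ 1)
                × Odd ℤ.∣ z ∣ × SquareFree z)
  × (∀ p → Prime p → Odd p → p ℕ∣.∣ c → FullRankMod p (W̃ α c G))

Orthogonal : ∀ {n} → Mat n → Set
Orthogonal {n} U = ∀ (i j : Fin n) → (transpose U · U) i j ≡ idMat i j

InΓ : ∀ {n} → ℚ → ℕ → Graph n → Mat n → Set
InΓ {n} α c G U =
  Orthogonal U
  × (∀ i → (U ▷ ones) i ≡ ones i)
  × ∃ λ (H : Graph n) → ∀ (i j : Fin n) → ((transpose U · Ac α c G) · U) i j ≡ Ac α c H i j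

IntegralMat : ∀ {n} → Mat n → Set
IntegralMat {n} M = ∀ (i j : Fin n) → IsInteger (M i j)

IsLevel : ∀ {n} → Mat n → ℕ → Set
IsLevel U l =
  1 ℕ.≤ l × IntegralMat (scale (ℕtoℚ l) U)
  × (∀ k → 1 ℕ.≤ k → IntegralMat (scale (ℕtoℚ k) U) → l ℕ.≤ k)

{-# OPTIONS --safe #-}
module Submission where

-- Put M = A_c, let d be the degree vector, and let w₀ = 𝟙, wₖ₊₁ = Mᵏ d be the columns of W, so that M 𝟙 = c d.
-- A column v of V = l U satisfies l ∣ v · wₖ and l² ∣ v · Mᵏ v for every k.
--
-- Suppose that l is even and that v is not zero modulo 2.  All products wᵢ · wⱼ are even, except n = w₀ · w₀ when
-- n is odd; since det (Wᵀ W) = (det W)², dividing Wᵀ W by these factors 2 leaves a matrix Q of odd determinant.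
-- Self-orthogonality modulo 2 makes v congruent to a combination F = Σ xᵢ Mⁱ u of about n / 2 columns.  The cross
-- terms of F · Mᵏ F come in equal even pairs, so modulo 4 it equals u · Mᵏ (Σ xᵢ² M²ⁱ u), which must vanish; as 2 i
-- stays below n, this is Q applied to a vector, whose entries xᵢ² are therefore even.  This contradicts v ≢ 0,
-- except that for n and c even it only shows that every entry of v is odd.  In that case 4 ∤ l because Q is
-- invertible modulo 2, and no odd prime divides l because it divides det W at most once; so l = 2 and the squared
-- norm l² = 4 of v is at least n ≥ 5.

open import Data.Nat as ℕ using (ℕ; zero; suc; _≤_; _≥_)
import Data.Nat.Properties as ℕ
import Data.Nat.Divisibility as ℕ∣
open import Data.Nat.Primality using (Prime; euclidsLemma; ¬prime[0]; ¬prime[1]; prime[2]; prime⇒nonTrivial; prime⇒irreducible)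
open import Data.Nat.Primality.Factorisation using (factorise)
open import Data.List using ([]; _∷_)
import Data.List.Relation.Unary.All as All
open import Data.Integer using (ℤ; 0ℤ; 1ℤ; -_; _+_; _*_)
import Data.Integer as ℤ
import Data.Integer.Properties as ℤ
import Data.Integer.DivMod as ℤ
open import Data.Integer.Divisibility.Signed
open import Data.Integer.Tactic.RingSolver using (solve-∀)
open import Data.Fin using (Fin; zero; suc; toℕ; punchIn; punchOut; inject₁; fromℕ; fromℕ<)
import Data.Fin.Properties as Fin
open import Data.Fin.Induction using (>-weakInduction)
open import Data.Vec.Functional using (Vector; updateAt; removeAt; insertAt)
open import Data.Vec.Functional.Properties using (updateAt-updates; updateAt-minimal; insertAt-lookup; insertAt-punchIn)
open import Data.Product using (∃; _×_; _,_; proj₁; proj₂)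
open import Data.Empty using (⊥)
open import Data.Sum using (_⊎_; inj₁; inj₂; [_,_]′)
open import Function using (_∘_; const; id; _⟨_⟩_)
open import Relation.Binary.PropositionalEquality
open import Relation.Binary.Definitions using (tri<; tri≈; tri>)
open import Relation.Nullary using (¬_; yes; no; contradiction; ¬?)
open import Relation.Nullary.Decidable using (decidable-stable)
open import Algebra.Properties.Semiring.Sum ℤ.+-*-semiring
  using (sum; sum-cong-≗; sum-remove; sum-init-last; ∑-distrib-+; ∑-comm; *-distribˡ-sum; *-distribʳ-sum)
open import Defs renaming (sym to adj-sym)
open import Data.Rational using (ℚ; 0ℚ; 1ℚ; mkℚ; toℚᵘ) renaming (_≤_ to _≤ℚ_; _<_ to _<ℚ_)
import Data.Rational as ℚ
import Data.Rational.Properties as ℚ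
import Data.Rational.Unnormalised as ℚᵘ
import Data.Rational.Unnormalised.Properties as ℚᵘ
open import Data.Nat.DivMod using (m*n/n≡m; +-distrib-/-∣ʳ)
import Data.Nat.Coprimality as Coprimality
open import Algebra.Bundles using (CommutativeMonoid)
import Algebra.Properties.CommutativeSemigroup (CommutativeMonoid.commutativeSemigroup ℚ.*-1-commutativeMonoid) as ℚ-*
open import Data.Bool using (true; false)

-- The relation for v holds modulo 2, but the forms v · Mᵏ v are known modulo 4; a congruence modulo
-- 2 between vectors gives one modulo 4 between their forms, and there the coefficients survive only
-- as squares attached to M²ⁱ. The starting vector u needs even moments u · Mᵏ u. For odd n this
-- rules out 𝟙, as 𝟙 · 𝟙 = n, so u = d; for c = 1 the vector 𝟙 generates all columns. For n and c
-- even the columns start from 𝟙 and d separately. Modulo 4 the form of y 𝟙 + F against Mᵏ with k ≥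
-- 1 equals that of F, and k = 0 would bring in y² n, where n need not be a multiple of 4; so
-- nothing is learnt about y, and v ≡ 𝟙 remains possible. For an odd prime p the decisive fact is
-- that v is isotropic: p ∣ v · v puts v into its own orthogonal complement, which is the column
-- space of W modulo p because the kernel of W is a line there. The conditions modulo p² place the
-- quotient by p of a vanishing combination κ v + μ M v there too. Everything modulo p is a
-- divisibility statement about integer vectors, with Cramer's rule in place of inverses and normal
-- forms.

-- Finite sums, the identity matrix and column updates

Matrix : ℕ → ℕ → Set
Matrix m n = Fin m → Fin n → ℤ

sum-zero : ∀ {n} {f : Vector ℤ n} → (∀ i → f i ≡ 0ℤ) → sum f ≡ 0ℤ
sum-zero {zero}  f≡0 = refl
sum-zero {suc n} f≡0 = cong₂ _+_ (f≡0 zero) (sum-zero (f≡0 ∘ suc))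

sum-single : ∀ {n} (f : Vector ℤ n) j → (∀ i → i ≢ j → f i ≡ 0ℤ) → sum f ≡ f j
sum-single {suc n} f j others = begin
  sum f                      ≡⟨ sum-remove {i = j} f ⟩
  f j + sum (removeAt f j)   ≡⟨ cong (f j +_) (sum-zero λ i → others _ (Fin.punchInᵢ≢i j i)) ⟩
  f j + 0ℤ                   ≡⟨ ℤ.+-identityʳ _ ⟩
  f j                        ∎
  where open ≡-Reasoning

sum-pair : ∀ {n} (f : Vector ℤ n) {j k} → j ≢ k → (∀ i → i ≢ j → i ≢ k → f i ≡ 0ℤ) →
           sum f ≡ f j + f k
sum-pair {suc n} f {j} {k} j≢k others = begin
  sum f                                   ≡⟨ sum-remove {i = j} f ⟩
  f j + sum (removeAt f j)                ≡⟨ cong (f j +_) (sum-single (removeAt f j) (punchOut j≢k) λ i i≢ →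
                                               others _ (Fin.punchInᵢ≢i j i) λ eq → i≢ (Fin.punchIn-injective j i _
                                                 (trans eq (sym (Fin.punchIn-punchOut j≢k))))) ⟩
  f j + f (punchIn j (punchOut j≢k))      ≡⟨ cong (λ i → f j + f i) (Fin.punchIn-punchOut j≢k) ⟩
  f j + f k                               ∎
  where open ≡-Reasoning

sum-linear : ∀ {n} s t (f g : Vector ℤ n) →
             sum (λ i → s * f i + t * g i) ≡ s * sum f + t * sum g
sum-linear s t f g = trans (∑-distrib-+ (λ i → s * f i) (λ i → t * g i))
  (sym (cong₂ _+_ (*-distribˡ-sum s f) (*-distribˡ-sum t g)))

identity : ∀ {n} → Matrix n n
identity zero    zero    = 1ℤ
identity zero    (suc _) = 0ℤ
identity (suc _) zero    = 0ℤ
identity (suc i) (suc j) = identity i j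

identity-diag : ∀ {n} (i : Fin n) → identity i i ≡ 1ℤ
identity-diag zero    = refl
identity-diag (suc i) = identity-diag i

identity-off : ∀ {n} {i j : Fin n} → i ≢ j → identity i j ≡ 0ℤ
identity-off {i = zero}  {zero}  i≢j = contradiction refl i≢j
identity-off {i = zero}  {suc _} i≢j = refl
identity-off {i = suc _} {zero}  i≢j = refl
identity-off {i = suc _} {suc _} i≢j = identity-off (i≢j ∘ cong suc)

identity-sym : ∀ {n} (i j : Fin n) → identity i j ≡ identity j i
identity-sym zero    zero    = refl
identity-sym zero    (suc _) = refl
identity-sym (suc _) zero    = refl
identity-sym (suc i) (suc j) = identity-sym i j

identity-punchIn : ∀ {n} (i : Fin (suc n)) r c → identity (punchIn i r) (punchIn i c) ≡ identity r c
identity-punchIn zero    r       c       = refl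
identity-punchIn (suc i) zero    zero    = refl
identity-punchIn (suc i) zero    (suc c) = refl
identity-punchIn (suc i) (suc r) zero    = refl
identity-punchIn (suc i) (suc r) (suc c) = identity-punchIn i r c

sum-identity : ∀ {n} (f : Vector ℤ n) j → sum (λ i → f i * identity i j) ≡ f j
sum-identity f j = trans
  (sum-single _ j λ i i≢j → trans (cong (f i *_) (identity-off i≢j)) (ℤ.*-zeroʳ (f i)))
  (trans (cong (f j *_) (identity-diag j)) (ℤ.*-identityʳ (f j)))

infixl 8 _⊗_
_⊗_ : ∀ {m n p} → Matrix m n → Matrix n p → Matrix m p
(A ⊗ B) i k = sum λ j → A i j * B j k

infixr 7 _⊛_
_⊛_ : ∀ {m n} → Matrix m n → Vector ℤ n → Vector ℤ m
(A ⊛ x) i = sum λ j → A i j * x j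

infix 9 _ᵀ
_ᵀ : ∀ {m n} → Matrix m n → Matrix n m
(A ᵀ) i j = A j i

infix 9 _[_]≔_
_[_]≔_ : ∀ {m n} → Matrix m n → Fin n → Vector ℤ m → Matrix m n
(A [ j ]≔ x) r = updateAt (A r) j (const (x r))

column-updated : ∀ {m n} (A : Matrix m n) j x r → (A [ j ]≔ x) r j ≡ x r
column-updated A j x r = updateAt-updates j (A r)

column-kept : ∀ {m n} (A : Matrix m n) {j} x r k → k ≢ j → (A [ j ]≔ x) r k ≡ A r k
column-kept A {j} x r k k≢j = updateAt-minimal k j (A r) k≢j

-- Determinants

sign : ℕ → ℤ
sign zero    = 1ℤ
sign (suc k) = - sign k

minor : ∀ {m n} → Matrix (suc m) (suc n) → Fin (suc m) → Fin (suc n) → Matrix m n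
minor A i j r c = A (punchIn i r) (punchIn j c)

detℤ : ∀ {n} → Matrix n n → ℤ
detℤ {zero}  A = 1ℤ
detℤ {suc n} A = sum λ j → sign (toℕ j) * (A zero j * detℤ (minor A zero j))

-- Matrices are functions compared entry by entry, so the three matrices are tied together by
-- pointwise equations. In this form multilinearity already implies invariance under pointwise
-- equality as soon as there is a column.
Multilinear : ∀ {m n} → (Matrix m n → ℤ) → Set
Multilinear D = ∀ j s t {A B C} →
  (∀ r k → k ≢ j → A r k ≡ C r k) → (∀ r k → k ≢ j → B r k ≡ C r k) →
  (∀ r → C r j ≡ s * A r j + t * B r j) → D C ≡ s * D A + t * D B

Alternating : ∀ {m n} → (Matrix m n → ℤ) → Set
Alternating D = ∀ {j k} {A} → j ≢ k → (∀ r → A r j ≡ A r k) → D A ≡ 0ℤ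

-- The form that expansion along a row yields directly: deleting a third column leaves two equal
-- adjacent columns adjacent. The full property then follows by swapping neighbours.
AdjacentAlternating : ∀ {m n} → (Matrix m n → ℤ) → Set
AdjacentAlternating D = ∀ {j k} {A} → toℕ k ≡ suc (toℕ j) → (∀ r → A r j ≡ A r k) → D A ≡ 0ℤ

module _ {m n} {D : Matrix m n → ℤ} (lin : Multilinear D) where

  -- The j-th column of C is 1 times that of A plus 0 times that of A.
  multilinear-cong-at : Fin n → ∀ {A C} → (∀ r k → A r k ≡ C r k) → D A ≡ D C
  multilinear-cong-at j {A} {C} A≗C = sym (trans
    (lin j 1ℤ 0ℤ {A} {A} {C} (λ r k _ → A≗C r k) (λ r k _ → A≗C r k)
      (λ r → trans (sym (A≗C r j)) (one-zero (A r j)))) (sym (one-zero (D A))))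
    where
    one-zero : ∀ a → a ≡ 1ℤ * a + 0ℤ * a
    one-zero = solve-∀

  multilinear-+ : ∀ j {A B C} → (∀ r k → k ≢ j → A r k ≡ C r k) → (∀ r k → k ≢ j → B r k ≡ C r k) →
                  (∀ r → C r j ≡ A r j + B r j) → D C ≡ D A + D B
  multilinear-+ j {A} {B} {C} A≡C B≡C Cj = trans
    (lin j 1ℤ 1ℤ A≡C B≡C (λ r → trans (Cj r) (sym (ones-linear (A r j) (B r j))))) (ones-linear (D A) (D B))
    where
    ones-linear : ∀ u v → 1ℤ * u + 1ℤ * v ≡ u + v
    ones-linear = solve-∀

  zero-column : ∀ j {A} → (∀ r → A r j ≡ 0ℤ) → D A ≡ 0ℤ
  zero-column j {A} A≡0 = trans
    (lin j 0ℤ 0ℤ {A} {A} {A} (λ _ _ _ → refl) (λ _ _ _ → refl) (λ r → trans (A≡0 r) (zeros (A r j) (A r j))))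
    (sym (zeros (D A) (D A)))
    where
    zeros : ∀ a b → 0ℤ ≡ 0ℤ * a + 0ℤ * b
    zeros = solve-∀

  column-sum : ∀ {q} j (t : Vector ℤ q) (b : Fin q → Vector ℤ m) {A} →
               (∀ r → A r j ≡ sum λ i → t i * b i r) → D A ≡ sum λ i → t i * D (A [ j ]≔ b i)
  column-sum {zero}  j t b A≡ = zero-column j A≡
  column-sum {suc q} j t b {A} A≡ = begin
    D A                                   ≡⟨ lin j (t zero) 1ℤ
                                               (λ r k k≢j → column-kept A (b zero) r k k≢j)
                                               (λ r k k≢j → column-kept A rest r k k≢j)
                                               (λ r → trans (A≡ r) (cong₂ _+_
                                                 (cong (t zero *_) (sym (column-updated A j (b zero) r)))
                                                 (trans (sym (column-updated A j rest r)) (sym (ℤ.*-identityˡ _))))) ⟩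
    t zero * D (A [ j ]≔ b zero) + 1ℤ * D A′
                                          ≡⟨ cong (t zero * D (A [ j ]≔ b zero) +_) (ℤ.*-identityˡ (D A′)) ⟩
    t zero * D (A [ j ]≔ b zero) + D A′   ≡⟨ cong (t zero * D (A [ j ]≔ b zero) +_)
                                               (column-sum j (t ∘ suc) (b ∘ suc) (column-updated A j rest)) ⟩
    t zero * D (A [ j ]≔ b zero) + sum (λ i → t (suc i) * D (A′ [ j ]≔ b (suc i)))
                                          ≡⟨ cong (t zero * D (A [ j ]≔ b zero) +_)
                                               (sum-cong-≗ λ i → cong (t (suc i) *_) (multilinear-cong-at j (twice i))) ⟩
    t zero * D (A [ j ]≔ b zero) + sum (λ i → t (suc i) * D (A [ j ]≔ b (suc i))) ∎
    where
    open ≡-Reasoning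
    rest : Vector ℤ m
    rest r = sum λ i → t (suc i) * b (suc i) r
    A′ = A [ j ]≔ rest
    twice : ∀ i r k → (A′ [ j ]≔ b (suc i)) r k ≡ (A [ j ]≔ b (suc i)) r k
    twice i r k with k Fin.≟ j
    ... | yes refl = trans (column-updated A′ j (b (suc i)) r) (sym (column-updated A j (b (suc i)) r))
    ... | no k≢j   = trans (column-kept A′ (b (suc i)) r k k≢j)
                       (trans (column-kept A rest r k k≢j) (sym (column-kept A (b (suc i)) r k k≢j)))

  -- Expand 0 = D (…, a + b, …, a + b, …).
  swap-columns : ∀ {j k} → j ≢ k → (∀ {A} → (∀ r → A r j ≡ A r k) → D A ≡ 0ℤ) →
                 ∀ {A B} → (∀ r → B r j ≡ A r k) → (∀ r → B r k ≡ A r j) →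
                 (∀ r i → i ≢ j → i ≢ k → B r i ≡ A r i) → D B ≡ - D A
  swap-columns {j} {k} j≢k alt {A} {B} Bj Bk Bi = begin
    D B                              ≡⟨ add-sub (D A) (D B) (D A + D B) refl ⟩
    (D A + D B) + - D A              ≡⟨ cong (_+ - D A) (sym sum≡0′) ⟩
    0ℤ + - D A                       ≡⟨ ℤ.+-identityˡ _ ⟩
    - D A                            ∎
    where
    open ≡-Reasoning
    add-sub : ∀ a b c → c ≡ a + b → b ≡ c + - a
    add-sub a b _ refl = lemma a b
      where lemma : ∀ a b → b ≡ (a + b) + - a
            lemma = solve-∀
    ab : Vector ℤ m
    ab r = A r j + A r k
    aj ak : Vector ℤ m
    aj r = A r j
    ak r = A r k
    col : ∀ (x y : Vector ℤ m) → Matrix m n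
    col x y = (A [ j ]≔ x) [ k ]≔ y
    at-j : ∀ x y r → col x y r j ≡ x r
    at-j x y r = trans (column-kept (A [ j ]≔ x) y r j j≢k) (column-updated A j x r)
    at-k : ∀ x y r → col x y r k ≡ y r
    at-k x y r = column-updated (A [ j ]≔ x) k y r
    at-i : ∀ x y r i → i ≢ j → i ≢ k → col x y r i ≡ A r i
    at-i x y r i i≢j i≢k = trans (column-kept (A [ j ]≔ x) y r i i≢k) (column-kept A x r i i≢j)
    agree : ∀ x y {B : Matrix m n} r i → (x r ≡ B r j) → (y r ≡ B r k) → (i ≢ j → i ≢ k → B r i ≡ A r i) →
            col x y r i ≡ B r i
    agree x y r i fj fk fi with i Fin.≟ j | i Fin.≟ k
    ... | yes refl | _        = trans (at-j x y r) fj
    ... | no _     | yes refl = trans (at-k x y r) fk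
    ... | no i≢j   | no i≢k   = trans (at-i x y r i i≢j i≢k) (sym (fi i≢j i≢k))
    split-j : ∀ y → D (col ab y) ≡ D (col aj y) + D (col ak y)
    split-j y = multilinear-+ j (λ r i i≢j → same-but-j aj r i i≢j) (λ r i i≢j → same-but-j ak r i i≢j)
      (λ r → trans (at-j ab y r) (sym (cong₂ _+_ (at-j aj y r) (at-j ak y r))))
      where
      same-but-j : ∀ x r i → i ≢ j → col x y r i ≡ col ab y r i
      same-but-j x r i i≢j with i Fin.≟ k
      ... | yes refl = trans (at-k x y r) (sym (at-k ab y r))
      ... | no i≢k   = trans (at-i x y r i i≢j i≢k) (sym (at-i ab y r i i≢j i≢k))
    split-k : ∀ x → D (col x ab) ≡ D (col x aj) + D (col x ak)
    split-k x = multilinear-+ k (λ r i i≢k → same-but-k aj r i i≢k) (λ r i i≢k → same-but-k ak r i i≢k)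
      (λ r → trans (at-k x ab r) (sym (cong₂ _+_ (at-k x aj r) (at-k x ak r))))
      where
      same-but-k : ∀ y r i → i ≢ k → col x y r i ≡ col x ab r i
      same-but-k y r i i≢k = trans (column-kept (A [ j ]≔ x) y r i i≢k) (sym (column-kept (A [ j ]≔ x) ab r i i≢k))
    equal : ∀ x → D (col x x) ≡ 0ℤ
    equal x = alt (λ r → trans (at-j x x r) (sym (at-k x x r)))
    A≗ : ∀ r i → col aj ak r i ≡ A r i
    A≗ r i = agree aj ak {A} r i refl refl (λ _ _ → refl)
    B≗ : ∀ r i → col ak aj r i ≡ B r i
    B≗ r i = agree ak aj {B} r i (sym (Bj r)) (sym (Bk r)) (Bi r i)
    sum≡0′ : 0ℤ ≡ D A + D B
    sum≡0′ = begin
      0ℤ                                                              ≡⟨ sym (equal ab) ⟩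
      D (col ab ab)                                                   ≡⟨ split-j ab ⟩
      D (col aj ab) + D (col ak ab)                                   ≡⟨ cong₂ _+_ (split-k aj) (split-k ak) ⟩
      (D (col aj aj) + D (col aj ak)) + (D (col ak aj) + D (col ak ak))
        ≡⟨ cong₂ _+_ (cong₂ _+_ (equal aj) (multilinear-cong-at j A≗)) (cong₂ _+_ (multilinear-cong-at j B≗) (equal ak)) ⟩
      (0ℤ + D A) + (D B + 0ℤ)                                         ≡⟨ cong₂ _+_ (ℤ.+-identityˡ (D A)) (ℤ.+-identityʳ (D B)) ⟩
      D A + D B                                                       ∎

module _ {m n} {D : Matrix m n → ℤ} (lin : Multilinear D) (adj : AdjacentAlternating D) where

  -- Induction on the number `d` of columns in between: exchanging column `k` with its left
  -- neighbour `i` changes only the sign and brings the two copies one step closer.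
  equal-columns : ∀ d {j k} {A} → toℕ k ≡ suc (d ℕ.+ toℕ j) → (∀ r → A r j ≡ A r k) → D A ≡ 0ℤ
  equal-columns zero    k≡ Aj≡Ak = adj k≡ Aj≡Ak
  equal-columns (suc d) {j} {k} {A} k≡ Aj≡Ak = begin
    D A        ≡⟨ sym (ℤ.neg-involutive (D A)) ⟩
    - (- D A)  ≡⟨ cong -_ (sym (swap-columns lin i≢k (adj k≡1+i)
                    at-i (column-updated A′ k ai)
                    (λ r l l≢i l≢k → trans (column-kept A′ ai r l l≢k) (column-kept A ak r l l≢i)))) ⟩
    - D B      ≡⟨ cong -_ (equal-columns d {j} {i} {B} i≡ λ r → trans
                    (trans (column-kept A′ ai r j j≢k) (column-kept A ak r j j≢i))
                    (trans (Aj≡Ak r) (sym (at-i r)))) ⟩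
    0ℤ         ∎
    where
    open ≡-Reasoning
    i<n : suc (d ℕ.+ toℕ j) ℕ.< n
    i<n = ℕ.≤-trans (ℕ.≤-reflexive (sym k≡)) (ℕ.<⇒≤ (Fin.toℕ<n k))
    i : Fin n
    i = fromℕ< i<n
    i≡ : toℕ i ≡ suc (d ℕ.+ toℕ j)
    i≡ = Fin.toℕ-fromℕ< i<n
    k≡1+i : toℕ k ≡ suc (toℕ i)
    k≡1+i = trans k≡ (cong suc (sym i≡))
    i≢k : i ≢ k
    i≢k i≡k = ℕ.1+n≢n (sym (trans (cong toℕ i≡k) k≡1+i))
    j≢i : j ≢ i
    j≢i j≡i = ℕ.m≢1+n+m (toℕ j) (trans (cong toℕ j≡i) i≡)
    j≢k : j ≢ k
    j≢k j≡k = ℕ.m≢1+n+m (toℕ j) (trans (cong toℕ j≡k) k≡)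
    ai ak : Vector ℤ m
    ai r = A r i
    ak r = A r k
    A′ = A [ i ]≔ ak
    B = A′ [ k ]≔ ai
    at-i : ∀ r → B r i ≡ A r k
    at-i r = trans (column-kept A′ ai r i i≢k) (column-updated A i ak r)

  private
    distance : ∀ {a b} → a ℕ.< b → b ≡ suc ((b ℕ.∸ suc a) ℕ.+ a)
    distance {a} {b} a<b = sym (trans (sym (ℕ.+-suc (b ℕ.∸ suc a) a)) (ℕ.m∸n+n≡m a<b))

  adjacent⇒alternating : Alternating D
  adjacent⇒alternating {j} {k} j≢k Aj≡Ak with ℕ.<-cmp (toℕ j) (toℕ k)
  ... | tri< j<k _ _ = equal-columns _ (distance j<k) Aj≡Ak
  ... | tri≈ _ j≡k _ = contradiction (Fin.toℕ-injective j≡k) j≢k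
  ... | tri> _ _ k<j = equal-columns _ (distance k<j) (sym ∘ Aj≡Ak)

-- Without a column multilinearity says nothing, so the empty matrix needs this as a hypothesis of
-- its own.
Congruent : ∀ {m n} → (Matrix m n → ℤ) → Set
Congruent D = ∀ {A B} → (∀ r k → A r k ≡ B r k) → D A ≡ D B

det-cong : ∀ {n} → Congruent (detℤ {n})
det-cong {zero}  A≗B = refl
det-cong {suc n} A≗B = sum-cong-≗ λ j → cong₂ (λ a d → sign (toℕ j) * (a * d)) (A≗B zero j)
  (det-cong λ r c → A≗B (suc r) (punchIn j c))

-- Each summand has exactly one factor linear in column `j`: the entry if `i` is `j`, where the
-- minor does not see that column, and otherwise the minor, in its column `punchOut i≢j`.
det-multilinear : ∀ {n} → Multilinear (detℤ {n})
det-multilinear {suc n} j s t {A} {B} {C} A≡C B≡C Cj = trans (sum-cong-≗ term) (sum-linear s t (summand A) (summand B))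
  where
  summand : Matrix (suc n) (suc n) → Fin (suc n) → ℤ
  summand M i = sign (toℕ i) * (M zero i * detℤ (minor M zero i))
  entry-linear : ∀ σ s t a b d → σ * ((s * a + t * b) * d) ≡ s * (σ * (a * d)) + t * (σ * (b * d))
  entry-linear = solve-∀
  minor-linear : ∀ σ s t c a b → σ * (c * (s * a + t * b)) ≡ s * (σ * (c * a)) + t * (σ * (c * b))
  minor-linear = solve-∀
  term : ∀ i → summand C i ≡ s * summand A i + t * summand B i
  term i with i Fin.≟ j
  ... | yes refl = begin
    σ * (C zero j * detℤ (minor C zero j))                       ≡⟨ cong (λ c → σ * (c * detℤ (minor C zero j))) (Cj zero) ⟩
    σ * ((s * A zero j + t * B zero j) * detℤ (minor C zero j))  ≡⟨ entry-linear σ s t (A zero j) (B zero j) _ ⟩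
    s * (σ * (A zero j * detℤ (minor C zero j))) + t * (σ * (B zero j * detℤ (minor C zero j)))
      ≡⟨ cong₂ (λ a b → s * (σ * (A zero j * a)) + t * (σ * (B zero j * b)))
           (det-cong λ r c → sym (A≡C (suc r) _ (Fin.punchInᵢ≢i j c)))
           (det-cong λ r c → sym (B≡C (suc r) _ (Fin.punchInᵢ≢i j c))) ⟩
    s * summand A j + t * summand B j                            ∎
    where
    open ≡-Reasoning
    σ = sign (toℕ j)
  ... | no i≢j = begin
    σ * (C zero i * detℤ (minor C zero i))
      ≡⟨ cong (λ d → σ * (C zero i * d)) (det-multilinear (punchOut i≢j) s t
           (λ r k k≢ → A≡C (suc r) _ (off k k≢)) (λ r k k≢ → B≡C (suc r) _ (off k k≢))
           (λ r → subst (λ k → C (suc r) k ≡ s * A (suc r) k + t * B (suc r) k) (sym (Fin.punchIn-punchOut i≢j)) (Cj (suc r)))) ⟩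
    σ * (C zero i * (s * detℤ (minor A zero i) + t * detℤ (minor B zero i)))
      ≡⟨ minor-linear σ s t (C zero i) _ _ ⟩
    s * (σ * (C zero i * detℤ (minor A zero i))) + t * (σ * (C zero i * detℤ (minor B zero i)))
      ≡⟨ cong₂ (λ a b → s * (σ * (a * detℤ (minor A zero i))) + t * (σ * (b * detℤ (minor B zero i))))
           (sym (A≡C zero i i≢j)) (sym (B≡C zero i i≢j)) ⟩
    s * summand A i + t * summand B i ∎
    where
    open ≡-Reasoning
    σ = sign (toℕ i)
    off : ∀ k → k ≢ punchOut i≢j → punchIn i k ≢ j
    off k k≢ eq = k≢ (Fin.punchIn-injective i k _ (trans eq (sym (Fin.punchIn-punchOut i≢j))))

punchOut-adjacent : ∀ {n} {i j k : Fin (suc n)} (i≢j : i ≢ j) (i≢k : i ≢ k) → toℕ k ≡ suc (toℕ j) →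
                    toℕ (punchOut i≢k) ≡ suc (toℕ (punchOut i≢j))
punchOut-adjacent {i = zero}  {zero}  {_}     i≢j i≢k adj = contradiction refl i≢j
punchOut-adjacent {i = zero}  {suc j} {suc k} i≢j i≢k adj = ℕ.suc-injective adj
punchOut-adjacent {suc n} {suc zero}    {zero} {suc zero} i≢j i≢k adj = contradiction refl i≢k
punchOut-adjacent {suc (suc n)} {suc (suc i)} {zero} {suc zero} i≢j i≢k adj = refl
punchOut-adjacent {suc n} {suc i} {suc j} {suc k} i≢j i≢k adj =
  cong suc (punchOut-adjacent (i≢j ∘ cong suc) (i≢k ∘ cong suc) (ℕ.suc-injective adj))

punchIn-inject₁ : ∀ {n} (i : Fin n) → punchIn (inject₁ i) i ≡ suc i
punchIn-inject₁ zero    = refl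
punchIn-inject₁ (suc i) = cong suc (punchIn-inject₁ i)

punchIn-suc : ∀ {n} (i : Fin n) → punchIn (suc i) i ≡ inject₁ i
punchIn-suc zero    = refl
punchIn-suc (suc i) = cong suc (punchIn-suc i)

punchIn-adjacent : ∀ {n} (i c : Fin n) → c ≢ i → punchIn (inject₁ i) c ≡ punchIn (suc i) c
punchIn-adjacent zero    zero    c≢i = contradiction refl c≢i
punchIn-adjacent zero    (suc c) c≢i = refl
punchIn-adjacent (suc i) zero    c≢i = refl
punchIn-adjacent (suc i) (suc c) c≢i = cong suc (punchIn-adjacent i c (c≢i ∘ cong suc))

inject₁≢suc : ∀ {n} (i : Fin n) → inject₁ i ≢ suc i
inject₁≢suc (suc i) eq = inject₁≢suc i (Fin.suc-injective eq)

-- Deleting either of the equal columns leaves the same minor and the two signs are opposite, so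
-- these summands cancel; every other minor still has two equal adjacent columns.
det-adjacent : ∀ {n} → AdjacentAlternating (detℤ {n})
det-adjacent {suc n} {j} {suc i} {A} adj Aj≡Ak
  with refl ← Fin.toℕ-injective (trans (sym (ℕ.suc-injective adj)) (sym (Fin.toℕ-inject₁ i))) = begin
    detℤ A                                            ≡⟨ sum-pair summand (inject₁≢suc i) others ⟩
    summand (inject₁ i) + summand (suc i)             ≡⟨ cong₂ (λ s d → s * (A zero (inject₁ i) * d) + summand (suc i))
                                                           (cong sign (Fin.toℕ-inject₁ i)) (det-cong minors) ⟩
    sign (toℕ i) * (A zero (inject₁ i) * d) + summand (suc i)
                                                      ≡⟨ cong (λ a → sign (toℕ i) * (a * d) + summand (suc i)) (Aj≡Ak zero) ⟩
    sign (toℕ i) * (A zero (suc i) * d) + - sign (toℕ i) * (A zero (suc i) * d)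
                                                      ≡⟨ cancel (sign (toℕ i)) (A zero (suc i) * d) ⟩
    0ℤ                                                ∎
  where
  open ≡-Reasoning
  d = detℤ (minor A zero (suc i))
  cancel : ∀ s x → s * x + - s * x ≡ 0ℤ
  cancel = solve-∀
  summand : Fin (suc n) → ℤ
  summand l = sign (toℕ l) * (A zero l * detℤ (minor A zero l))
  minors : ∀ r c → minor A zero (inject₁ i) r c ≡ minor A zero (suc i) r c
  minors r c with c Fin.≟ i
  ... | yes refl = trans (cong (A (suc r)) (punchIn-inject₁ c))
                     (trans (sym (Aj≡Ak (suc r))) (cong (A (suc r)) (sym (punchIn-suc c))))
  ... | no c≢i   = cong (A (suc r)) (punchIn-adjacent i c c≢i)
  others : ∀ l → l ≢ inject₁ i → l ≢ suc i → summand l ≡ 0ℤ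
  others l l≢j l≢k = trans
    (cong (λ d → sign (toℕ l) * (A zero l * d))
      (det-adjacent {j = punchOut l≢j} {punchOut l≢k} {minor A zero l} (punchOut-adjacent l≢j l≢k adj) λ r →
        trans (cong (A (suc r)) (Fin.punchIn-punchOut l≢j))
          (trans (Aj≡Ak (suc r)) (cong (A (suc r)) (sym (Fin.punchIn-punchOut l≢k))))))
    (annihilate (sign (toℕ l)) (A zero l))
    where
    annihilate : ∀ s a → s * (a * 0ℤ) ≡ 0ℤ
    annihilate = solve-∀

det-alternating : ∀ {n} → Alternating (detℤ {n})
det-alternating = adjacent⇒alternating det-multilinear det-adjacent

det-identity : ∀ n → detℤ (identity {n}) ≡ 1ℤ
det-identity zero    = refl
det-identity (suc n) = begin
  detℤ (identity {suc n})                     ≡⟨ sum-single summand zero others ⟩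
  1ℤ * (1ℤ * detℤ (identity {n}))             ≡⟨ cong (λ d → 1ℤ * (1ℤ * d)) (det-identity n) ⟩
  1ℤ                                          ∎
  where
  open ≡-Reasoning
  summand : Fin (suc n) → ℤ
  summand j = sign (toℕ j) * (identity {suc n} zero j * detℤ (minor identity zero j))
  others : ∀ j → j ≢ zero → summand j ≡ 0ℤ
  others zero    j≢0 = contradiction refl j≢0
  others (suc j) j≢0 = ℤ.*-zeroʳ (sign (toℕ (suc j)))

insertAt-cong : ∀ {n} i {x y : Vector ℤ n} {a} → (∀ r → x r ≡ y r) → ∀ r → insertAt x i a r ≡ insertAt y i a r
insertAt-cong i {a = a} x≗y r with i Fin.≟ r
... | yes refl = trans (insertAt-lookup _ i a) (sym (insertAt-lookup _ i a))
... | no i≢r rewrite sym (Fin.punchIn-punchOut i≢r) =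
  trans (insertAt-punchIn _ i a _) (trans (x≗y _) (sym (insertAt-punchIn _ i a _)))

-- What is left of a matrix with first column `identity i` once the rest of row `i` is cleared. An
-- alternating form of `bordered i B` is an alternating form of `B`, one size smaller, and this
-- carries the induction in `alternating-unique`.
bordered : ∀ {m n} → Fin (suc m) → Matrix m n → Matrix (suc m) (suc n)
bordered i B r zero    = identity i r
bordered i B r (suc c) = insertAt (λ r → B r c) i 0ℤ r

bordered-cong : ∀ {m n} i {A B : Matrix m n} → (∀ r k → A r k ≡ B r k) → ∀ r k → bordered i A r k ≡ bordered i B r k
bordered-cong i A≗B r zero    = refl
bordered-cong i A≗B r (suc c) = insertAt-cong i (λ r → A≗B r c) r

module _ {n} {D : Matrix (suc n) (suc n) → ℤ} (lin : Multilinear D) (alt : Alternating D) where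

  private
    -- The multiples of the first column are added one column at a time; `m` bounds the indices with
    -- a nonzero multiplier, and each step splits off a matrix in which the first column is
    -- repeated.
    add-to-first : ∀ m → m ≤ n → (t : Vector ℤ n) → (∀ k → m ≤ toℕ k → t k ≡ 0ℤ) → ∀ {A C} →
                   (∀ r → C r zero ≡ A r zero) → (∀ r k → C r (suc k) ≡ A r (suc k) + t k * A r zero) →
                   D C ≡ D A
    add-to-first zero _ t t≡0 {A} {C} C0 Ck = multilinear-cong-at lin zero λ where
      r zero    → C0 r
      r (suc k) → trans (Ck r k) (trans (cong (λ t → A r (suc k) + t * A r zero) (t≡0 k ℕ.z≤n)) (ℤ.+-identityʳ _))
    add-to-first (suc m) m<n t t≡0 {A} {C} C0 Ck = begin
      D C                     ≡⟨ lin (suc k) 1ℤ (t k) {C′} {C″} {C} agree agree′ at-k ⟩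
      1ℤ * D C′ + t k * D C″  ≡⟨ cong (λ x → 1ℤ * D C′ + t k * x) (alt {zero} {suc k} (λ ())
                                   λ r → sym (column-updated C′ (suc k) (λ r → A r zero) r)) ⟩
      1ℤ * D C′ + t k * 0ℤ    ≡⟨ one-zero (D C′) (t k) ⟩
      D C′                    ≡⟨ add-to-first m (ℕ.<⇒≤ m<n) t′ t′≡0 {A} {C′} (λ _ → refl) (λ _ _ → refl) ⟩
      D A                     ∎
      where
      open ≡-Reasoning
      one-zero : ∀ d t → 1ℤ * d + t * 0ℤ ≡ d
      one-zero = solve-∀
      one-times : ∀ a x t → a + t * x ≡ 1ℤ * (a + 0ℤ * x) + t * x
      one-times = solve-∀
      k : Fin n
      k = fromℕ< m<n
      t′ : Vector ℤ n
      t′ = updateAt t k (const 0ℤ)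
      C′ C″ : Matrix (suc n) (suc n)
      C′ r zero    = A r zero
      C′ r (suc l) = A r (suc l) + t′ l * A r zero
      C″ = C′ [ suc k ]≔ (λ r → A r zero)
      t′≡0 : ∀ l → m ≤ toℕ l → t′ l ≡ 0ℤ
      t′≡0 l m≤l with l Fin.≟ k
      ... | yes refl = updateAt-updates k t
      ... | no l≢k   = trans (updateAt-minimal l k t l≢k) (t≡0 l (ℕ.≤∧≢⇒< m≤l λ m≡l →
                         l≢k (Fin.toℕ-injective (trans (sym m≡l) (sym (Fin.toℕ-fromℕ< m<n))))))
      agree : ∀ r l → l ≢ suc k → C′ r l ≡ C r l
      agree r zero    _   = sym (C0 r)
      agree r (suc l) l≢k = trans (cong (λ t → A r (suc l) + t * A r zero) (updateAt-minimal l k t (l≢k ∘ cong suc)))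
                              (sym (Ck r l))
      agree′ : ∀ r l → l ≢ suc k → C″ r l ≡ C r l
      agree′ r l l≢k = trans (column-kept C′ (λ r → A r zero) r l l≢k) (agree r l l≢k)
      at-k : ∀ r → C r (suc k) ≡ 1ℤ * C′ r (suc k) + t k * C″ r (suc k)
      at-k r = trans (Ck r k) (trans (one-times (A r (suc k)) (A r zero) (t k))
        (sym (cong₂ (λ u v → 1ℤ * (A r (suc k) + u * A r zero) + t k * v) (updateAt-updates k t)
          (column-updated C′ (suc k) (λ r → A r zero) r))))

  clear-row : ∀ A i → D (A [ zero ]≔ identity i) ≡ D (bordered i (minor A i zero))
  clear-row A i = sym (add-to-first n ℕ.≤-refl (λ k → - A i (suc k))
    (λ k n≤k → contradiction (Fin.toℕ<n k) (ℕ.≤⇒≯ n≤k))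
    (λ _ → refl) entry)
    where
    self : ∀ a → 0ℤ ≡ a + - a * 1ℤ
    self = solve-∀
    other : ∀ a b → a ≡ a + - b * 0ℤ
    other = solve-∀
    entry : ∀ r k → bordered i (minor A i zero) r (suc k) ≡ A r (suc k) + - A i (suc k) * identity i r
    entry r k with i Fin.≟ r
    ... | yes refl = trans (insertAt-lookup _ i 0ℤ)
                       (trans (self (A i (suc k))) (cong (λ x → A i (suc k) + - A i (suc k) * x) (sym (identity-diag i))))
    ... | no i≢r   = trans (trans (cong (insertAt (λ r → minor A i zero r k) i 0ℤ) (sym (Fin.punchIn-punchOut i≢r)))
                         (trans (insertAt-punchIn _ i 0ℤ _) (cong (λ r → A r (suc k)) (Fin.punchIn-punchOut i≢r))))
                       (trans (other (A r (suc k)) (A i (suc k)))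
                         (cong (λ x → A r (suc k) + - A i (suc k) * x) (sym (identity-off i≢r))))

  private
    cycle : Fin (suc n) → Matrix (suc n) (suc n)
    cycle i r zero    = identity i r
    cycle i r (suc c) = identity (punchIn i c) r

    -- Exchanging columns `zero` and `suc i` takes `cycle (suc i)` to `cycle (inject₁ i)`, so
    -- `toℕ i` swaps lead to the identity.
    cycle-sign : ∀ m i → toℕ i ≡ m → D (cycle i) ≡ sign m * D identity
    cycle-sign zero zero _ = trans (multilinear-cong-at lin zero
      λ where
        r zero    → identity-sym zero r
        r (suc c) → identity-sym (suc c) r)
      (sym (ℤ.*-identityˡ (D identity)))
    cycle-sign (suc m) (suc i) eq = begin
      D (cycle (suc i))         ≡⟨ swap-columns lin {zero} {suc i} (λ ()) (alt λ ()) {cycle (inject₁ i)}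
                                     (λ r → cong (λ j → identity j r) (sym (punchIn-inject₁ i)))
                                     (λ r → cong (λ j → identity j r) (punchIn-suc i))
                                     others ⟩
      - D (cycle (inject₁ i))   ≡⟨ cong -_ (cycle-sign m (inject₁ i) (trans (Fin.toℕ-inject₁ i) (ℕ.suc-injective eq))) ⟩
      - (sign m * D identity)   ≡⟨ ℤ.neg-distribˡ-* (sign m) (D identity) ⟩
      sign (suc m) * D identity ∎
      where
      open ≡-Reasoning
      others : ∀ r l → l ≢ zero → l ≢ suc i → cycle (suc i) r l ≡ cycle (inject₁ i) r l
      others r zero    l≢0 _   = contradiction refl l≢0
      others r (suc c) _   l≢i = cong (λ j → identity j r) (sym (punchIn-adjacent i c (l≢i ∘ cong suc)))

  bordered-identity : ∀ i → D (bordered i identity) ≡ sign (toℕ i) * D identity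
  bordered-identity i = trans (multilinear-cong-at lin zero λ where
    r zero    → refl
    r (suc c) → entry r c) (cycle-sign (toℕ i) i refl)
    where
    entry : ∀ r c → insertAt (λ r → identity r c) i 0ℤ r ≡ identity (punchIn i c) r
    entry r c with i Fin.≟ r
    ... | yes refl = trans (insertAt-lookup _ i 0ℤ) (sym (identity-off (Fin.punchInᵢ≢i i c)))
    ... | no i≢r   = trans (cong (insertAt (λ r → identity r c) i 0ℤ) (sym (Fin.punchIn-punchOut i≢r)))
                       (trans (insertAt-punchIn _ i 0ℤ _) (trans (sym (identity-punchIn i _ c))
                         (trans (cong (λ r → identity r (punchIn i c)) (Fin.punchIn-punchOut i≢r))
                           (identity-sym r (punchIn i c)))))

  bordered-multilinear : ∀ i → Multilinear (D ∘ bordered i)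
  bordered-multilinear i j s t {A} {B} {C} A≡C B≡C Cj = lin (suc j) s t
    (λ where
      r zero    _ → refl
      r (suc k) k≢j → insertAt-cong i (λ r → A≡C r k (k≢j ∘ cong suc)) r)
    (λ where
      r zero    _ → refl
      r (suc k) k≢j → insertAt-cong i (λ r → B≡C r k (k≢j ∘ cong suc)) r)
    entry
    where
    zeros : ∀ s t → 0ℤ ≡ s * 0ℤ + t * 0ℤ
    zeros = solve-∀
    entry : ∀ r → bordered i C r (suc j) ≡ s * bordered i A r (suc j) + t * bordered i B r (suc j)
    entry r with i Fin.≟ r
    ... | yes refl = trans (insertAt-lookup _ i 0ℤ) (trans (zeros s t)
                       (sym (cong₂ (λ a b → s * a + t * b) (insertAt-lookup _ i 0ℤ) (insertAt-lookup _ i 0ℤ))))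
    ... | no i≢r rewrite sym (Fin.punchIn-punchOut i≢r) =
      trans (insertAt-punchIn _ i 0ℤ _) (trans (Cj _)
        (sym (cong₂ (λ a b → s * a + t * b) (insertAt-punchIn _ i 0ℤ _) (insertAt-punchIn _ i 0ℤ _))))

  bordered-alternating : ∀ i → Alternating (D ∘ bordered i)
  bordered-alternating i {j} {k} {A} j≢k Aj≡Ak = alt (j≢k ∘ Fin.suc-injective) entry
    where
    entry : ∀ r → bordered i A r (suc j) ≡ bordered i A r (suc k)
    entry r with i Fin.≟ r
    ... | yes refl = trans (insertAt-lookup _ i 0ℤ) (sym (insertAt-lookup _ i 0ℤ))
    ... | no i≢r rewrite sym (Fin.punchIn-punchOut i≢r) =
      trans (insertAt-punchIn _ i 0ℤ _) (trans (Aj≡Ak _) (sym (insertAt-punchIn _ i 0ℤ _)))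

  -- The comparison for smaller matrices is passed in as `IH`, so that one induction can use this
  -- expansion both for `D` and for the determinant.
  expand-first-column : (∀ i B → D (bordered i B) ≡ detℤ B * D (bordered i identity)) → ∀ A →
    D A ≡ sum (λ i → A i zero * (detℤ (minor A i zero) * (sign (toℕ i) * D identity)))
  expand-first-column IH A = trans
    (column-sum lin zero (λ i → A i zero) identity (λ r → sym (sum-identity (λ i → A i zero) r)))
    (sum-cong-≗ λ i → cong (A i zero *_) (trans (clear-row A i) (trans (IH i (minor A i zero))
      (cong (detℤ (minor A i zero) *_) (bordered-identity i)))))

-- The expansion along the first column holds for D and for the determinant alike.
alternating-unique : ∀ {n} {D : Matrix n n → ℤ} → Congruent D → Multilinear D → Alternating D →
                     ∀ A → D A ≡ detℤ A * D identity
alternating-unique {zero} congr lin alt A = trans (congr λ ()) (sym (ℤ.*-identityˡ _))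
alternating-unique {suc n} {D} congr lin alt A = begin
  D A
    ≡⟨ expand-first-column lin alt (IH congr lin alt) A ⟩
  sum (λ i → A i zero * (detℤ (minor A i zero) * (sign (toℕ i) * D identity)))
    ≡⟨ sum-cong-≗ (λ i → factor (A i zero) (detℤ (minor A i zero)) (sign (toℕ i)) (D identity)) ⟩
  sum (λ i → (A i zero * (detℤ (minor A i zero) * (sign (toℕ i) * 1ℤ))) * D identity)
    ≡⟨ sym (*-distribʳ-sum (D identity) (λ i → A i zero * (detℤ (minor A i zero) * (sign (toℕ i) * 1ℤ)))) ⟩
  sum (λ i → A i zero * (detℤ (minor A i zero) * (sign (toℕ i) * 1ℤ))) * D identity
    ≡⟨ cong (λ d → sum (λ i → A i zero * (detℤ (minor A i zero) * (sign (toℕ i) * d))) * D identity) (sym (det-identity (suc n))) ⟩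
  sum (λ i → A i zero * (detℤ (minor A i zero) * (sign (toℕ i) * detℤ (identity {suc n})))) * D identity
    ≡⟨ cong (_* D identity) (sym (expand-first-column det-multilinear det-alternating
         (IH det-cong det-multilinear det-alternating) A)) ⟩
  detℤ A * D identity ∎
  where
  open ≡-Reasoning
  factor : ∀ a d s x → a * (d * (s * x)) ≡ (a * (d * (s * 1ℤ))) * x
  factor = solve-∀
  IH : ∀ {D : Matrix (suc n) (suc n) → ℤ} → Congruent D → Multilinear D → Alternating D →
       ∀ i B → D (bordered i B) ≡ detℤ B * D (bordered i identity)
  IH congr lin alt i B = alternating-unique
    (λ A≗B → congr (bordered-cong i A≗B))
    (bordered-multilinear lin alt i) (bordered-alternating lin alt i) B

-- The determinant is itself an alternating form, with value 1 at the identity. Set against the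
-- defining expansion along the first row, this gives invariance under transposition.
det-first-column : ∀ {n} (A : Matrix (suc n) (suc n)) →
                   detℤ A ≡ sum λ i → sign (toℕ i) * (A i zero * detℤ (minor A i zero))
det-first-column {n} A = trans
  (expand-first-column det-multilinear det-alternating
    (λ i B → alternating-unique (λ A≗B → det-cong (bordered-cong i A≗B))
      (bordered-multilinear det-multilinear det-alternating i)
      (bordered-alternating det-multilinear det-alternating i) B) A)
  (sum-cong-≗ λ i → trans (cong (λ d → A i zero * (detℤ (minor A i zero) * (sign (toℕ i) * d))) (det-identity (suc n)))
    (reorder (A i zero) (detℤ (minor A i zero)) (sign (toℕ i))))
  where
  reorder : ∀ a d s → a * (d * (s * 1ℤ)) ≡ s * (a * d)
  reorder = solve-∀

det-transpose : ∀ {n} (A : Matrix n n) → detℤ (A ᵀ) ≡ detℤ A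
det-transpose {zero}  A = refl
det-transpose {suc n} A = trans
  (sum-cong-≗ λ j → cong (λ d → sign (toℕ j) * (A j zero * d)) (det-transpose (minor A j zero)))
  (sym (det-first-column A))

-- As a function of the columns of `B` the left side is multilinear and alternating, and at the
-- identity it is `detℤ A`.
det-⊗ : ∀ {n} (A B : Matrix n n) → detℤ (A ⊗ B) ≡ detℤ A * detℤ B
det-⊗ {n} A B = begin
  detℤ (A ⊗ B)                    ≡⟨ alternating-unique {D = D} congr lin alt B ⟩
  detℤ B * detℤ (A ⊗ identity)    ≡⟨ cong (detℤ B *_) (det-cong λ r k → sum-identity (A r) k) ⟩
  detℤ B * detℤ A                 ≡⟨ ℤ.*-comm (detℤ B) (detℤ A) ⟩
  detℤ A * detℤ B                 ∎
  where
  open ≡-Reasoning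
  D : Matrix n n → ℤ
  D B = detℤ (A ⊗ B)
  congr : Congruent D
  congr B≗C = det-cong λ r k → sum-cong-≗ λ j → cong (A r j *_) (B≗C j k)
  distribute : ∀ a s t x y → a * (s * x + t * y) ≡ s * (a * x) + t * (a * y)
  distribute = solve-∀
  lin : Multilinear D
  lin j s t {X} {Y} X≡ Y≡ Cj = det-multilinear j s t
    (λ r k k≢j → sum-cong-≗ λ i → cong (A r i *_) (X≡ i k k≢j))
    (λ r k k≢j → sum-cong-≗ λ i → cong (A r i *_) (Y≡ i k k≢j))
    (λ r → trans (sum-cong-≗ λ i → trans (cong (A r i *_) (Cj i)) (distribute (A r i) s t (X i j) (Y i j)))
      (sum-linear s t (λ i → A r i * X i j) (λ i → A r i * Y i j)))
  alt : Alternating D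
  alt {j} {k} {X} j≢k Xj≡Xk = det-alternating {A = A ⊗ X} j≢k λ r → sum-cong-≗ λ i → cong (A r i *_) (Xj≡Xk i)

-- Once `b` is expanded in the columns of `A`, only column `j` contributes; any other one would
-- appear twice.
cramer : ∀ {n} (A : Matrix n n) x j b → (∀ r → (A ⊛ x) r ≡ b r) → detℤ (A [ j ]≔ b) ≡ x j * detℤ A
cramer {n} A x j b Ax≡b = begin
  detℤ (A [ j ]≔ b)
    ≡⟨ column-sum det-multilinear j x (A ᵀ) (λ r → trans (column-updated A j b r)
         (trans (sym (Ax≡b r)) (sum-cong-≗ λ i → ℤ.*-comm (A r i) (x i)))) ⟩
  sum (λ i → x i * detℤ ((A [ j ]≔ b) [ j ]≔ (A ᵀ) i))
    ≡⟨ sum-single (λ i → x i * detℤ ((A [ j ]≔ b) [ j ]≔ (A ᵀ) i)) j others ⟩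
  x j * detℤ ((A [ j ]≔ b) [ j ]≔ (A ᵀ) j)
    ≡⟨ cong (x j *_) (det-cong restored) ⟩
  x j * detℤ A ∎
  where
  open ≡-Reasoning
  kept : ∀ i r k → k ≢ j → ((A [ j ]≔ b) [ j ]≔ (A ᵀ) i) r k ≡ A r k
  kept i r k k≢j = trans (column-kept (A [ j ]≔ b) ((A ᵀ) i) r k k≢j) (column-kept A b r k k≢j)
  restored : ∀ r k → ((A [ j ]≔ b) [ j ]≔ (A ᵀ) j) r k ≡ A r k
  restored r k with k Fin.≟ j
  ... | yes refl = column-updated (A [ j ]≔ b) j ((A ᵀ) j) r
  ... | no k≢j   = kept j r k k≢j
  others : ∀ i → i ≢ j → x i * detℤ ((A [ j ]≔ b) [ j ]≔ (A ᵀ) i) ≡ 0ℤ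
  others i i≢j = trans (cong (x i *_) (det-alternating {j = j} {i} {(A [ j ]≔ b) [ j ]≔ (A ᵀ) i} (i≢j ∘ sym) λ r →
    trans (column-updated (A [ j ]≔ b) j ((A ᵀ) i) r) (sym (kept i r i i≢j)))) (ℤ.*-zeroʳ (x i))

infixl 7 _∙_
_∙_ : ∀ {n} → Vector ℤ n → Vector ℤ n → ℤ
x ∙ y = sum λ i → x i * y i

∙-cong : ∀ {n} {x x′ y y′ : Vector ℤ n} → (∀ i → x i ≡ x′ i) → (∀ i → y i ≡ y′ i) → x ∙ y ≡ x′ ∙ y′
∙-cong x≗ y≗ = sum-cong-≗ λ i → cong₂ _*_ (x≗ i) (y≗ i)

∙-comm : ∀ {n} (x y : Vector ℤ n) → x ∙ y ≡ y ∙ x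
∙-comm x y = sum-cong-≗ λ i → ℤ.*-comm (x i) (y i)

∙-linearʳ : ∀ {n} (x : Vector ℤ n) s t y z → x ∙ (λ i → s * y i + t * z i) ≡ s * (x ∙ y) + t * (x ∙ z)
∙-linearʳ x s t y z = trans (sum-cong-≗ λ i → distribute (x i) s t (y i) (z i))
  (sum-linear s t (λ i → x i * y i) (λ i → x i * z i))
  where
  distribute : ∀ a s t x y → a * (s * x + t * y) ≡ s * (a * x) + t * (a * y)
  distribute = solve-∀

∙-linearˡ : ∀ {n} s t (x y z : Vector ℤ n) → (λ i → s * x i + t * y i) ∙ z ≡ s * (x ∙ z) + t * (y ∙ z)
∙-linearˡ s t x y z = trans (∙-comm (λ i → s * x i + t * y i) z)
  (trans (∙-linearʳ z s t x y) (cong₂ (λ a b → s * a + t * b) (∙-comm z x) (∙-comm z y)))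

∙-scaleʳ : ∀ {n} (x : Vector ℤ n) s y → x ∙ (λ i → s * y i) ≡ s * (x ∙ y)
∙-scaleʳ x s y = trans (sum-cong-≗ λ i → swap (x i) s (y i)) (sym (*-distribˡ-sum s (λ i → x i * y i)))
  where
  swap : ∀ x s y → x * (s * y) ≡ s * (x * y)
  swap = solve-∀

∙-scaleˡ : ∀ {n} s (x y : Vector ℤ n) → (λ i → s * x i) ∙ y ≡ s * (x ∙ y)
∙-scaleˡ s x y = trans (sum-cong-≗ λ i → ℤ.*-assoc s (x i) (y i)) (sym (*-distribˡ-sum s (λ i → x i * y i)))

-- Divisibility and linear dependence modulo a prime

∣0 : ∀ {d} → d ∣ 0ℤ
∣0 = divides 0ℤ refl

∣-resp : ∀ {d a b} → a ≡ b → d ∣ a → d ∣ b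
∣-resp refl d∣a = d∣a

∣-sum : ∀ {n d} {f : Vector ℤ n} → (∀ i → d ∣ f i) → d ∣ sum f
∣-sum {zero}  d∣f = ∣0
∣-sum {suc n} d∣f = ∣m∣n⇒∣m+n (d∣f zero) (∣-sum (d∣f ∘ suc))

euclid : ∀ {p} → Prime p → ∀ a b → ℤ.+ p ∣ a * b → ℤ.+ p ∣ a ⊎ ℤ.+ p ∣ b
euclid pr a b p∣ab with euclidsLemma ℤ.∣ a ∣ ℤ.∣ b ∣ pr (subst (_ ℕ∣.∣_) (ℤ.abs-* a b) (∣⇒∣ᵤ p∣ab))
... | inj₁ p∣a = inj₁ (∣ᵤ⇒∣ p∣a)
... | inj₂ p∣b = inj₂ (∣ᵤ⇒∣ p∣b)

∣*-cancelˡ : ∀ {p} → Prime p → ∀ {a b} → ¬ ℤ.+ p ∣ a → ℤ.+ p ∣ a * b → ℤ.+ p ∣ b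
∣*-cancelˡ pr {a} {b} p∤a p∣ab with euclid pr a b p∣ab
... | inj₁ p∣a = contradiction p∣a p∤a
... | inj₂ p∣b = p∣b

∤*∤ : ∀ {p} → Prime p → ∀ {a b} → ¬ ℤ.+ p ∣ a → ¬ ℤ.+ p ∣ b → ¬ ℤ.+ p ∣ a * b
∤*∤ pr p∤a p∤b p∣ab = p∤b (∣*-cancelˡ pr p∤a p∣ab)

∤1 : ∀ {p} → Prime p → ¬ ℤ.+ p ∣ 1ℤ
∤1 pr p∣1 = contradiction (ℕ∣.∣1⇒≡1 (∣⇒∣ᵤ p∣1)) λ where refl → ¬prime[1] pr

Nontrivial : ∀ {n} → ℕ → Vector ℤ n → Set
Nontrivial p x = ∃ λ i → ¬ ℤ.+ p ∣ x i

-- Linear dependence of the rows over the field with `p` elements, with integers representing the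
-- coefficients.
Dependent : ∀ {k n} → ℕ → Matrix k n → Set
Dependent {k} p X = ∃ λ (y : Vector ℤ k) → Nontrivial p y × (∀ j → ℤ.+ p ∣ sum λ i → y i * X i j)

private
  -- The induction hypothesis as a type: `eliminate` takes it as an argument, and the recursion on
  -- `n` stays in `orthogonal⇒dependent`.
  Step : ℕ → ℕ → Set
  Step p n = ∀ k m (C : Matrix k n) (B : Matrix m n) → n ℕ.< k ℕ.+ m →
    (∀ i j → ℤ.+ p ∣ C i ∙ B j) → Dependent p C ⊎ Dependent p B

  -- Eliminate a column in which the first row of C has a unit.
  eliminate : ∀ {p} → Prime p → ∀ {n} → Step p n → ∀ k m (C : Matrix (suc k) (suc n)) (B : Matrix m (suc n)) →
    suc n ℕ.< suc k ℕ.+ m → (∀ i j → ℤ.+ p ∣ C i ∙ B j) → Dependent p C ⊎ Dependent p B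
  eliminate {p} pr {n} IH k m C B n<k+m C⊥B with Fin.any? (λ j → ¬? (ℤ.+ p ∣? C zero j))
  ... | no all = inj₁ (basis₀ , (zero , ∤1 pr) , λ j → ∣-resp (sym (only-first j))
                   (decidable-stable (ℤ.+ p ∣? C zero j) λ p∤ → all (j , p∤)))
    where
    basis₀ : Vector ℤ (suc k)
    basis₀ = identity zero
    only-first : ∀ j → sum (λ i → basis₀ i * C i j) ≡ C zero j
    only-first j = trans (sum-cong-≗ λ i → trans (ℤ.*-comm (basis₀ i) (C i j)) (cong (C i j *_) (identity-sym zero i)))
                     (sum-identity (λ i → C i j) zero)
  ... | yes (j , p∤a) with IH k m C′ B′ (ℕ.≤-pred n<k+m) C′⊥B′
    where
    a = C zero j
    C′ : Matrix k n
    -- Cross-multiplying with the pivot clears column `j` without division, so the entries of `B` in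
    -- that column drop out of the products.
    C′ i c = a * C (suc i) (punchIn j c) + - C (suc i) j * C zero (punchIn j c)
    B′ : Matrix m n
    B′ i c = B i (punchIn j c)
    combine : ∀ a b x s t → a * (b * x + s) + - b * (a * x + t) ≡ a * s + - b * t
    combine = solve-∀
    C′⊥B′ : ∀ i l → ℤ.+ p ∣ C′ i ∙ B′ l
    C′⊥B′ i l = ∣-resp (begin
      a * (C (suc i) ∙ B l) + - b * (C zero ∙ B l)
        ≡⟨ cong₂ (λ u v → a * u + - b * v) (sum-remove {i = j} (λ q → C (suc i) q * B l q))
             (sum-remove {i = j} (λ q → C zero q * B l q)) ⟩
      a * (b * B l j + c ∙ B′ l) + - b * (a * B l j + c₀ ∙ B′ l)
        ≡⟨ combine a b (B l j) (c ∙ B′ l) (c₀ ∙ B′ l) ⟩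
      a * (c ∙ B′ l) + - b * (c₀ ∙ B′ l)
        ≡⟨ sym (∙-linearˡ a (- b) c c₀ (B′ l)) ⟩
      C′ i ∙ B′ l ∎)
      (∣m∣n⇒∣m+n (∣n⇒∣m*n a (C⊥B (suc i) l)) (∣n⇒∣m*n (- b) (C⊥B zero l)))
      where
      open ≡-Reasoning
      b = C (suc i) j
      c c₀ : Vector ℤ n
      c q = C (suc i) (punchIn j q)
      c₀ q = C zero (punchIn j q)
  ... | inj₁ (y , (i , p∤yi) , yC′) = inj₁ (Y , (suc i , ∤*∤ pr p∤a p∤yi) , YC)
    where
    a = C zero j
    b : Vector ℤ k
    b i = C (suc i) j
    Y : Vector ℤ (suc k)
    -- The coefficient of the pivot row for which column `j` cancels exactly.
    Y zero    = - (y ∙ b)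
    Y (suc i) = a * y i
    term : ∀ a y u b g → y * (a * u + - b * g) ≡ a * (y * u) + - g * (y * b)
    term = solve-∀
    swap : ∀ a u g v → a * u + - g * v ≡ - v * g + a * u
    swap = solve-∀
    row : ∀ q → sum (λ i → y i * (a * C (suc i) q + - b i * C zero q)) ≡ sum (λ i → Y i * C i q)
    row q = begin
      sum (λ i → y i * (a * C (suc i) q + - b i * C zero q))
        ≡⟨ sum-cong-≗ (λ i → term a (y i) (C (suc i) q) (b i) (C zero q)) ⟩
      sum (λ i → a * (y i * C (suc i) q) + - C zero q * (y i * b i))
        ≡⟨ sum-linear a (- C zero q) (λ i → y i * C (suc i) q) (λ i → y i * b i) ⟩
      a * (y ∙ (λ i → C (suc i) q)) + - C zero q * (y ∙ b)
        ≡⟨ swap a (y ∙ (λ i → C (suc i) q)) (C zero q) (y ∙ b) ⟩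
      - (y ∙ b) * C zero q + a * (y ∙ (λ i → C (suc i) q))
        ≡⟨ cong (- (y ∙ b) * C zero q +_) (sym (∙-scaleˡ a y (λ i → C (suc i) q))) ⟩
      sum (λ i → Y i * C i q) ∎
      where open ≡-Reasoning
    vanish : ∀ y a b → y * (a * b + - b * a) ≡ 0ℤ
    vanish = solve-∀
    YC : ∀ q → ℤ.+ p ∣ sum λ i → Y i * C i q
    YC q with j Fin.≟ q
    ... | yes refl = ∣-resp (trans (sym (sum-zero λ i → vanish (y i) a (b i))) (row j)) ∣0
    ... | no j≢q   = subst (λ q → ℤ.+ p ∣ sum λ i → Y i * C i q) (Fin.punchIn-punchOut j≢q)
                       (∣-resp (row _) (yC′ (punchOut j≢q)))
  ... | inj₂ (y , y≢0 , yB′) = inj₂ (y , y≢0 , yB)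
    where
    a = C zero j
    S : Vector ℤ (suc n)
    S q = sum λ i → y i * B i q
    exchange : sum (λ i → y i * (C zero ∙ B i)) ≡ a * S j + sum (λ c → C zero (punchIn j c) * S (punchIn j c))
    exchange = begin
      sum (λ i → y i * (C zero ∙ B i))
        ≡⟨ sum-cong-≗ (λ i → sym (∙-scaleʳ (C zero) (y i) (B i))) ⟩
      sum (λ i → sum λ q → C zero q * (y i * B i q))
        ≡⟨ ∑-comm (λ i q → C zero q * (y i * B i q)) ⟩
      sum (λ q → sum λ i → C zero q * (y i * B i q))
        ≡⟨ sum-cong-≗ (λ q → sym (*-distribˡ-sum (C zero q) (λ i → y i * B i q))) ⟩
      sum (λ q → C zero q * S q)
        ≡⟨ sum-remove {i = j} (λ q → C zero q * S q) ⟩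
      a * S j + sum (λ c → C zero (punchIn j c) * S (punchIn j c)) ∎
      where open ≡-Reasoning
    yB : ∀ q → ℤ.+ p ∣ S q
    yB q with j Fin.≟ q
    -- Orthogonality to the pivot row expresses `a * S j` through the columns where `S` is already
    -- known to vanish.
    ... | yes refl = ∣*-cancelˡ pr p∤a (∣m+n∣n⇒∣m
                       (∣-resp exchange (∣-sum λ i → ∣n⇒∣m*n (y i) (C⊥B zero i)))
                       (∣-sum λ c → ∣n⇒∣m*n (C zero (punchIn j c)) (yB′ c)))
    ... | no j≢q   = subst (λ q → ℤ.+ p ∣ S q) (Fin.punchIn-punchOut j≢q) (yB′ (punchOut j≢q))

-- Over a field, orthogonal subspaces of n-space have dimensions adding up to at most n.
orthogonal⇒dependent : ∀ {p} → Prime p → ∀ {n k m} (C : Matrix k n) (B : Matrix m n) → n ℕ.< k ℕ.+ m →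
  (∀ i j → ℤ.+ p ∣ C i ∙ B j) → Dependent p C ⊎ Dependent p B
orthogonal⇒dependent {p} pr {n} {k} {m} = go n k m
  where
  go : ∀ n → Step p n
  go zero    (suc k) m       C B _     _   = inj₁ (const 1ℤ , (zero , ∤1 pr) , λ ())
  go zero    zero    (suc m) C B _     _   = inj₂ (const 1ℤ , (zero , ∤1 pr) , λ ())
  go (suc n) (suc k) m       C B n<k+m C⊥B = eliminate pr (go n) k m C B n<k+m C⊥B
  -- `C` has no row to pivot on, so the families change places; the empty one cannot be dependent.
  go (suc n) zero    (suc m) C B n<k+m C⊥B
    with eliminate pr (go n) m zero B C (ℕ.≤-trans n<k+m (ℕ.≤-reflexive (sym (ℕ.+-identityʳ (suc m))))) (λ _ ())
  ... | inj₁ depB = inj₂ depB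
  ... | inj₂ (_ , (() , _) , _)

-- Powers of a symmetric matrix

parity : ∀ x → ℤ.+ 2 ∣ x ⊎ ℤ.+ 2 ∣ x + - 1ℤ
parity x with x ℤ.%ℕ 2 | ℤ.a≡a%ℕn+[a/ℕn]*n x 2 | ℤ.n%ℕd<d x 2
... | 0 | x≡ | _ = inj₁ (divides (x ℤ./ℕ 2) (trans x≡ (ℤ.+-identityˡ _)))
... | 1 | x≡ | _ = inj₂ (divides (x ℤ./ℕ 2) (trans (cong (_+ - 1ℤ) x≡) (cancel (x ℤ./ℕ 2 * ℤ.+ 2))))
  where
  cancel : ∀ a → 1ℤ + a + - 1ℤ ≡ a
  cancel = solve-∀
... | suc (suc _) | _ | ℕ.s≤s (ℕ.s≤s ())

2∣x²-x : ∀ x → ℤ.+ 2 ∣ x * x + - x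
2∣x²-x x = ∣-resp (factor x) (go (parity x))
  where
  factor : ∀ x → x * (x + - 1ℤ) ≡ x * x + - x
  factor = solve-∀
  go : ℤ.+ 2 ∣ x ⊎ ℤ.+ 2 ∣ x + - 1ℤ → ℤ.+ 2 ∣ x * (x + - 1ℤ)
  go (inj₁ 2∣x)   = ∣m⇒∣m*n (x + - 1ℤ) 2∣x
  go (inj₂ 2∣x-1) = ∣n⇒∣m*n x 2∣x-1

Symmetric : ∀ {n} → Matrix n n → Set
Symmetric M = ∀ i j → M i j ≡ M j i

-- Off-diagonal terms come in equal pairs, and y² ≡ y modulo 2 on the diagonal. Both the handshake
-- lemma and the odd moments of the degree vector rest on this.
quadratic-parity : ∀ {n} {S : Matrix n n} → Symmetric S → ∀ y →
                   ℤ.+ 2 ∣ y ∙ (S ⊛ y) + - sum (λ i → S i i * y i)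
quadratic-parity {zero}  S-sym y = ∣0
quadratic-parity {suc n} {S} S-sym y = ∣-resp (sym split)
  (∣m∣n⇒∣m+n (∣m∣n⇒∣m+n (∣n⇒∣m*n s (2∣x²-x x)) (∣m⇒∣m*n (x * (r ∙ y′)) ∣-refl))
    (quadratic-parity {S = S′} (λ i j → S-sym (suc i) (suc j)) y′))
  where
  open ≡-Reasoning
  s = S zero zero
  x = y zero
  y′ r : Vector ℤ n
  y′ i = y (suc i)
  r i = S zero (suc i)
  S′ : Matrix n n
  S′ i j = S (suc i) (suc j)
  δ′ = sum λ i → S′ i i * y′ i
  lower : sum (λ i → y′ i * (S (suc i) zero * x + (S′ ⊛ y′) i)) ≡ x * (r ∙ y′) + 1ℤ * (y′ ∙ (S′ ⊛ y′))
  lower = trans (sum-cong-≗ λ i → trans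
      (cong (λ u → y′ i * (u * x + (S′ ⊛ y′) i)) (S-sym (suc i) zero)) (expand (y′ i) (r i) x ((S′ ⊛ y′) i)))
    (sum-linear x 1ℤ (λ i → r i * y′ i) (λ i → y′ i * (S′ ⊛ y′) i))
    where
    expand : ∀ y r x z → y * (r * x + z) ≡ x * (r * y) + 1ℤ * (y * z)
    expand = solve-∀
  collect : ∀ x s t u v → x * (s * x + t) + (x * t + 1ℤ * u) + - (s * x + v) ≡
            s * (x * x + - x) + ℤ.+ 2 * (x * t) + (u + - v)
  collect = solve-∀
  split : y ∙ (S ⊛ y) + - sum (λ i → S i i * y i) ≡
          s * (x * x + - x) + ℤ.+ 2 * (x * (r ∙ y′)) + (y′ ∙ (S′ ⊛ y′) + - δ′)
  split = trans (cong (λ u → x * (s * x + r ∙ y′) + u + - (s * x + δ′)) lower)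
            (collect x s (r ∙ y′) (y′ ∙ (S′ ⊛ y′)) δ′)

⊛-congʳ : ∀ {m n} (A : Matrix m n) {x y : Vector ℤ n} → (∀ i → x i ≡ y i) → ∀ r → (A ⊛ x) r ≡ (A ⊛ y) r
⊛-congʳ A x≗y r = sum-cong-≗ λ j → cong (A r j *_) (x≗y j)

⊛-linear : ∀ {m n} (A : Matrix m n) s t x y r →
           (A ⊛ (λ i → s * x i + t * y i)) r ≡ s * (A ⊛ x) r + t * (A ⊛ y) r
⊛-linear A s t x y r = ∙-linearʳ (A r) s t x y

adjoint : ∀ {m n} (A : Matrix m n) x y → x ∙ (A ⊛ y) ≡ (A ᵀ ⊛ x) ∙ y
adjoint A x y = begin
  sum (λ i → x i * sum (λ j → A i j * y j))    ≡⟨ sum-cong-≗ (λ i → *-distribˡ-sum (x i) (λ j → A i j * y j)) ⟩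
  sum (λ i → sum λ j → x i * (A i j * y j))    ≡⟨ ∑-comm (λ i j → x i * (A i j * y j)) ⟩
  sum (λ j → sum λ i → x i * (A i j * y j))    ≡⟨ sum-cong-≗ (λ j → sum-cong-≗ λ i → rotate (x i) (A i j) (y j)) ⟩
  sum (λ j → sum λ i → A i j * x i * y j)      ≡⟨ sum-cong-≗ (λ j → sym (*-distribʳ-sum (y j) (λ i → A i j * x i))) ⟩
  sum (λ j → sum (λ i → A i j * x i) * y j)    ∎
  where
  open ≡-Reasoning
  rotate : ∀ x a y → x * (a * y) ≡ a * x * y
  rotate = solve-∀

power : ∀ {n} → Matrix n n → ℕ → Vector ℤ n → Vector ℤ n
power M zero    x = x
power M (suc k) x = M ⊛ power M k x

power-suc : ∀ {n} (M : Matrix n n) k x → power M k (M ⊛ x) ≡ M ⊛ power M k x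
power-suc M zero    x = refl
power-suc M (suc k) x = cong (M ⊛_) (power-suc M k x)

power-+ : ∀ {n} (M : Matrix n n) j k x → power M (j ℕ.+ k) x ≡ power M j (power M k x)
power-+ M zero    k x = refl
power-+ M (suc j) k x = cong (M ⊛_) (power-+ M j k x)

power-cong : ∀ {n} (M : Matrix n n) k {x y : Vector ℤ n} → (∀ i → x i ≡ y i) → ∀ r → power M k x r ≡ power M k y r
power-cong M zero    x≗y = x≗y
power-cong M (suc k) x≗y = ⊛-congʳ M (power-cong M k x≗y)

power-linear : ∀ {n} (M : Matrix n n) k s t x y r →
               power M k (λ i → s * x i + t * y i) r ≡ s * power M k x r + t * power M k y r
power-linear M zero    s t x y r = refl
power-linear M (suc k) s t x y r = trans (⊛-congʳ M (power-linear M k s t x y) r)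
  (⊛-linear M s t (power M k x) (power M k y) r)

-- combination M u x h is the sum of x i · Mⁱ u over i < h, in Horner form.
combination : ∀ {n} → Matrix n n → Vector ℤ n → (ℕ → ℤ) → ℕ → Vector ℤ n
combination M u x zero    r = 0ℤ
combination M u x (suc h) r = x 0 * u r + 1ℤ * (M ⊛ combination M u (x ∘ suc) h) r

combination-sum : ∀ {n} (M : Matrix n n) u x h r →
                  combination M u x h r ≡ sum {h} (λ i → power M (toℕ i) u r * x (toℕ i))
combination-sum M u x zero    r = refl
combination-sum M u x (suc h) r = cong₂ _+_ (ℤ.*-comm (x 0) (u r)) (trans (ℤ.*-identityˡ _) (begin
  (M ⊛ combination M u (x ∘ suc) h) r
    ≡⟨ ⊛-congʳ M (combination-sum M u (x ∘ suc) h) r ⟩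
  M r ∙ ((λ i (j : Fin h) → power M (toℕ j) u i) ⊛ (λ j → x (suc (toℕ j))))
    ≡⟨ adjoint (λ i (j : Fin h) → power M (toℕ j) u i) (M r) (λ j → x (suc (toℕ j))) ⟩
  sum {h} (λ j → sum (λ i → power M (toℕ j) u i * M r i) * x (suc (toℕ j)))
    ≡⟨ sum-cong-≗ {h} (λ j → cong (_* x (suc (toℕ j))) (∙-comm (power M (toℕ j) u) (M r))) ⟩
  sum {h} (λ j → power M (suc (toℕ j)) u r * x (suc (toℕ j))) ∎))
  where open ≡-Reasoning

-- The coefficients of Σ xᵢ² M²ⁱ.
spread : (ℕ → ℤ) → ℕ → ℤ
spread x zero          = x 0 * x 0
spread x (suc zero)    = 0ℤ
spread x (suc (suc i)) = spread (x ∘ suc) i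

spread-double : ∀ x i → spread x (i ℕ.* 2) ≡ x i * x i
spread-double x zero    = refl
spread-double x (suc i) = spread-double (x ∘ suc) i

module SymmetricPowers {n} {M : Matrix n n} (M-sym : Symmetric M) where

  self-adjoint : ∀ x y → (M ⊛ x) ∙ y ≡ x ∙ (M ⊛ y)
  self-adjoint x y = sym (trans (adjoint M x y)
    (∙-cong {y = y} (λ r → sum-cong-≗ λ i → cong (_* x i) (M-sym i r)) (λ _ → refl)))

  power-self-adjoint : ∀ k x y → power M k x ∙ y ≡ x ∙ power M k y
  power-self-adjoint zero    x y = refl
  power-self-adjoint (suc k) x y = trans (self-adjoint (power M k x) y)
    (trans (power-self-adjoint k x (M ⊛ y)) (cong (x ∙_) (power-suc M k y)))

  moment-linearʳ : ∀ k x s t y z → x ∙ power M k (λ i → s * y i + t * z i) ≡ s * (x ∙ power M k y) + t * (x ∙ power M k z)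
  moment-linearʳ k x s t y z = trans (∙-cong {x = x} (λ _ → refl) (power-linear M k s t y z))
    (∙-linearʳ x s t (power M k y) (power M k z))

  moment-sym : ∀ k x y → x ∙ power M k y ≡ y ∙ power M k x
  moment-sym k x y = trans (∙-comm x (power M k y)) (power-self-adjoint k y x)

  moment-linearˡ : ∀ k s t x y z → (λ i → s * x i + t * y i) ∙ power M k z ≡ s * (x ∙ power M k z) + t * (y ∙ power M k z)
  moment-linearˡ k s t x y z = ∙-linearˡ s t x y (power M k z)

  even-combination : ∀ u w → (∀ k → ℤ.+ 2 ∣ w ∙ power M k u) → ∀ x h k →
                     ℤ.+ 2 ∣ w ∙ power M k (combination M u x h)
  even-combination u w even x zero    k = ∣-resp
    (sym (trans (sym (power-self-adjoint k w (λ _ → 0ℤ))) (sum-zero λ i → ℤ.*-zeroʳ (power M k w i)))) ∣0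
  even-combination u w even x (suc h) k = ∣-resp
    (sym (trans (moment-linearʳ k w (x 0) 1ℤ u (M ⊛ F))
      (cong (λ e → x 0 * (w ∙ power M k u) + 1ℤ * (w ∙ e)) (power-suc M k F))))
    (∣m∣n⇒∣m+n (∣n⇒∣m*n (x 0) (even k)) (∣n⇒∣m*n 1ℤ (even-combination u w even (x ∘ suc) h (suc k))))
    where F = combination M u (x ∘ suc) h

  module _ {u : Vector ℤ n} (even : ∀ k → ℤ.+ 2 ∣ u ∙ power M k u) where

    -- The cross terms of F · Mᵏ F come in equal even pairs.
    square-moments : ∀ x h k → let F = combination M u x h in
      ℤ.+ 4 ∣ u ∙ power M k (combination M u (spread x) (h ℕ.* 2)) + - (F ∙ power M k F)
    square-moments x zero    k = ∣-resp (sym (cong₂ (λ a b → a + - b) left right)) ∣0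
      where
      0⃗ : Vector ℤ n
      0⃗ _ = 0ℤ
      left : u ∙ power M k 0⃗ ≡ 0ℤ
      left = trans (sym (power-self-adjoint k u 0⃗)) (sum-zero λ i → ℤ.*-zeroʳ (power M k u i))
      right : 0⃗ ∙ power M k 0⃗ ≡ 0ℤ
      right = sum-zero λ i → ℤ.*-zeroˡ (power M k 0⃗ i)
    -- Splitting off the leading coefficient moves one factor M out of each `F`, hence `2 + k`,
    -- matched by the two positions that `spread` advances. The cross term is twice an even number.
    square-moments x (suc h) k = ∣-resp (sym (trans (cong₂ (λ a b → a + - b) left right)
        (collect (x 0) μ (u ∙ power M (2 ℕ.+ k) S) (F ∙ power M (2 ℕ.+ k) F) (u ∙ power M (suc k) F))))
      (∣m∣n⇒∣m-n (square-moments (x ∘ suc) h (2 ℕ.+ k))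
        (∣n⇒∣m*n (x 0) (*-monoʳ-∣ (ℤ.+ 2) (even-combination u u even (x ∘ suc) h (suc k)))))
      where
      μ = u ∙ power M k u
      F = combination M u (x ∘ suc) h
      S = combination M u (spread (x ∘ suc)) (h ℕ.* 2)
      S₁ : Vector ℤ n
      S₁ r = 0ℤ * u r + 1ℤ * (M ⊛ S) r
      collect : ∀ x μ s f e → (x * x) * μ + 1ℤ * (0ℤ * e + 1ℤ * s) + - (x * (x * μ + 1ℤ * e) + 1ℤ * (x * e + 1ℤ * f)) ≡
                (s + - f) + - (x * (ℤ.+ 2 * e))
      collect = solve-∀
      shift : ∀ z → u ∙ power M k (M ⊛ z) ≡ u ∙ power M (suc k) z
      shift z = cong (u ∙_) (power-suc M k z)
      left : u ∙ power M k (combination M u (spread x) (suc h ℕ.* 2)) ≡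
             (x 0 * x 0) * μ + 1ℤ * (0ℤ * (u ∙ power M (suc k) F) + 1ℤ * (u ∙ power M (2 ℕ.+ k) S))
      left = trans (moment-linearʳ k u (x 0 * x 0) 1ℤ u (M ⊛ S₁))
        (cong (λ e → (x 0 * x 0) * μ + 1ℤ * e) (trans (shift S₁)
          (trans (moment-linearʳ (suc k) u 0ℤ 1ℤ u (M ⊛ S))
            (cong₂ (λ a b → a + 1ℤ * b)
              (trans (ℤ.*-zeroˡ (u ∙ power M (suc k) u)) (sym (ℤ.*-zeroˡ (u ∙ power M (suc k) F))))
              (cong (u ∙_) (power-suc M (suc k) S))))))
      right : combination M u x (suc h) ∙ power M k (combination M u x (suc h)) ≡
              x 0 * (x 0 * μ + 1ℤ * (u ∙ power M (suc k) F)) +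
              1ℤ * (x 0 * (u ∙ power M (suc k) F) + 1ℤ * (F ∙ power M (2 ℕ.+ k) F))
      right = trans (moment-linearˡ k (x 0) 1ℤ u (M ⊛ F) G)
        (cong₂ (λ a b → x 0 * a + 1ℤ * b)
          (trans (moment-linearʳ k u (x 0) 1ℤ u (M ⊛ F)) (cong (λ e → x 0 * μ + 1ℤ * e) (shift F)))
          (trans (moment-linearʳ k (M ⊛ F) (x 0) 1ℤ u (M ⊛ F))
            (cong₂ (λ a b → x 0 * a + 1ℤ * b)
              (trans (self-adjoint F (power M k u)) (moment-sym (suc k) F u))
              (trans (self-adjoint F (power M k (M ⊛ F))) (cong (λ v → F ∙ (M ⊛ v)) (power-suc M k F))))))
        where G = combination M u x (suc h)

-- Kernels, inverses and Gram matrices over the integers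

∣*-cancelʳ : ∀ {p} → Prime p → ∀ {a b} → ¬ ℤ.+ p ∣ b → ℤ.+ p ∣ a * b → ℤ.+ p ∣ a
∣*-cancelʳ pr {a} {b} p∤b p∣ab = ∣*-cancelˡ pr p∤b (∣-resp (ℤ.*-comm a b) p∣ab)

∤⇒≢0 : ∀ {d a} → ¬ d ∣ a → a ≢ 0ℤ
∤⇒≢0 d∤a refl = d∤a ∣0

*≢0 : ∀ {a b} → a ≢ 0ℤ → b ≢ 0ℤ → a * b ≢ 0ℤ
*≢0 {a} a≢0 b≢0 ab≡0 with ℤ.i*j≡0⇒i≡0∨j≡0 a ab≡0
... | inj₁ a≡0 = a≢0 a≡0
... | inj₂ b≡0 = b≢0 b≡0

scale-column : ∀ {n} (A : Matrix n n) j e b → (∀ r → A r j ≡ e * b r) → detℤ A ≡ e * detℤ (A [ j ]≔ b)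
scale-column A j e b Aj≡eb = trans
  (det-multilinear j e 0ℤ {A [ j ]≔ b} {A [ j ]≔ b} {A} (column-kept A b) (column-kept A b)
    λ r → trans (Aj≡eb r) (trans (cong (e *_) (sym (column-updated A j b r))) (plus-zero e ((A [ j ]≔ b) r j))))
  (sym (plus-zero e (detℤ (A [ j ]≔ b))))
  where
  plus-zero : ∀ e x → e * x ≡ e * x + 0ℤ * x
  plus-zero = solve-∀

updated-twice : ∀ {m n} (A : Matrix m n) j x y r k → ((A [ j ]≔ x) [ j ]≔ y) r k ≡ (A [ j ]≔ y) r k
updated-twice A j x y r k with k Fin.≟ j
... | yes refl = trans (column-updated (A [ j ]≔ x) j y r) (sym (column-updated A j y r))
... | no k≢j   = trans (column-kept (A [ j ]≔ x) y r k k≢j)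
                   (trans (column-kept A x r k k≢j) (sym (column-kept A y r k k≢j)))

-- Pulling `e` out of the replaced column turns divisibility of the right-hand side into
-- divisibility of `x j * detℤ A`; the values needed are 0, p and p².
scaled-cramer : ∀ {n} (A : Matrix n n) x j e b → (∀ r → (A ⊛ x) r ≡ e * b r) →
                e * detℤ (A [ j ]≔ b) ≡ x j * detℤ A
scaled-cramer A x j e b Ax≡eb = begin
  e * detℤ (A [ j ]≔ b)                           ≡⟨ cong (e *_) (sym (det-cong (updated-twice A j eb b))) ⟩
  e * detℤ ((A [ j ]≔ eb) [ j ]≔ b)               ≡⟨ sym (scale-column (A [ j ]≔ eb) j e b (column-updated A j eb)) ⟩
  detℤ (A [ j ]≔ eb)                              ≡⟨ cramer A x j eb Ax≡eb ⟩
  x j * detℤ A                                    ∎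
  where
  open ≡-Reasoning
  eb : Vector ℤ _
  eb r = e * b r

kernel-trivial : ∀ {n} (A : Matrix n n) → detℤ A ≢ 0ℤ → ∀ x → (∀ r → (A ⊛ x) r ≡ 0ℤ) → ∀ j → x j ≡ 0ℤ
kernel-trivial A det≢0 x Ax≡0 j
  with ℤ.i*j≡0⇒i≡0∨j≡0 (x j) (trans (sym (scaled-cramer A x j 0ℤ (const 0ℤ) Ax≡0)) (ℤ.*-zeroˡ (detℤ (A [ j ]≔ const 0ℤ))))
... | inj₁ xj≡0  = xj≡0
... | inj₂ det≡0 = contradiction det≡0 det≢0

kernel-trivial-mod : ∀ {p n} → Prime p → (A : Matrix n n) → ¬ ℤ.+ p ∣ detℤ A → ∀ x → (∀ r → ℤ.+ p ∣ (A ⊛ x) r) →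
                     ∀ j → ℤ.+ p ∣ x j
kernel-trivial-mod {p} pr A p∤det x p∣Ax j = ∣*-cancelʳ pr p∤det
  (∣-resp (scaled-cramer A x j (ℤ.+ p) b λ r → trans (_∣_.equality (p∣Ax r)) (ℤ.*-comm (b r) (ℤ.+ p)))
    (∣m⇒∣m*n _ ∣-refl))
  where
  b : Vector ℤ _
  b r = quotient (p∣Ax r)

product : ∀ {n} → Vector ℤ n → ℤ
product {zero}  ρ = 1ℤ
product {suc n} ρ = ρ zero * product (ρ ∘ suc)

product≢0 : ∀ {n} {ρ : Vector ℤ n} → (∀ i → ρ i ≢ 0ℤ) → product ρ ≢ 0ℤ
product≢0 {zero}  ρ≢0 ()
product≢0 {suc n} ρ≢0 = *≢0 (ρ≢0 zero) (product≢0 (ρ≢0 ∘ suc))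

det-scale-rows : ∀ {n} (ρ : Vector ℤ n) (A : Matrix n n) → detℤ (λ i j → ρ i * A i j) ≡ product ρ * detℤ A
det-scale-rows {zero}  ρ A = refl
det-scale-rows {suc n} ρ A = trans
  (sum-cong-≗ λ j → trans (cong (λ d → sign (toℕ j) * (ρ zero * A zero j * d)) (det-scale-rows (ρ ∘ suc) (minor A zero j)))
    (factor (sign (toℕ j)) (ρ zero) (A zero j) (product (ρ ∘ suc)) (detℤ (minor A zero j))))
  (sym (*-distribˡ-sum (product ρ) (λ j → sign (toℕ j) * (A zero j * detℤ (minor A zero j)))))
  where
  factor : ∀ s r a q d → s * (r * a * (q * d)) ≡ r * q * (s * (a * d))
  factor = solve-∀

⊗-⊛ : ∀ {m n p} (A : Matrix m n) (B : Matrix n p) x r → (A ⊛ B ⊛ x) r ≡ (A ⊗ B ⊛ x) r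
⊗-⊛ A B x r = trans (adjoint B (A r) x) (∙-cong {y = x} (λ k → ∙-comm (λ j → B j k) (A r)) (λ _ → refl))

⊗-assoc : ∀ {m n p q} (A : Matrix m n) (B : Matrix n p) (C : Matrix p q) i k →
          (A ⊗ (B ⊗ C)) i k ≡ ((A ⊗ B) ⊗ C) i k
⊗-assoc A B C i k = ⊗-⊛ A B (λ j → C j k) i

-- The difference `R` of the two sides satisfies R A = A (B A) - e A = 0, so its rows lie in the
-- kernel of the transpose of `A`.
left-inverse⇒right-inverse : ∀ {n} (A B : Matrix n n) e → detℤ A ≢ 0ℤ →
  (∀ i j → (B ⊗ A) i j ≡ e * identity i j) → ∀ i j → (A ⊗ B) i j ≡ e * identity i j
left-inverse⇒right-inverse {n} A B e det≢0 BA≡e i j = begin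
  (A ⊗ B) i j                          ≡⟨ split ((A ⊗ B) i j) (e * identity i j) ⟩
  R i j + e * identity i j             ≡⟨ cong (_+ e * identity i j) (R≡0 i j) ⟩
  0ℤ + e * identity i j                ≡⟨ ℤ.+-identityˡ _ ⟩
  e * identity i j                     ∎
  where
  open ≡-Reasoning
  split : ∀ a b → a ≡ (1ℤ * a + - 1ℤ * b) + b
  split = solve-∀
  cancel : ∀ a e → 1ℤ * (e * a) + - 1ℤ * (e * a) ≡ 0ℤ
  cancel = solve-∀
  R : Matrix n n
  R i j = 1ℤ * (A ⊗ B) i j + - 1ℤ * (e * identity i j)
  RA≡0 : ∀ i k → (A ᵀ ⊛ R i) k ≡ 0ℤ
  RA≡0 i k = begin
    (A ᵀ) k ∙ R i
      ≡⟨ ∙-linearʳ ((A ᵀ) k) 1ℤ (- 1ℤ) ((A ⊗ B) i) (λ j → e * identity i j) ⟩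
    1ℤ * ((A ᵀ) k ∙ (A ⊗ B) i) + - 1ℤ * ((A ᵀ) k ∙ (λ j → e * identity i j))
      ≡⟨ cong₂ (λ u v → 1ℤ * u + - 1ℤ * v)
           (trans (∙-comm ((A ᵀ) k) ((A ⊗ B) i)) (trans (sym (⊗-assoc A B A i k))
             (trans (∙-cong {x = A i} (λ _ → refl) (λ j → BA≡e j k))
               (trans (∙-scaleʳ (A i) e (λ j → identity j k)) (cong (e *_) (sum-identity (A i) k))))))
           (trans (∙-scaleʳ ((A ᵀ) k) e (identity i))
             (cong (e *_) (trans (sum-cong-≗ λ j → cong (A j k *_) (identity-sym i j)) (sum-identity (λ j → A j k) i)))) ⟩
    1ℤ * (e * A i k) + - 1ℤ * (e * A i k)
      ≡⟨ cancel (A i k) e ⟩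
    0ℤ ∎
  R≡0 : ∀ i j → R i j ≡ 0ℤ
  R≡0 i = kernel-trivial (A ᵀ) (det≢0 ∘ trans (sym (det-transpose A))) (R i) (RA≡0 i)

adjugate : ∀ {n} → Matrix n n → Matrix n n
adjugate A j k = detℤ (A [ j ]≔ identity k)

-- Weighted by the entries of column `j`, the unit vectors placed in column `i` add up to column `j`
-- of `A`, to which Cramer's rule applies.
adjugate-left-inverse : ∀ {n} (A : Matrix n n) i j → (adjugate A ⊗ A) i j ≡ detℤ A * identity i j
adjugate-left-inverse A i j = begin
  sum (λ r → detℤ (A [ i ]≔ identity r) * A r j)
    ≡⟨ sum-cong-≗ (λ r → trans (ℤ.*-comm _ (A r j)) (cong (A r j *_) (sym (det-cong (updated-twice A i (λ r → A r j) (identity r)))))) ⟩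
  sum (λ r → A r j * detℤ ((A [ i ]≔ (λ r → A r j)) [ i ]≔ identity r))
    ≡⟨ sym (column-sum det-multilinear i (λ r → A r j) identity (λ r → trans (column-updated A i (λ r → A r j) r)
         (sym (sum-identity (λ r → A r j) r)))) ⟩
  detℤ (A [ i ]≔ (λ r → A r j))
    ≡⟨ cramer A (λ k → identity k j) i (λ r → A r j) (λ r → sum-identity (A r) j) ⟩
  identity i j * detℤ A
    ≡⟨ ℤ.*-comm (identity i j) (detℤ A) ⟩
  detℤ A * identity i j ∎
  where open ≡-Reasoning

-- Here `q` will be 2 to the power ⌊n/2⌋, and `ρ` lists factors 2 common to the rows of the Gram
-- matrix, with a leading 1 if n is odd. Either way their product is q², the full power of 2 in (det
-- W)², and this is what makes det Q odd.
module Gram {n} {W Q : Matrix n n} {ρ : Vector ℤ n} (WW≡ρQ : ∀ i j → (W ᵀ ⊗ W) i j ≡ ρ i * Q i j)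
  {z q} (detW : detℤ W ≡ z * q) (Πρ : product ρ ≡ q * q) (q≢0 : q ≢ 0ℤ) (z-odd : ¬ ℤ.+ 2 ∣ z) where

  det-gram : detℤ Q ≡ z * z
  det-gram = ℤ.*-cancelˡ-≡ (q * q) (detℤ Q) (z * z) {{ℤ.≢-nonZero (*≢0 q≢0 q≢0)}} (begin
    q * q * detℤ Q                   ≡⟨ cong (_* detℤ Q) (sym Πρ) ⟩
    product ρ * detℤ Q               ≡⟨ sym (det-scale-rows ρ Q) ⟩
    detℤ (λ i j → ρ i * Q i j)       ≡⟨ sym (det-cong WW≡ρQ) ⟩
    detℤ (W ᵀ ⊗ W)                   ≡⟨ det-⊗ (W ᵀ) W ⟩
    detℤ (W ᵀ) * detℤ W              ≡⟨ cong (_* detℤ W) (det-transpose W) ⟩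
    detℤ W * detℤ W                  ≡⟨ cong₂ _*_ detW detW ⟩
    z * q * (z * q)                  ≡⟨ rearrange z q ⟩
    q * q * (z * z)                  ∎)
    where
    open ≡-Reasoning
    rearrange : ∀ z q → z * q * (z * q) ≡ q * q * (z * z)
    rearrange = solve-∀

  module _ (2-prime : Prime 2) where

    detQ-odd : ¬ ℤ.+ 2 ∣ detℤ Q
    detQ-odd 2∣det = ∤*∤ 2-prime z-odd z-odd (∣-resp det-gram 2∣det)

    detW≢0 : detℤ W ≢ 0ℤ
    detW≢0 det≡0 = *≢0 (∤⇒≢0 z-odd) q≢0 (trans (sym detW) det≡0)

    -- Cancelling `ρ i` in each row leaves Q x ≡ 0 modulo 2, where Q has trivial kernel.
    even-coefficients : ∀ x → (∀ i → ρ i ≢ 0ℤ) → (∀ i → ρ i * ℤ.+ 2 ∣ (W ᵀ ⊛ W ⊛ x) i) → ∀ j → ℤ.+ 2 ∣ x j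
    even-coefficients x ρ≢0 2ρ∣ = kernel-trivial-mod 2-prime Q detQ-odd x λ i →
      *-cancelˡ-∣ (ρ i) {{ℤ.≢-nonZero (ρ≢0 i)}} (∣-resp (begin
        (W ᵀ ⊛ W ⊛ x) i                ≡⟨ ⊗-⊛ (W ᵀ) W x i ⟩
        (W ᵀ ⊗ W ⊛ x) i                ≡⟨ sum-cong-≗ (λ j → trans (cong (_* x j) (WW≡ρQ i j)) (ℤ.*-assoc (ρ i) (Q i j) (x j))) ⟩
        sum (λ j → ρ i * (Q i j * x j)) ≡⟨ sym (*-distribˡ-sum (ρ i) (λ j → Q i j * x j)) ⟩
        ρ i * (Q ⊛ x) i                ∎) (2ρ∣ i))
      where open ≡-Reasoning

    -- W adj(Q) Wᵀ = 2 det(Q) because it agrees with 2 det(Q) on the columns of W.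
    even-vector : (∀ i → ρ i ≡ ℤ.+ 2) → ∀ y → (∀ i → ℤ.+ 4 ∣ (W ᵀ ⊛ y) i) → ∀ r → ℤ.+ 2 ∣ y r
    even-vector ρ≡2 y 4∣Wy r = ∣*-cancelˡ 2-prime detQ-odd (*-cancelˡ-∣ (ℤ.+ 2)
      (∣-resp (begin
        (W ⊛ adjugate Q ⊛ W ᵀ ⊛ y) r            ≡⟨ ⊛-congʳ W (⊗-⊛ (adjugate Q) (W ᵀ) y) r ⟩
        (W ⊛ adjugate Q ⊗ W ᵀ ⊛ y) r            ≡⟨ ⊗-⊛ W (adjugate Q ⊗ W ᵀ) y r ⟩
        (W ⊗ (adjugate Q ⊗ W ᵀ) ⊛ y) r          ≡⟨ sum-cong-≗ (λ k → cong (_* y k) (inverse r k)) ⟩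
        sum (λ k → e * identity r k * y k)      ≡⟨ sum-cong-≗ (λ k → rotate e (identity r k) (y k)) ⟩
        sum (λ k → e * (y k * identity r k))    ≡⟨ sym (*-distribˡ-sum e (λ k → y k * identity r k)) ⟩
        e * sum (λ k → y k * identity r k)      ≡⟨ cong (e *_) (trans (sum-cong-≗ λ k → cong (y k *_) (identity-sym r k)) (sum-identity y r)) ⟩
        ℤ.+ 2 * detℤ Q * y r                    ≡⟨ ℤ.*-assoc (ℤ.+ 2) (detℤ Q) (y r) ⟩
        ℤ.+ 2 * (detℤ Q * y r)                  ∎)
        (∣-sum λ k → ∣n⇒∣m*n (W r k) (∣-sum λ j → ∣n⇒∣m*n (adjugate Q k j) (4∣Wy j)))))
      where
      open ≡-Reasoning
      e = ℤ.+ 2 * detℤ Q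
      rotate : ∀ e i y → e * i * y ≡ e * (y * i)
      rotate = solve-∀
      inverse : ∀ i j → (W ⊗ (adjugate Q ⊗ W ᵀ)) i j ≡ e * identity i j
      inverse = left-inverse⇒right-inverse W (adjugate Q ⊗ W ᵀ) e detW≢0 λ i j → begin
        ((adjugate Q ⊗ W ᵀ) ⊗ W) i j                   ≡⟨ sym (⊗-assoc (adjugate Q) (W ᵀ) W i j) ⟩
        (adjugate Q ⊗ (W ᵀ ⊗ W)) i j                   ≡⟨ ∙-cong {x = adjugate Q i} (λ _ → refl)
                                                            (λ k → trans (WW≡ρQ k j) (cong (_* Q k j) (ρ≡2 k))) ⟩
        adjugate Q i ∙ (λ k → ℤ.+ 2 * Q k j)           ≡⟨ ∙-scaleʳ (adjugate Q i) (ℤ.+ 2) (λ k → Q k j) ⟩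
        ℤ.+ 2 * (adjugate Q ⊗ Q) i j                   ≡⟨ cong (ℤ.+ 2 *_) (adjugate-left-inverse Q i j) ⟩
        ℤ.+ 2 * (detℤ Q * identity i j)                ≡⟨ sym (ℤ.*-assoc (ℤ.+ 2) (detℤ Q) (identity i j)) ⟩
        e * identity i j                               ∎

-- An odd prime dividing the determinant exactly once

prime-square-cancel : ∀ {p} → Prime p → ∀ {a b} → ¬ ℤ.+ p ∣ a → ℤ.+ p * ℤ.+ p ∣ a * b → ℤ.+ p * ℤ.+ p ∣ b
prime-square-cancel {p} pr {a} {b} p∤a pp∣ab
  with divides q refl ← ∣*-cancelˡ pr p∤a (∣-trans (∣n⇒∣m*n (ℤ.+ p) ∣-refl) pp∣ab)
  = *-monoˡ-∣ (ℤ.+ p) (∣*-cancelˡ pr p∤a (*-cancelʳ-∣ (ℤ.+ p) {{ℤ.≢-nonZero +p≢0}}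
      (∣-resp (sym (ℤ.*-assoc a q (ℤ.+ p))) pp∣ab)))
  where
  +p≢0 : ℤ.+ p ≢ 0ℤ
  +p≢0 refl = contradiction pr ¬prime[0]

-- A kernel vector x of W modulo p and the coordinates z of v in the columns of W would be independent
-- eigenvectors, for one eigenvalue, of the companion matrix of M modulo p; but its eigenspaces are lines.
module OddLevel {p} (pr : Prime p) {m} {M W : Matrix (suc m) (suc m)} (M-sym : Symmetric M)
  (γ : Vector ℤ m) (γ-unit : ∀ k → ¬ ℤ.+ p ∣ γ k)
  (shift : ∀ k r → (M ⊛ (λ r → W r (inject₁ k))) r ≡ γ k * W r (suc k))
  (pp∤det : ¬ ℤ.+ p * ℤ.+ p ∣ detℤ W)
  {v : Vector ℤ (suc m)} (v≢0 : Nontrivial p v)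
  (v⊥W : ∀ k → ℤ.+ p ∣ v ∙ (λ r → W r k)) (Mv⊥W : ∀ k → ℤ.+ p ∣ (M ⊛ v) ∙ (λ r → W r k))
  (pp∣vv : ℤ.+ p * ℤ.+ p ∣ v ∙ v) (pp∣vMv : ℤ.+ p * ℤ.+ p ∣ v ∙ (M ⊛ v)) where

  open SymmetricPowers M-sym

  private
    n = suc m
    P = ℤ.+ p

    v-row : Matrix 1 n
    v-row _ = v

    v-row-independent : ¬ Dependent p v-row
    v-row-independent (y , (zero , p∤y) , p∣yv) = proj₂ v≢0
      (∣*-cancelˡ pr p∤y (∣-resp (ℤ.+-identityʳ _) (p∣yv (proj₁ v≢0))))

    -- Replacing column `j` by W x / p takes one factor p out of the determinant. As `u` avoids that
    -- column, it stays a kernel vector and takes out a second factor at `k` unless p divides `u k`.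
    -- So the kernel modulo p is a line.
    two-kernel-vectors : ∀ x j → ¬ P ∣ x j → (∀ r → P ∣ (W ⊛ x) r) →
                         ∀ u k → u j ≡ 0ℤ → (∀ r → P ∣ (W ⊛ u) r) → P ∣ u k
    two-kernel-vectors x j p∤xj Wx u k uj≡0 Wu with P ∣? u k
    ... | yes p∣uk = p∣uk
    ... | no p∤uk  = contradiction (prime-square-cancel pr (∤*∤ pr p∤uk p∤xj) (divides d₂ (begin
      u k * x j * detℤ W         ≡⟨ ℤ.*-assoc (u k) (x j) (detℤ W) ⟩
      u k * (x j * detℤ W)       ≡⟨ cong (u k *_) (sym (scaled-cramer W x j P b (at-p Wx))) ⟩
      u k * (P * d₁)             ≡⟨ rotate (u k) P d₁ ⟩
      P * (u k * d₁)             ≡⟨ cong (P *_) (sym (scaled-cramer W₁ u k P b′ W₁u)) ⟩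
      P * (P * d₂)               ≡⟨ regroup P d₂ ⟩
      d₂ * (P * P)               ∎))) pp∤det
      where
      open ≡-Reasoning
      rotate : ∀ u p d → u * (p * d) ≡ p * (u * d)
      rotate = solve-∀
      regroup : ∀ p d → p * (p * d) ≡ d * (p * p)
      regroup = solve-∀
      at-p : ∀ {x : Vector ℤ n} (p∣x : ∀ r → P ∣ x r) r → x r ≡ P * quotient (p∣x r)
      at-p p∣x r = trans (_∣_.equality (p∣x r)) (ℤ.*-comm (quotient (p∣x r)) P)
      b b′ : Vector ℤ n
      b r = quotient (Wx r)
      b′ r = quotient (Wu r)
      W₁ = W [ j ]≔ b
      d₁ = detℤ W₁
      d₂ = detℤ (W₁ [ k ]≔ b′)
      W₁u : ∀ r → (W₁ ⊛ u) r ≡ P * b′ r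
      W₁u r = trans (sum-cong-≗ same) (at-p Wu r)
        where
        same : ∀ i → W₁ r i * u i ≡ W r i * u i
        same i with i Fin.≟ j
        ... | yes refl = trans (cong (W₁ r i *_) uj≡0) (trans (ℤ.*-zeroʳ (W₁ r i))
                           (sym (trans (cong (W r i *_) uj≡0) (ℤ.*-zeroʳ (W r i)))))
        ... | no i≢j   = cong (_* u i) (column-kept W b r i i≢j)

    -- The row `v` and the n columns of W are one vector too many for two independent orthogonal
    -- families.
    kernel-vector : ∃ λ x → Nontrivial p x × (∀ r → P ∣ (W ⊛ x) r)
    kernel-vector with orthogonal⇒dependent pr v-row (W ᵀ) (ℕ.n<1+n n) (λ _ → v⊥W)
    ... | inj₁ dep              = contradiction dep v-row-independent
    ... | inj₂ (x , x≢0 , p∣xW) = x , x≢0 , λ r → ∣-resp (∙-comm x (W r)) (p∣xW r)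

    x : Vector ℤ n
    x = proj₁ kernel-vector
    j : Fin n
    j = proj₁ (proj₁ (proj₂ kernel-vector))
    p∤xj : ¬ P ∣ x j
    p∤xj = proj₂ (proj₁ (proj₂ kernel-vector))
    p∣Wx : ∀ r → P ∣ (W ⊛ x) r
    p∣Wx = proj₂ (proj₂ kernel-vector)

    other-columns : Matrix m n
    other-columns i r = W r (punchIn j i)

    padded : ∀ (y : Vector ℤ m) r → (W ⊛ insertAt y j 0ℤ) r ≡ sum λ i → y i * other-columns i r
    padded y r = begin
      (W ⊛ insertAt y j 0ℤ) r
        ≡⟨ sum-remove {i = j} (λ k → W r k * insertAt y j 0ℤ k) ⟩
      W r j * insertAt y j 0ℤ j + sum (λ i → W r (punchIn j i) * insertAt y j 0ℤ (punchIn j i))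
        ≡⟨ cong₂ _+_ (trans (cong (W r j *_) (insertAt-lookup y j 0ℤ)) (ℤ.*-zeroʳ (W r j)))
             (sum-cong-≗ λ i → trans (cong (W r (punchIn j i) *_) (insertAt-punchIn y j 0ℤ i)) (ℤ.*-comm _ (y i))) ⟩
      0ℤ + sum (λ i → y i * other-columns i r)
        ≡⟨ ℤ.+-identityˡ _ ⟩
      sum (λ i → y i * other-columns i r) ∎
      where open ≡-Reasoning

    no-other-kernel-vector : ∀ (y : Vector ℤ m) → (∀ r → P ∣ sum λ i → y i * other-columns i r) → ∀ i → P ∣ y i
    no-other-kernel-vector y p∣y i = ∣-resp (insertAt-punchIn y j 0ℤ i)
      (two-kernel-vectors x j p∤xj p∣Wx (insertAt y j 0ℤ) (punchIn j i) (insertAt-lookup y j 0ℤ)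
        λ r → ∣-resp (sym (padded y r)) (p∣y r))

    -- The columns other than `j` are independent and orthogonal to `v`, so they already span its
    -- complement; adjoining `t` forces a dependence, and `t` must occur in it.
    column-span : ∀ t → P ∣ v ∙ t → ∃ λ z → ∃ λ σ → ¬ P ∣ σ × (∀ r → P ∣ σ * t r + (W ⊛ z) r)
    column-span t p∣vt with orthogonal⇒dependent pr v-row B (ℕ.n<1+n n) ⊥B
      where
      B : Matrix n n
      B zero    = t
      B (suc i) = other-columns i
      ⊥B : ∀ i k → P ∣ v-row i ∙ B k
      ⊥B _ zero    = p∣vt
      ⊥B _ (suc k) = v⊥W (punchIn j k)
    ... | inj₁ dep = contradiction dep v-row-independent
    ... | inj₂ (y , (i , p∤yi) , p∣yB) = insertAt (y ∘ suc) j 0ℤ , y zero , p∤y₀ i p∤yi ,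
                                          λ r → ∣-resp (cong (y zero * t r +_) (sym (padded (y ∘ suc) r))) (p∣yB r)
      where
      p∤y₀ : ∀ i → ¬ P ∣ y i → ¬ P ∣ y zero
      p∤y₀ zero    p∤yi = p∤yi
      p∤y₀ (suc i) p∤yi p∣y₀ = p∤yi (no-other-kernel-vector (y ∘ suc)
        (λ r → ∣m+n∣m⇒∣n (p∣yB r) (∣m⇒∣m*n (t r) p∣y₀)) i)

    -- `v` and M v are both orthogonal to `m` independent columns in dimension `m` + 1, hence
    -- dependent; M v occurs because `v` is not zero.
    eigenvector : ∃ λ κ → ∃ λ μ → ¬ P ∣ μ × (∀ r → P ∣ κ * v r + μ * (M ⊛ v) r)
    eigenvector with orthogonal⇒dependent pr C other-columns (ℕ.n<1+n n) ⊥C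
      where
      C : Matrix 2 n
      C zero    = v
      C (suc _) = M ⊛ v
      ⊥C : ∀ i k → P ∣ C i ∙ other-columns k
      ⊥C zero    k = v⊥W (punchIn j k)
      ⊥C (suc _) k = Mv⊥W (punchIn j k)
    ... | inj₂ (y , (i , p∤yi) , p∣y) = contradiction (no-other-kernel-vector y p∣y i) p∤yi
    ... | inj₁ (y , (i , p∤yi) , p∣yC) = y zero , y (suc zero) , p∤μ i p∤yi , p∣comb
      where
      p∣comb : ∀ r → P ∣ y zero * v r + y (suc zero) * (M ⊛ v) r
      p∣comb r = ∣-resp (cong (y zero * v r +_) (ℤ.+-identityʳ _)) (p∣yC r)
      p∤μ : ∀ i → ¬ P ∣ y i → ¬ P ∣ y (suc zero)
      p∤μ (suc zero) p∤yi = p∤yi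
      p∤μ zero p∤y₀ p∣μ = proj₂ v≢0 (∣*-cancelˡ pr p∤y₀
        (∣m+n∣n⇒∣m (p∣comb (proj₁ v≢0)) (∣m⇒∣m*n _ p∣μ)))

    κ μ : ℤ
    κ = proj₁ eigenvector
    μ = proj₁ (proj₂ eigenvector)
    p∤μ : ¬ P ∣ μ
    p∤μ = proj₁ (proj₂ (proj₂ eigenvector))
    N : Vector ℤ n → Vector ℤ n
    N y r = κ * y r + μ * (M ⊛ y) r
    β : Vector ℤ n
    β r = quotient (proj₂ (proj₂ (proj₂ eigenvector)) r)
    Nv≡pβ : ∀ r → N v r ≡ P * β r
    Nv≡pβ r = trans (_∣_.equality (proj₂ (proj₂ (proj₂ eigenvector)) r)) (ℤ.*-comm (β r) P)

    P≢0 : P ≢ 0ℤ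
    P≢0 refl = contradiction pr ¬prime[0]

    N-self-adjoint : ∀ y → v ∙ N y ≡ N v ∙ y
    N-self-adjoint y = trans (∙-linearʳ v κ μ y (M ⊛ y))
      (trans (cong (λ e → κ * (v ∙ y) + μ * e) (sym (self-adjoint v y)))
        (sym (∙-linearˡ κ μ v (M ⊛ v) y)))

    p∣vNy : ∀ y → P ∣ v ∙ N y
    p∣vNy y = ∣-resp (sym (trans (N-self-adjoint y) (trans (∙-cong {y = y} Nv≡pβ (λ _ → refl)) (∙-scaleˡ P β y))))
      (∣m⇒∣m*n (β ∙ y) ∣-refl)

    -- The two conditions modulo p² are spent here: p (v · β) = v · N v = κ (v · v) + μ (v · M v).
    p∣vβ : P ∣ v ∙ β
    p∣vβ = *-cancelˡ-∣ P {{ℤ.≢-nonZero P≢0}} (∣-resp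
      (trans (sym (∙-linearʳ v κ μ v (M ⊛ v))) (trans (∙-cong {x = v} (λ _ → refl) Nv≡pβ) (∙-scaleʳ v P β)))
      (∣m∣n⇒∣m+n (∣n⇒∣m*n κ pp∣vv) (∣n⇒∣m*n μ pp∣vMv)))

    -- As `t` lies in the column span modulo p, correcting σ s by p z yields a vector that W sends
    -- to a multiple of p²; a unit entry in it would put p² into the determinant.
    divisible-coefficients : ∀ s t → P ∣ v ∙ t → (∀ r → (W ⊛ s) r ≡ P * t r) → ∀ k → P ∣ s k
    divisible-coefficients s t p∣vt Ws≡pt k with column-span t p∣vt
    ... | z , σ , p∤σ , p∣ = ∣*-cancelˡ pr p∤σ (∣m+n∣n⇒∣m p∣s′k (∣m⇒∣m*n (z k) ∣-refl))
      where
      s′ : Vector ℤ n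
      s′ k = σ * s k + P * z k
      factor : ∀ σ p t z → σ * (p * t) + p * z ≡ p * (σ * t + z)
      factor = solve-∀
      pair : ∀ p q → p * (q * p) ≡ p * p * q
      pair = solve-∀
      Ws′ : ∀ r → (W ⊛ s′) r ≡ P * P * quotient (p∣ r)
      Ws′ r = trans (⊛-linear W σ P s z r) (trans (cong (λ u → σ * u + P * (W ⊛ z) r) (Ws≡pt r))
        (trans (factor σ P (t r) ((W ⊛ z) r)) (trans (cong (P *_) (_∣_.equality (p∣ r))) (pair P (quotient (p∣ r))))))
      p∣s′k : P ∣ s′ k
      p∣s′k with P ∣? s′ k
      ... | yes p∣s′k = p∣s′k
      ... | no p∤s′k  = contradiction (prime-square-cancel pr p∤s′k
        (∣-resp (scaled-cramer W s′ k (P * P) _ Ws′) (∣m⇒∣m*n _ ∣-refl))) pp∤det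

    -- Applying μ M + κ to W y shifts the coefficients y, so they vanish modulo p from the top down.
    short-combination : ∀ y → y (fromℕ m) ≡ 0ℤ → ∀ τ t → (∀ r → (W ⊛ y) r ≡ τ * v r + P * t r) → ∀ k → P ∣ y k
    short-combination y y-last τ t Wy≡ = >-weakInduction (λ k → P ∣ y k) (∣-resp (sym y-last) ∣0)
      λ k p∣y → ∣*-cancelˡ pr (γ-unit k) (∣*-cancelˡ pr p∤μ (∣-resp (cong (μ *_) (ℤ.*-comm _ (γ k)))
        (∣m+n∣m⇒∣n (p∣s (suc k)) (∣n⇒∣m*n κ p∣y))))
      where
      open ≡-Reasoning
      shifted s t′ : Vector ℤ n
      shifted zero    = 0ℤ
      shifted (suc k) = y (inject₁ k) * γ k
      s k = κ * y k + μ * shifted k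
      t′ r = τ * β r + 1ℤ * N t r
      M-combination : ∀ r → (M ⊛ W ⊛ y) r ≡ (W ⊛ shifted) r
      M-combination r = begin
        (M ⊛ W ⊛ y) r                                          ≡⟨ ⊗-⊛ M W y r ⟩
        sum (λ k → (M ⊗ W) r k * y k)                          ≡⟨ sum-init-last (λ k → (M ⊗ W) r k * y k) ⟩
        sum (λ k → (M ⊗ W) r (inject₁ k) * y (inject₁ k)) + (M ⊗ W) r (fromℕ m) * y (fromℕ m)
          ≡⟨ cong₂ _+_ (sum-cong-≗ λ k → trans (cong (_* y (inject₁ k)) (shift k r)) (rotate (γ k) (W r (suc k)) (y (inject₁ k))))
               (trans (cong ((M ⊗ W) r (fromℕ m) *_) y-last) (ℤ.*-zeroʳ ((M ⊗ W) r (fromℕ m)))) ⟩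
        sum (λ k → W r (suc k) * shifted (suc k)) + 0ℤ         ≡⟨ swap (W r zero) _ ⟩
        (W ⊛ shifted) r                                        ∎
        where
        rotate : ∀ g w y → g * w * y ≡ w * (y * g)
        rotate = solve-∀
        swap : ∀ w a → a + 0ℤ ≡ w * 0ℤ + a
        swap = solve-∀
      Ws≡pt′ : ∀ r → (W ⊛ s) r ≡ P * t′ r
      Ws≡pt′ r = begin
        (W ⊛ s) r                                              ≡⟨ ⊛-linear W κ μ y shifted r ⟩
        κ * (W ⊛ y) r + μ * (W ⊛ shifted) r                    ≡⟨ cong₂ (λ a b → κ * a + μ * b) (Wy≡ r) (sym (M-combination r)) ⟩
        κ * (τ * v r + P * t r) + μ * (M ⊛ W ⊛ y) r            ≡⟨ cong (λ a → κ * (τ * v r + P * t r) + μ * a)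
                                                                    (trans (⊛-congʳ M Wy≡ r) (⊛-linear M τ P v t r)) ⟩
        κ * (τ * v r + P * t r) + μ * (τ * (M ⊛ v) r + P * (M ⊛ t) r)
                                                               ≡⟨ collect κ μ τ P (v r) (t r) ((M ⊛ v) r) ((M ⊛ t) r) ⟩
        τ * N v r + P * N t r                                  ≡⟨ cong (λ a → τ * a + P * N t r) (Nv≡pβ r) ⟩
        τ * (P * β r) + P * N t r                              ≡⟨ factor τ P (β r) (N t r) ⟩
        P * t′ r                                               ∎
        where
        collect : ∀ κ μ τ p v t a b → κ * (τ * v + p * t) + μ * (τ * a + p * b) ≡ τ * (κ * v + μ * a) + p * (κ * t + μ * b)
        collect = solve-∀
        factor : ∀ τ p b t → τ * (p * b) + p * t ≡ p * (τ * b + 1ℤ * t)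
        factor = solve-∀
      p∣s : ∀ k → P ∣ s k
      -- Both parts of `t′` are orthogonal to `v`: β by `p∣vβ`, and N t because N is self-adjoint
      -- and N v vanishes modulo p.
      p∣s = divisible-coefficients s t′ (∣-resp (sym (∙-linearʳ v τ 1ℤ β (N t)))
        (∣m∣n⇒∣m+n (∣n⇒∣m*n τ p∣vβ) (∣n⇒∣m*n 1ℤ (p∣vNy t)))) Ws≡pt′

    last = fromℕ m

    -- Being isotropic, `v` has coordinates `z` in the columns of W, up to a unit. Eliminating the
    -- last coefficient between `x` and `z` gives a short combination equal to a multiple of `v`; it
    -- is trivial, so the multiple is zero.
    p∣x-last : P ∣ x last
    p∣x-last with column-span v (∣-trans (∣n⇒∣m*n P ∣-refl) pp∣vv)
    ... | z , σ , p∤σ , p∣ = ∣*-cancelʳ pr p∤σ (∣*-cancelʳ pr (proj₂ v≢0)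
            (∣m+n∣n⇒∣m (∣-resp (Wy≡ (proj₁ v≢0)) (∣-sum λ k → ∣n⇒∣m*n (W (proj₁ v≢0) k) (p∣y k))) (∣m⇒∣m*n _ ∣-refl)))
      where
      y t : Vector ℤ n
      y k = z last * x k + - x last * z k
      t r = z last * quotient (p∣Wx r) + - x last * quotient (p∣ r)
      Wy≡ : ∀ r → (W ⊛ y) r ≡ (x last * σ) * v r + P * t r
      Wy≡ r = trans (⊛-linear W (z last) (- x last) x z r)
        (trans (cong₂ (λ a b → z last * a + - x last * b) (_∣_.equality (p∣Wx r))
            (move (σ * v r) ((W ⊛ z) r) (_∣_.equality (p∣ r))))
          (collect (z last) (x last) σ (v r) P (quotient (p∣Wx r)) (quotient (p∣ r))))
        where
        move : ∀ a b {c} → a + b ≡ c → b ≡ c + - a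
        move a b refl = lemma a b
          where lemma : ∀ a b → b ≡ a + b + - a
                lemma = solve-∀
        collect : ∀ z x σ v p a b → z * (a * p) + - x * (b * p + - (σ * v)) ≡ (x * σ) * v + p * (z * a + - x * b)
        collect = solve-∀
      cancel : ∀ a b → a * b + - b * a ≡ 0ℤ
      cancel = solve-∀
      p∣y : ∀ k → P ∣ y k
      p∣y = short-combination y (cancel (z last) (x last)) (x last * σ) t Wy≡

  -- Now `x` can drop its last coefficient without leaving the kernel, and as a short combination it
  -- vanishes modulo p, against the choice of `j`.
  impossible : ⊥
  impossible = p∤xj (∣m+n∣n⇒∣m (∣-resp (cong (_+ - x last * identity j last) (ℤ.*-identityˡ (x j))) (p∣y j))
                        (∣m⇒∣m*n (identity j last) (∣m⇒∣-m p∣x-last)))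
    where
    y t : Vector ℤ n
    y k = 1ℤ * x k + - x last * identity k last
    t r = quotient (p∣Wx r) + - quotient p∣x-last * W r last
    Wy≡ : ∀ r → (W ⊛ y) r ≡ 0ℤ * v r + P * t r
    Wy≡ r = trans (⊛-linear W 1ℤ (- x last) x (λ k → identity k last) r)
      (trans (cong₂ (λ a b → 1ℤ * a + b) (_∣_.equality (p∣Wx r))
          (cong₂ (λ a b → - a * b) (_∣_.equality p∣x-last) (sum-identity (W r) last)))
        (collect (quotient (p∣Wx r)) P (quotient p∣x-last) (W r last) (v r)))
      where
      collect : ∀ a p b w v → 1ℤ * (a * p) + - (b * p) * w ≡ 0ℤ * v + p * (a + - b * w)
      collect = solve-∀
    y-last : y last ≡ 0ℤ
    y-last = trans (cong (λ i → 1ℤ * x last + - x last * i) (identity-diag last)) (cancel (x last))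
      where
      cancel : ∀ a → 1ℤ * a + - a * 1ℤ ≡ 0ℤ
      cancel = solve-∀
    p∣y : ∀ k → P ∣ y k
    p∣y = short-combination y y-last 0ℤ t Wy≡

-- The prime two

extend : ∀ {h} → Vector ℤ h → ℕ → ℤ
extend {zero}  y _       = 0ℤ
extend {suc h} y zero    = y zero
extend {suc h} y (suc k) = extend (y ∘ suc) k

extend-toℕ : ∀ {h} (y : Vector ℤ h) i → extend y (toℕ i) ≡ y i
extend-toℕ y zero    = refl
extend-toℕ y (suc i) = extend-toℕ (y ∘ suc) i

combination-extend : ∀ {n h} (M : Matrix n n) u (y : Vector ℤ h) r →
                     combination M u (extend y) h r ≡ sum λ i → y i * power M (toℕ i) u r
combination-extend {h = h} M u y r = trans (combination-sum M u (extend y) h r)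
  (sum-cong-≗ λ i → trans (cong (power M (toℕ i) u r *_) (extend-toℕ y i)) (ℤ.*-comm (power M (toℕ i) u r) (y i)))

half : ∀ k → ∃ λ j → k ≡ j ℕ.+ j ⊎ k ≡ suc (j ℕ.+ j)
half zero = 0 , inj₁ refl
half (suc k) with half k
... | j , inj₁ k≡ = j , inj₂ (cong suc k≡)
... | j , inj₂ k≡ = suc j , inj₁ (trans (cong suc k≡) (cong suc (sym (ℕ.+-suc j j))))

𝟙 : ∀ {n} → Vector ℤ n
𝟙 _ = 1ℤ

∙-𝟙 : ∀ {n} (x : Vector ℤ n) → 𝟙 ∙ x ≡ sum x
∙-𝟙 x = sum-cong-≗ λ i → ℤ.*-identityˡ (x i)

sum-𝟙 : ∀ n → sum (𝟙 {n}) ≡ ℤ.+ n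
sum-𝟙 zero    = refl
sum-𝟙 (suc n) = cong (1ℤ +_) (sum-𝟙 n)

product-twos : ∀ h → product {h ℕ.* 2} (const (ℤ.+ 2)) ≡ ℤ.+ (2 ℕ.^ h) * ℤ.+ (2 ℕ.^ h)
product-twos zero    = refl
product-twos (suc h) = trans (cong (λ q → ℤ.+ 2 * (ℤ.+ 2 * q)) (product-twos h))
  (trans (regroup (ℤ.+ (2 ℕ.^ h))) (sym (cong₂ _*_ (ℤ.pos-* 2 (2 ℕ.^ h)) (ℤ.pos-* 2 (2 ℕ.^ h)))))
  where
  regroup : ∀ q → ℤ.+ 2 * (ℤ.+ 2 * (q * q)) ≡ ℤ.+ 2 * q * (ℤ.+ 2 * q)
  regroup = solve-∀

2^≢0 : ∀ h → ℤ.+ (2 ℕ.^ h) ≢ 0ℤ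
2^≢0 h eq = contradiction (ℤ.+-injective eq) (ℕ.>⇒≢ (ℕ.m^n>0 2 h))

even-square : ∀ {x} → ℤ.+ 2 ∣ x * x → ℤ.+ 2 ∣ x
even-square {x} 2∣xx with euclid prime[2] x x 2∣xx
... | inj₁ 2∣x = 2∣x
... | inj₂ 2∣x = 2∣x

private
  isolate : ∀ y v {f q} → y * v + f ≡ q * ℤ.+ 2 → f ≡ - y * v + ℤ.+ 2 * q
  isolate y v {f} {q} eq = trans (add-sub y v f) (cong (- y * v +_) (trans eq (ℤ.*-comm q (ℤ.+ 2))))
    where
    add-sub : ∀ y v f → f ≡ - y * v + (y * v + f)
    add-sub = solve-∀

module _ {n} {M : Matrix n n} (M-sym : Symmetric M) where

  open SymmetricPowers M-sym

  -- For F ≡ s v modulo 2 the two cross terms are equal by the symmetry of M, so the error is a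
  -- multiple of 4 and not just of 2.
  four-moments : ∀ {v} → (∀ k → ℤ.+ 4 ∣ v ∙ power M k v) → ∀ s q {F} → (∀ r → F r ≡ s * v r + ℤ.+ 2 * q r) →
                 ∀ k → ℤ.+ 4 ∣ F ∙ power M k F
  four-moments {v} 4∣vv s q {F} F≡ k = ∣-resp (sym (begin
    F ∙ power M k F
      ≡⟨ ∙-cong F≡ (power-cong M k F≡) ⟩
    G ∙ power M k G
      ≡⟨ moment-linearˡ k s (ℤ.+ 2) v q G ⟩
    s * (v ∙ power M k G) + ℤ.+ 2 * (q ∙ power M k G)
      ≡⟨ cong₂ (λ a b → s * a + ℤ.+ 2 * b) (moment-linearʳ k v s (ℤ.+ 2) v q)
           (trans (moment-linearʳ k q s (ℤ.+ 2) v q)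
             (cong (λ e → s * e + ℤ.+ 2 * (q ∙ power M k q)) (moment-sym k q v))) ⟩
    s * (s * (v ∙ power M k v) + ℤ.+ 2 * (v ∙ power M k q)) + ℤ.+ 2 * (s * (v ∙ power M k q) + ℤ.+ 2 * (q ∙ power M k q))
      ≡⟨ collect s (v ∙ power M k v) (v ∙ power M k q) (q ∙ power M k q) ⟩
    s * s * (v ∙ power M k v) + ℤ.+ 4 * (s * (v ∙ power M k q) + (q ∙ power M k q)) ∎))
    (∣m∣n⇒∣m+n (∣n⇒∣m*n (s * s) (4∣vv k)) (∣m⇒∣m*n _ ∣-refl))
    where
    open ≡-Reasoning
    G : Vector ℤ n
    G i = s * v i + ℤ.+ 2 * q i
    collect : ∀ s a b e → s * (s * a + ℤ.+ 2 * b) + ℤ.+ 2 * (s * b + ℤ.+ 2 * e) ≡ s * s * a + ℤ.+ 4 * (s * b + e)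
    collect = solve-∀

  -- The relation makes the combination congruent to -y₀ v modulo 2, so its moments vanish modulo 4,
  -- and `square-moments` passes this on to the combination with squared coefficients.
  relation-moments : ∀ {u} → (∀ k → ℤ.+ 2 ∣ u ∙ power M k u) → ∀ {v} → (∀ k → ℤ.+ 4 ∣ v ∙ power M k v) →
    ∀ y₀ x h → (∀ r → ℤ.+ 2 ∣ y₀ * v r + combination M u x h r) →
    ∀ k → ℤ.+ 4 ∣ u ∙ power M k (combination M u (spread x) (h ℕ.* 2))
  relation-moments {u} even {v} 4∣vv y₀ x h rel k = ∣m+n∣n⇒∣m (square-moments even x h k)
    (∣m⇒∣-m (four-moments 4∣vv (- y₀) (λ r → quotient (rel r)) (λ r → isolate y₀ (v r) (_∣_.equality (rel r))) k))

-- Parity of the products of walk columns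

module Walks {n} {M : Matrix n n} (M-sym : Symmetric M) (a c : ℤ) (d : Vector ℤ n)
  (M𝟙≡cd : ∀ r → (M ⊛ 𝟙) r ≡ c * d r) (diagonal : ∀ i → M i i ≡ a * d i) (handshake : ℤ.+ 2 ∣ 𝟙 ∙ d) where

  open SymmetricPowers M-sym

  walk : ℕ → Vector ℤ n
  walk zero    = 𝟙
  walk (suc k) = power M k d

  sum-walk : ∀ k x → 𝟙 ∙ power M (suc k) x ≡ c * (d ∙ power M k x)
  sum-walk k x = trans (sym (self-adjoint 𝟙 (power M k x)))
    (trans (∙-cong {y = power M k x} M𝟙≡cd (λ _ → refl)) (∙-scaleˡ c d (power M k x)))

  private
    -- Strong induction with bound `b`. For k = 2 j the value is the squared norm of Mʲ d, congruent
    -- to its entry sum, which is the degree sum or `c` times an earlier moment. For k = 2 j + 1 the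
    -- diagonal of M, being `a` times d, reduces the quadratic form to `a` times the moment at `j`.
    even-by-half : ∀ b k → k ℕ.< b → ℤ.+ 2 ∣ d ∙ power M k d
    even-by-half (suc b) k (ℕ.s≤s k≤b) with half k
    ... | j , inj₁ refl = ∣-resp (trans (power-self-adjoint j d (power M j d)) (cong (d ∙_) (sym (power-+ M j j d))))
            (∣m+n∣n⇒∣m (even-norm (power M j d)) (∣m⇒∣-m (even-sum j k≤b)))
      where
      even-norm : ∀ (y : Vector ℤ n) → ℤ.+ 2 ∣ y ∙ y + - (𝟙 ∙ y)
      even-norm y = ∣-resp (trans (sum-cong-≗ λ i → split (y i))
          (trans (sum-linear 1ℤ (- 1ℤ) (λ i → y i * y i) (λ i → 1ℤ * y i)) (join (y ∙ y) (𝟙 ∙ y))))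
        (∣-sum λ i → 2∣x²-x (y i))
        where
        split : ∀ y → y * y + - y ≡ 1ℤ * (y * y) + - 1ℤ * (1ℤ * y)
        split = solve-∀
        join : ∀ a b → 1ℤ * a + - 1ℤ * b ≡ a + - b
        join = solve-∀
      even-sum : ∀ j → j ℕ.+ j ≤ b → ℤ.+ 2 ∣ 𝟙 ∙ power M j d
      even-sum zero    _   = handshake
      even-sum (suc j) j<b = ∣-resp (sym (sum-walk j d))
        (∣n⇒∣m*n c (even-by-half b j (ℕ.≤-trans (ℕ.s≤s (ℕ.m≤m+n j (suc j))) j<b)))
    ... | j , inj₂ refl = ∣-resp (trans (power-self-adjoint j d (M ⊛ power M j d))
              (cong (d ∙_) (trans (sym (power-+ M j (suc j) d)) (cong (λ k → power M k d) (ℕ.+-suc j j)))))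
            (∣m+n∣n⇒∣m (quadratic-parity M-sym (power M j d)) (∣m⇒∣-m (∣-resp
              (trans (sym (∙-scaleˡ a d (power M j d))) (sum-cong-≗ λ i → cong (_* power M j d i) (sym (diagonal i))))
              (∣n⇒∣m*n a (even-by-half b j (ℕ.≤-trans (ℕ.s≤s (ℕ.m≤m+n j j)) k≤b))))))

  even-moments : ∀ k → ℤ.+ 2 ∣ d ∙ power M k d
  even-moments k = even-by-half (suc k) k (ℕ.n<1+n k)

  even-sums : ∀ k → ℤ.+ 2 ∣ 𝟙 ∙ power M k d
  even-sums zero    = handshake
  even-sums (suc k) = ∣-resp (sym (sum-walk k d)) (∣n⇒∣m*n c (even-moments k))

  even-gram : ∀ i j → ℤ.+ 2 ∣ walk (suc i) ∙ walk j
  even-gram i zero    = ∣-resp (∙-comm 𝟙 (power M i d)) (even-sums i)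
  even-gram i (suc j) = ∣-resp (trans (cong (d ∙_) (power-+ M i j d)) (sym (power-self-adjoint i d (power M j d))))
    (even-moments (i ℕ.+ j))

  even-gram₀ : ∀ j → ℤ.+ 2 ∣ 𝟙 ∙ walk (suc j)
  even-gram₀ j = ∣-resp (∙-comm (walk (suc j)) 𝟙) (even-gram j zero)

-- The prime two for n odd

module OddOrder (h : ℕ) {M : Matrix (suc (h ℕ.* 2)) (suc (h ℕ.* 2))} (M-sym : Symmetric M)
  (a c : ℤ) (d : Vector ℤ (suc (h ℕ.* 2))) (M𝟙≡cd : ∀ r → (M ⊛ 𝟙) r ≡ c * d r)
  (diagonal : ∀ i → M i i ≡ a * d i) (handshake : ℤ.+ 2 ∣ 𝟙 ∙ d) where

  private
    n : ℕ
    n = suc (h ℕ.* 2)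

  open SymmetricPowers M-sym
  open Walks M-sym a c d M𝟙≡cd diagonal handshake

  module _ {z} (det≡ : detℤ {n} (λ r k → walk (toℕ k) r) ≡ z * ℤ.+ (2 ℕ.^ h)) (z-odd : ¬ ℤ.+ 2 ∣ z)
    {v : Vector ℤ n} (v⊥walk : ∀ k → ℤ.+ 2 ∣ v ∙ walk k) (4∣vv : ∀ k → ℤ.+ 4 ∣ v ∙ power M k v) where

    private
      W Q : Matrix n n
      W r k = walk (toℕ k) r
      Q zero    j = 𝟙 ∙ walk (toℕ j)
      Q (suc i) j = quotient (even-gram (toℕ i) (toℕ j))
      ρ : Vector ℤ n
      ρ zero    = 1ℤ
      ρ (suc _) = ℤ.+ 2
      ρ≢0 : ∀ i → ρ i ≢ 0ℤ
      ρ≢0 zero    ()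
      ρ≢0 (suc _) ()
      gram : ∀ i j → (W ᵀ ⊗ W) i j ≡ ρ i * Q i j
      gram zero    j = sym (ℤ.*-identityˡ (𝟙 {n} ∙ walk (toℕ j)))
      gram (suc i) j = trans (_∣_.equality (even-gram (toℕ i) (toℕ j))) (ℤ.*-comm (Q (suc i) j) (ℤ.+ 2))

      open Gram {n} {W} {Q} {ρ} gram {z} {ℤ.+ (2 ℕ.^ h)} det≡ (trans (ℤ.*-identityˡ (product {h ℕ.* 2} (const (ℤ.+ 2)))) (product-twos h)) (2^≢0 h) z-odd

      -- The squares sit at the columns 1 + 2 i of W, which exist since 2 i < 2 h. Row 0 of the Gram
      -- matrix carries no factor 2, so evenness is enough there, while the other rows need
      -- divisibility by 4.
      even-relation : ∀ y₀ (y : Vector ℤ h) → (∀ r → ℤ.+ 2 ∣ y₀ * v r + combination M d (extend y) h r) →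
                      ∀ i → ℤ.+ 2 ∣ y i
      even-relation y₀ y rel i = even-square (∣-resp
        (trans (cong (spread (extend y)) (Fin.toℕ-fromℕ< i<))
          (trans (spread-double (extend y) (toℕ i)) (cong₂ _*_ (extend-toℕ y i) (extend-toℕ y i))))
        (even-coefficients prime[2] ξ ρ≢0 2ρ∣ (suc (fromℕ< i<))))
        where
        i< : toℕ i ℕ.* 2 ℕ.< h ℕ.* 2
        i< = ℕ.*-monoˡ-< 2 (Fin.toℕ<n i)
        S : Vector ℤ n
        S = combination M d (spread (extend y)) (h ℕ.* 2)
        ξ : Vector ℤ n
        ξ zero    = 0ℤ
        ξ (suc k) = spread (extend y) (toℕ k)
        Wξ : ∀ r → (W ⊛ ξ) r ≡ S r
        Wξ r = trans (ℤ.+-identityˡ (sum {h ℕ.* 2} λ k → W r (suc k) * ξ (suc k))) (sym (combination-sum M d (spread (extend y)) (h ℕ.* 2) r))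
        2ρ∣ : ∀ k → ρ k * ℤ.+ 2 ∣ (W ᵀ ⊛ W ⊛ ξ) k
        2ρ∣ zero    = ∣-resp (∙-cong {n} {𝟙} {𝟙} {S} {W ⊛ ξ} (λ _ → refl) (sym ∘ Wξ))
          (even-combination d 𝟙 even-sums (spread (extend y)) (h ℕ.* 2) 0)
        2ρ∣ (suc k) = ∣-resp (trans (sym (power-self-adjoint (toℕ k) d S))
            (∙-cong {n} {walk (suc (toℕ k))} {walk (suc (toℕ k))} {S} {W ⊛ ξ} (λ _ → refl) (sym ∘ Wξ)))
          (relation-moments M-sym even-moments 4∣vv y₀ (extend y) h rel (toℕ k))

    -- `v` and the Mⁱ d with i < h are h + 1 vectors, mutually orthogonal modulo 2, in dimension 2 h
    -- + 1. They are therefore dependent, and only `v` can occur with an odd coefficient.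
    odd-order-even-column : ∀ r → ℤ.+ 2 ∣ v r
    odd-order-even-column = conclude (orthogonal⇒dependent prime[2] B B n<2h+2 B⊥B)
      where
      B : Matrix (suc h) n
      B zero    = v
      B (suc i) = walk (suc (toℕ i))
      n<2h+2 : n ℕ.< suc h ℕ.+ suc h
      n<2h+2 = ℕ.s≤s (ℕ.≤-reflexive (trans (cong suc (trans (ℕ.*-comm h 2) (cong (h ℕ.+_) (ℕ.+-identityʳ h))))
        (sym (ℕ.+-suc h h))))
      B⊥B : ∀ i j → ℤ.+ 2 ∣ B i ∙ B j
      B⊥B zero    zero    = ∣-trans (divides (ℤ.+ 2) refl) (4∣vv 0)
      B⊥B zero    (suc j) = v⊥walk (suc (toℕ j))
      B⊥B (suc i) zero    = ∣-resp (∙-comm v (walk (suc (toℕ i)))) (v⊥walk (suc (toℕ i)))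
      B⊥B (suc i) (suc j) = even-gram (toℕ i) (suc (toℕ j))
      conclude : Dependent 2 B ⊎ Dependent 2 B → ∀ r → ℤ.+ 2 ∣ v r
      conclude dep r with [ id , id ]′ dep
      ... | y , (i , 2∤yi) , rel = ∣*-cancelˡ prime[2] (2∤y₀ i 2∤yi)
              (∣m+n∣n⇒∣m (rel r) (∣-sum λ i → ∣m⇒∣m*n (B (suc i) r) (even i)))
        where
        even : ∀ i → ℤ.+ 2 ∣ y (suc i)
        even = even-relation (y zero) (y ∘ suc) λ r →
          ∣-resp (cong (y zero * v r +_) (sym (combination-extend M d (y ∘ suc) r))) (rel r)
        2∤y₀ : ∀ i → ¬ ℤ.+ 2 ∣ y i → ¬ ℤ.+ 2 ∣ y zero
        2∤y₀ zero    2∤yi = 2∤yi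
        2∤y₀ (suc i) 2∤yi = contradiction (even i) 2∤yi

-- The prime two for n even

module EvenOrder (h : ℕ) {M : Matrix (suc h ℕ.* 2) (suc h ℕ.* 2)} (M-sym : Symmetric M)
  (a c : ℤ) (d : Vector ℤ (suc h ℕ.* 2)) (M𝟙≡cd : ∀ r → (M ⊛ 𝟙) r ≡ c * d r)
  (diagonal : ∀ i → M i i ≡ a * d i) (handshake : ℤ.+ 2 ∣ 𝟙 ∙ d) where

  private
    n : ℕ
    n = suc h ℕ.* 2

  open SymmetricPowers M-sym
  open Walks M-sym a c d M𝟙≡cd diagonal handshake

  even-walks : ∀ i j → ℤ.+ 2 ∣ walk i ∙ walk j
  even-walks zero    zero    = ∣-resp (sym (trans (∙-𝟙 (𝟙 {n})) (sum-𝟙 n))) (divides (ℤ.+ suc h) (ℤ.pos-* (suc h) 2))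
  even-walks zero    (suc j) = even-gram₀ j
  even-walks (suc i) j       = even-gram i j

  module _ {z} (det≡ : detℤ {n} (λ r k → walk (toℕ k) r) ≡ z * ℤ.+ (2 ℕ.^ suc h)) (z-odd : ¬ ℤ.+ 2 ∣ z) where

    private
      W Q : Matrix n n
      W r k = walk (toℕ k) r
      Q i j = quotient (even-walks (toℕ i) (toℕ j))
      ρ : Vector ℤ n
      ρ _ = ℤ.+ 2
      ρ≢0 : ∀ i → ρ i ≢ 0ℤ
      ρ≢0 _ ()
      gram : ∀ i j → (W ᵀ ⊗ W) i j ≡ ρ i * Q i j
      gram i j = trans (_∣_.equality (even-walks (toℕ i) (toℕ j))) (ℤ.*-comm (Q i j) (ℤ.+ 2))

      open Gram {n} {W} {Q} {ρ} gram {z} {ℤ.+ (2 ℕ.^ suc h)} det≡ (product-twos (suc h)) (2^≢0 (suc h)) z-odd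

    -- This is what excludes 4 ∣ l: it would make every column of V even.
    quadruple-walks⇒even : ∀ v → (∀ k → ℤ.+ 4 ∣ v ∙ walk k) → ∀ r → ℤ.+ 2 ∣ v r
    quadruple-walks⇒even v 4∣v = even-vector prime[2] (λ _ → refl) v λ i → ∣-resp (∙-comm v (walk (toℕ i))) (4∣v (toℕ i))

    module _ {v : Vector ℤ n} (v⊥walk : ∀ k → ℤ.+ 2 ∣ v ∙ walk k) (4∣vv : ∀ k → ℤ.+ 4 ∣ v ∙ power M k v) where

      private
        B : Matrix (suc (suc h)) n
        B zero    = v
        B (suc i) = walk (toℕ i)

        -- `v` and the first h + 1 walks are h + 2 vectors, mutually orthogonal modulo 2, in
        -- dimension 2 h + 2.
        relation : Dependent 2 B
        relation = [ id , id ]′ (orthogonal⇒dependent prime[2] B B n<2h+4 B⊥B)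
          where
          n<2h+4 : n ℕ.< suc (suc h) ℕ.+ suc (suc h)
          n<2h+4 = ℕ.s≤s (ℕ.s≤s (ℕ.≤-trans (ℕ.≤-reflexive (cong suc (trans (ℕ.*-comm h 2) (cong (h ℕ.+_) (ℕ.+-identityʳ h)))))
            (ℕ.≤-trans (ℕ.≤-reflexive (sym (ℕ.+-suc h h))) (ℕ.+-monoʳ-≤ h (ℕ.n≤1+n (suc h))))))
          B⊥B : ∀ i j → ℤ.+ 2 ∣ B i ∙ B j
          B⊥B zero    zero    = ∣-trans (divides (ℤ.+ 2) refl) (4∣vv 0)
          B⊥B zero    (suc j) = v⊥walk (toℕ j)
          B⊥B (suc i) zero    = ∣-resp (∙-comm v (walk (toℕ i))) (v⊥walk (toℕ i))
          B⊥B (suc i) (suc j) = even-walks (toℕ i) (toℕ j)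

        y₀ : ℤ
        y₀ = proj₁ relation zero
        y : Vector ℤ (suc h)
        y i = proj₁ relation (suc i)
        rel : ∀ r → ℤ.+ 2 ∣ y₀ * v r + sum (λ i → y i * walk (toℕ i) r)
        rel = proj₂ (proj₂ relation)

        y₀-odd : (∀ i → ℤ.+ 2 ∣ y i) → ¬ ℤ.+ 2 ∣ y₀
        y₀-odd even = go (proj₁ (proj₁ (proj₂ relation))) (proj₂ (proj₁ (proj₂ relation)))
          where
          go : ∀ i → ¬ ℤ.+ 2 ∣ proj₁ relation i → ¬ ℤ.+ 2 ∣ y₀
          go zero    2∤yi = 2∤yi
          go (suc i) 2∤yi = contradiction (even i) 2∤yi

      -- For c = 1 the walks are the powers Mᵏ 𝟙, and since n is even 𝟙 has even moments. It takes
      -- the place of d in the argument for odd n, with the squares at the columns 2 i.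
      even-order-even-column : c ≡ 1ℤ → ∀ r → ℤ.+ 2 ∣ v r
      even-order-even-column c≡1 r = ∣*-cancelˡ prime[2] (y₀-odd even)
        (∣m+n∣n⇒∣m (rel r) (∣-sum λ i → ∣m⇒∣m*n (walk (toℕ i) r) (even i)))
        where
        walk-power : ∀ k r → walk k r ≡ power M k 𝟙 r
        walk-power zero    r = refl
        walk-power (suc k) r = trans
          (power-cong M k {d} {M ⊛ 𝟙} (λ r → trans (sym (ℤ.*-identityˡ (d r))) (trans (cong (_* d r) (sym c≡1)) (sym (M𝟙≡cd r)))) r)
          (cong (λ u → u r) (power-suc M k 𝟙))
        x : ℕ → ℤ
        x = extend y
        S ξ : Vector ℤ n
        S = combination M 𝟙 (spread x) (suc h ℕ.* 2)
        ξ k = spread x (toℕ k)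
        even-𝟙 : ∀ k → ℤ.+ 2 ∣ 𝟙 ∙ power M k 𝟙
        even-𝟙 k = ∣-resp (∙-cong {x = 𝟙 {n}} (λ _ → refl) (walk-power k)) (even-walks zero k)
        Wξ : ∀ r → (W ⊛ ξ) r ≡ S r
        Wξ r = trans (sum-cong-≗ λ k → cong (_* ξ k) (walk-power (toℕ k) r)) (sym (combination-sum M 𝟙 (spread x) n r))
        4∣ : ∀ k → ℤ.+ 4 ∣ (W ᵀ ⊛ W ⊛ ξ) k
        4∣ k = ∣-resp (trans (sym (power-self-adjoint (toℕ k) 𝟙 S))
            (∙-cong {n} {power M (toℕ k) 𝟙} {walk (toℕ k)} {S} {W ⊛ ξ} (λ r → sym (walk-power (toℕ k) r)) (sym ∘ Wξ)))
          (relation-moments M-sym even-𝟙 4∣vv y₀ x (suc h)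
            (λ r → ∣-resp (cong (y₀ * v r +_) (trans (sum-cong-≗ λ i → cong (y i *_) (walk-power (toℕ i) r))
              (sym (combination-extend M 𝟙 y r)))) (rel r)) (toℕ k))
        even : ∀ i → ℤ.+ 2 ∣ y i
        even i = even-square (∣-resp
          (trans (cong (spread x) (Fin.toℕ-fromℕ< i<))
            (trans (spread-double x (toℕ i)) (cong₂ _*_ (extend-toℕ y i) (extend-toℕ y i))))
          (even-coefficients prime[2] ξ ρ≢0 4∣ (fromℕ< i<)))
          where
          i< : toℕ i ℕ.* 2 ℕ.< suc h ℕ.* 2
          i< = ℕ.*-monoˡ-< 2 (Fin.toℕ<n i)

      -- Once the coefficients of all Mⁱ d are even, the relation shrinks to y₀ v + y₁ 𝟙 ≡ 0. If
      -- `y₁` were even, `y₀` would be odd and `v` zero; so `y₁` is odd, and then no entry of `v`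
      -- can be even.
      even-order-odd-column : ℤ.+ 2 ∣ c → Nontrivial 2 v → ∀ r → ¬ ℤ.+ 2 ∣ v r
      even-order-odd-column 2∣c (r₀ , 2∤v) r 2∣vr = y₁-odd
        (∣m+n∣m⇒∣n (rel′ r) (∣n⇒∣m*n y₀ 2∣vr))
        where
        y₁ : ℤ
        y₁ = y zero
        x : ℕ → ℤ
        x = extend (y ∘ suc)
        F G S : Vector ℤ n
        F = combination M d x h
        G r = y₁ * 𝟙 {n} r + 1ℤ * F r
        S = combination M d (spread x) (h ℕ.* 2)
        sum≡G : ∀ r → sum (λ i → y i * walk (toℕ i) r) ≡ G r
        sum≡G r = cong (y₁ * 1ℤ +_) (trans (sym (combination-extend M d (y ∘ suc) r)) (sym (ℤ.*-identityˡ (F r))))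
        G≡ : ∀ r → G r ≡ - y₀ * v r + ℤ.+ 2 * quotient (rel r)
        G≡ r = isolate y₀ (v r) (trans (cong (y₀ * v r +_) (sym (sum≡G r))) (_∣_.equality (rel r)))
        -- One factor 2 comes from `c`, the other from the even sum 𝟙 · Mᵏ d. For M⁰ the value would
        -- be n, hence the powers start at `suc k`.
        4∣c𝟙 : ∀ k → ℤ.+ 4 ∣ 𝟙 ∙ power M (suc k) 𝟙
        4∣c𝟙 k = ∣-resp (sym (trans (sum-walk k 𝟙) (cong (c *_) (moment-sym k d 𝟙))))
          (∣-trans (*-monoʳ-∣ (ℤ.+ 2) (even-sums k)) (*-monoˡ-∣ (𝟙 ∙ power M k d) 2∣c))
        4∣FF : ∀ k → ℤ.+ 4 ∣ F ∙ power M (suc k) F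
        4∣FF k = ∣m+n∣m⇒∣n (∣-resp expand (four-moments M-sym 4∣vv (- y₀) (λ r → quotient (rel r)) G≡ (suc k)))
          (∣m∣n⇒∣m+n (∣n⇒∣m*n (y₁ * y₁) (4∣c𝟙 k))
            (∣n⇒∣m*n y₁ (*-monoʳ-∣ (ℤ.+ 2) (even-combination d 𝟙 even-sums x h (suc k)))))
          where
          collect : ∀ y a b f → y * (y * a + 1ℤ * b) + 1ℤ * (y * b + 1ℤ * f) ≡ y * y * a + y * (ℤ.+ 2 * b) + f
          collect = solve-∀
          expand : G ∙ power M (suc k) G ≡ y₁ * y₁ * (𝟙 ∙ power M (suc k) 𝟙) + y₁ * (ℤ.+ 2 * (𝟙 ∙ power M (suc k) F)) +
                                           F ∙ power M (suc k) F
          expand = trans (moment-linearˡ (suc k) y₁ 1ℤ 𝟙 F G)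
            (trans (cong₂ (λ a b → y₁ * a + 1ℤ * b) (moment-linearʳ (suc k) 𝟙 y₁ 1ℤ 𝟙 F)
                (trans (moment-linearʳ (suc k) F y₁ 1ℤ 𝟙 F)
                  (cong (λ e → y₁ * e + 1ℤ * (F ∙ power M (suc k) F)) (moment-sym (suc k) F 𝟙))))
              (collect y₁ (𝟙 ∙ power M (suc k) 𝟙) (𝟙 ∙ power M (suc k) F) (F ∙ power M (suc k) F)))
        4∣dS : ∀ k → ℤ.+ 4 ∣ d ∙ power M (suc k) S
        4∣dS k = ∣m+n∣n⇒∣m (square-moments {d} even-moments x h (suc k)) (∣m⇒∣-m (4∣FF k))
        -- Only the moments of S from the first on are controlled, so the coefficients of M S are used instead.
        s : ℕ → ℤ
        s zero    = 0ℤ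
        s (suc k) = spread x k
        ξ : Vector ℤ n
        ξ zero    = 0ℤ
        ξ (suc k) = s (toℕ k)
        Wξ : ∀ r → (W ⊛ ξ) r ≡ (M ⊛ S) r
        Wξ r = trans (ℤ.+-identityˡ (sum {suc (h ℕ.* 2)} λ k → W r (suc k) * ξ (suc k)))
          (trans (sym (combination-sum M d s (suc (h ℕ.* 2)) r)) (simplify (d r) ((M ⊛ S) r)))
          where
          simplify : ∀ d m → 0ℤ * d + 1ℤ * m ≡ m
          simplify = solve-∀
        4∣ : ∀ k → ℤ.+ 4 ∣ (W ᵀ ⊛ W ⊛ ξ) k
        -- The row of 𝟙 is not among the moments of d; here d · S is even and `c` supplies the
        -- second factor 2.
        4∣ zero    = ∣-resp (trans (sym (sum-walk 0 S)) (∙-cong {n} {𝟙} {𝟙} {M ⊛ S} {W ⊛ ξ} (λ _ → refl) (sym ∘ Wξ)))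
          (∣-trans (*-monoʳ-∣ (ℤ.+ 2) (even-combination d d even-moments (spread x) (h ℕ.* 2) 0)) (*-monoˡ-∣ (d ∙ S) 2∣c))
        4∣ (suc k) = ∣-resp (trans (cong (d ∙_) (sym (power-suc M (toℕ k) S))) (trans (sym (power-self-adjoint (toℕ k) d (M ⊛ S)))
            (∙-cong {n} {walk (suc (toℕ k))} {walk (suc (toℕ k))} {M ⊛ S} {W ⊛ ξ} (λ _ → refl) (sym ∘ Wξ))))
          (4∣dS (toℕ k))
        even : ∀ i → ℤ.+ 2 ∣ y (suc i)
        even i = even-square (∣-resp
          (trans (cong (spread x) (Fin.toℕ-fromℕ< i<))
            (trans (spread-double x (toℕ i)) (cong₂ _*_ (extend-toℕ (y ∘ suc) i) (extend-toℕ (y ∘ suc) i))))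
          (even-coefficients prime[2] ξ ρ≢0 4∣ (suc (suc (fromℕ< i<)))))
          where
          i< : toℕ i ℕ.* 2 ℕ.< h ℕ.* 2
          i< = ℕ.*-monoˡ-< 2 (Fin.toℕ<n i)
        rel′ : ∀ r → ℤ.+ 2 ∣ y₀ * v r + y₁
        rel′ r = ∣m+n∣n⇒∣m (∣-resp (regroup y₀ (v r) y₁ (sum (λ i → y (suc i) * walk (suc (toℕ i)) r))) (rel r))
          (∣-sum λ i → ∣m⇒∣m*n (walk (suc (toℕ i)) r) (even i))
          where
          regroup : ∀ y v z s → y * v + (z * 1ℤ + s) ≡ y * v + z + s
          regroup = solve-∀
        y₁-odd : ¬ ℤ.+ 2 ∣ y₁
        y₁-odd 2∣y₁ = ∤*∤ prime[2] (y₀-odd all-even) 2∤v (∣m+n∣n⇒∣m (rel′ r₀) 2∣y₁)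
          where
          all-even : ∀ i → ℤ.+ 2 ∣ y i
          all-even zero    = 2∣y₁
          all-even (suc i) = even i

-- The level of the orthogonal matrix

prime-divisor : ∀ {m} → 2 ≤ m → ∃ λ p → Prime p × p ℕ∣.∣ m
prime-divisor {m@(suc _)} 2≤m with factorise m
... | record { factors = [] ; isFactorisation = m≡1 } = contradiction 2≤m (ℕ.<⇒≱ (ℕ.s≤s (ℕ.≤-reflexive m≡1)))
... | record { factors = p ∷ ps ; isFactorisation = m≡ ; factorsPrime = pr All.∷ _ } =
  p , pr , subst (p ℕ∣.∣_) (sym m≡) (ℕ∣.m∣m*n _)

prime∣2⇒≡2 : ∀ {p} → Prime p → p ℕ∣.∣ 2 → p ≡ 2
prime∣2⇒≡2 {p} pr p∣2 = ℕ.≤-antisym (ℕ∣.∣⇒≤ p∣2) (ℕ.nonTrivial⇒n>1 p {{prime⇒nonTrivial pr}})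

prime∤2^ : ∀ {p} → Prime p → p ≢ 2 → ∀ h → ¬ ℤ.+ p ∣ ℤ.+ (2 ℕ.^ h)
prime∤2^ pr p≢2 zero    p∣ = ∤1 pr p∣
prime∤2^ pr p≢2 (suc h) p∣ with euclid pr (ℤ.+ 2) (ℤ.+ (2 ℕ.^ h)) (∣-resp (ℤ.pos-* 2 (2 ℕ.^ h)) p∣)
... | inj₁ p∣2 = p≢2 (prime∣2⇒≡2 pr (∣⇒∣ᵤ p∣2))
... | inj₂ p∣  = prime∤2^ pr p≢2 h p∣

even-order-parity : ∀ {c} → 1 ≤ c → ¬ (¬ 2 ℕ∣.∣ c × c ≥ 3) → c ≡ 1 ⊎ 2 ℕ∣.∣ c
even-order-parity {c} 1≤c ¬odd with 2 ℕ∣.∣? c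
... | yes 2∣c = inj₂ 2∣c
even-order-parity {zero} 1≤c ¬odd | no 2∤c = contradiction (ℕ∣._∣0 2) 2∤c
even-order-parity {suc zero} 1≤c ¬odd | no 2∤c = inj₁ refl
even-order-parity {suc (suc zero)} 1≤c ¬odd | no 2∤c = contradiction ℕ∣.∣-refl 2∤c
even-order-parity {suc (suc (suc c))} 1≤c ¬odd | no 2∤c = contradiction (2∤c , ℕ.s≤s (ℕ.s≤s (ℕ.s≤s ℕ.z≤n))) ¬odd

nonzero-square : ∀ {x} → x ≢ 0ℤ → 1ℤ ℤ.≤ x * x
nonzero-square {ℤ.+ zero}   x≢0 = contradiction refl x≢0
nonzero-square {ℤ.+ suc x}  _   = ℤ.+≤+ (ℕ.s≤s ℕ.z≤n)
nonzero-square {ℤ.-[1+ x ]} _   = ℤ.+≤+ (ℕ.s≤s ℕ.z≤n)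

norm-lower-bound : ∀ {n} {v : Vector ℤ n} → (∀ r → v r ≢ 0ℤ) → ℤ.+ n ℤ.≤ v ∙ v
norm-lower-bound {zero}  v≢0 = ℤ.≤-refl
norm-lower-bound {suc n} v≢0 = ℤ.+-mono-≤ (nonzero-square (v≢0 zero)) (norm-lower-bound (v≢0 ∘ suc))

degree-power : ∀ {n} (M : Matrix n n) c d → (∀ r → (M ⊛ 𝟙) r ≡ c * d r) →
               ∀ k r → power M (suc k) 𝟙 r ≡ c * power M k d r
degree-power M c d M𝟙 zero    r = M𝟙 r
degree-power M c d M𝟙 (suc k) r = trans (⊛-congʳ M (degree-power M c d M𝟙 k) r) (∙-scaleʳ (M r) c (power M k d))

-- V is l U for a rational orthogonal U of level l, and M′ = Uᵀ M U.
record LevelData (n : ℕ) : Set where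
  field
    {M M′}      : Matrix n n
    M-sym       : Symmetric M
    a           : ℤ
    c           : ℕ
    1≤c         : 1 ≤ c
    d d′        : Vector ℤ n
    M𝟙≡cd       : ∀ r → (M ⊛ 𝟙) r ≡ ℤ.+ c * d r
    M′𝟙≡cd′     : ∀ r → (M′ ⊛ 𝟙) r ≡ ℤ.+ c * d′ r
    diagonal    : ∀ i → M i i ≡ a * d i
    handshake   : ℤ.+ 2 ∣ 𝟙 ∙ d
    {V}         : Matrix n n
    l           : ℕ
    1≤l         : 1 ≤ l
    VV≡l²       : ∀ i j → (V ᵀ ⊗ V) i j ≡ ℤ.+ l * ℤ.+ l * identity i j
    V𝟙≡l        : ∀ r → (V ⊛ 𝟙) r ≡ ℤ.+ l * 𝟙 {n} r
    VMV≡l²M′    : ∀ i j → ((V ᵀ ⊗ M) ⊗ V) i j ≡ ℤ.+ l * ℤ.+ l * M′ i j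
    primitivity : ∀ {p} → Prime p → p ℕ∣.∣ l → ∃ λ i → Nontrivial p (λ r → V r i)

  open SymmetricPowers M-sym
  open Walks M-sym a (ℤ.+ c) d M𝟙≡cd diagonal handshake

  walk-matrix : Matrix n n
  walk-matrix r k = walk (toℕ k) r

  private
    L C : ℤ
    L = ℤ.+ l
    C = ℤ.+ c
    L≢0 : L ≢ 0ℤ
    L≢0 eq = ℕ.>⇒≢ 1≤l (ℤ.+-injective eq)
    C≢0 : C ≢ 0ℤ
    C≢0 eq = ℕ.>⇒≢ 1≤c (ℤ.+-injective eq)

    detV≢0 : detℤ V ≢ 0ℤ
    detV≢0 detV≡0 = *≢0 (product≢0 {n} {const (L * L)} λ _ → *≢0 L≢0 L≢0) det-identity≢0 (begin
        product {n} (const (L * L)) * detℤ (identity {n})  ≡⟨ sym (det-scale-rows (const (L * L)) (identity {n})) ⟩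
        detℤ (λ i j → L * L * identity {n} i j)            ≡⟨ sym (det-cong VV≡l²) ⟩
        detℤ (V ᵀ ⊗ V)                                     ≡⟨ det-⊗ (V ᵀ) V ⟩
        detℤ (V ᵀ) * detℤ V                                ≡⟨ cong (detℤ (V ᵀ) *_) detV≡0 ⟩
        detℤ (V ᵀ) * 0ℤ                                    ≡⟨ ℤ.*-zeroʳ (detℤ (V ᵀ)) ⟩
        0ℤ                                                 ∎)
      where
      open ≡-Reasoning
      det-identity≢0 : detℤ (identity {n}) ≢ 0ℤ
      det-identity≢0 det≡0 = contradiction (trans (sym (det-identity n)) det≡0) λ ()

    VVᵀ≡l² : ∀ i j → (V ⊗ V ᵀ) i j ≡ L * L * identity i j
    VVᵀ≡l² = left-inverse⇒right-inverse V (V ᵀ) (L * L) detV≢0 VV≡l²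

    scalar-⊛ : ∀ e (x : Vector ℤ n) r → sum (λ k → e * identity r k * x k) ≡ e * x r
    scalar-⊛ e x r = trans (sum-cong-≗ λ k → trans (rotate e (identity r k) (x k)) (cong (λ i → e * (x k * i)) (identity-sym r k)))
      (trans (sym (*-distribˡ-sum e (λ k → x k * identity k r))) (cong (e *_) (sum-identity x r)))
      where
      rotate : ∀ e i x → e * i * x ≡ e * (x * i)
      rotate = solve-∀

    -- Multiplying Vᵀ M V = l² M′ by V on the left and using V Vᵀ = l² leaves a factor l² to cancel.
    intertwine : ∀ i j → (M ⊗ V) i j ≡ (V ⊗ M′) i j
    intertwine i j = ℤ.*-cancelˡ-≡ (L * L) _ _ {{ℤ.≢-nonZero (*≢0 L≢0 L≢0)}} (begin
      L * L * (M ⊗ V) i j                            ≡⟨ sym (scalar-⊛ (L * L) (λ k → (M ⊗ V) k j) i) ⟩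
      sum (λ k → L * L * identity i k * (M ⊗ V) k j) ≡⟨ sum-cong-≗ (λ k → cong (_* (M ⊗ V) k j) (sym (VVᵀ≡l² i k))) ⟩
      ((V ⊗ V ᵀ) ⊗ (M ⊗ V)) i j                      ≡⟨ sym (⊗-assoc V (V ᵀ) (M ⊗ V) i j) ⟩
      (V ⊗ (V ᵀ ⊗ (M ⊗ V))) i j                      ≡⟨ sum-cong-≗ (λ k → cong (V i k *_) (trans (⊗-assoc (V ᵀ) M V k j) (VMV≡l²M′ k j))) ⟩
      V i ∙ (λ k → L * L * M′ k j)                   ≡⟨ ∙-scaleʳ (V i) (L * L) (λ k → M′ k j) ⟩
      L * L * (V ⊗ M′) i j                           ∎)
      where open ≡-Reasoning

    power-intertwine : ∀ k x r → power M k (V ⊛ x) r ≡ (V ⊛ power M′ k x) r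
    power-intertwine zero    x r = refl
    power-intertwine (suc k) x r = begin
      (M ⊛ power M k (V ⊛ x)) r     ≡⟨ ⊛-congʳ M (power-intertwine k x) r ⟩
      (M ⊛ V ⊛ power M′ k x) r      ≡⟨ ⊗-⊛ M V (power M′ k x) r ⟩
      (M ⊗ V ⊛ power M′ k x) r      ≡⟨ sum-cong-≗ (λ j → cong (_* power M′ k x j) (intertwine r j)) ⟩
      (V ⊗ M′ ⊛ power M′ k x) r     ≡⟨ sym (⊗-⊛ V M′ (power M′ k x) r) ⟩
      (V ⊛ M′ ⊛ power M′ k x) r     ∎
      where open ≡-Reasoning

    isometry : ∀ x y → (V ⊛ x) ∙ (V ⊛ y) ≡ L * L * (x ∙ y)
    isometry x y = begin
      (V ⊛ x) ∙ (V ⊛ y)             ≡⟨ adjoint V (V ⊛ x) y ⟩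
      (V ᵀ ⊛ V ⊛ x) ∙ y             ≡⟨ ∙-cong {y = y} (λ i → trans (⊗-⊛ (V ᵀ) V x i)
                                         (trans (sum-cong-≗ λ j → cong (_* x j) (VV≡l² i j)) (scalar-⊛ (L * L) x i))) (λ _ → refl) ⟩
      (λ i → L * L * x i) ∙ y       ≡⟨ ∙-scaleˡ (L * L) x y ⟩
      L * L * (x ∙ y)               ∎
      where open ≡-Reasoning

    moment : ∀ k x y → (V ⊛ x) ∙ power M k (V ⊛ y) ≡ L * L * (x ∙ power M′ k y)
    moment k x y = trans (∙-cong {x = V ⊛ x} (λ _ → refl) (power-intertwine k y)) (isometry x (power M′ k y))

    -- Since V 𝟙 = l 𝟙, one of the two factors l in `moment` cancels and one remains.
    ones-moment : ∀ k x → (V ⊛ x) ∙ power M k 𝟙 ≡ L * (x ∙ power M′ k 𝟙)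
    ones-moment k x = ℤ.*-cancelˡ-≡ L _ _ {{ℤ.≢-nonZero L≢0}} (begin
      L * ((V ⊛ x) ∙ power M k 𝟙)                 ≡⟨ expand ⟩
      (V ⊛ x) ∙ power M k (λ i → L * 𝟙 {n} i + 0ℤ * 𝟙 {n} i)
                                                  ≡⟨ ∙-cong {x = V ⊛ x} (λ _ → refl) (power-cong M k λ i →
                                                       trans (ℤ.+-identityʳ _) (sym (V𝟙≡l i))) ⟩
      (V ⊛ x) ∙ power M k (V ⊛ 𝟙)                 ≡⟨ moment k x 𝟙 ⟩
      L * L * (x ∙ power M′ k 𝟙)                  ≡⟨ ℤ.*-assoc L L (x ∙ power M′ k 𝟙) ⟩
      L * (L * (x ∙ power M′ k 𝟙))                ∎)
      where
      open ≡-Reasoning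
      plus-zero : ∀ l e → l * e ≡ l * e + 0ℤ * e
      plus-zero = solve-∀
      expand : L * ((V ⊛ x) ∙ power M k 𝟙) ≡ (V ⊛ x) ∙ power M k (λ i → L * 𝟙 {n} i + 0ℤ * 𝟙 {n} i)
      expand = trans (plus-zero L ((V ⊛ x) ∙ power M k 𝟙)) (sym (moment-linearʳ k (V ⊛ x) L 0ℤ 𝟙 𝟙))

  -- Both graphs share `c`, so the factor in Mᵏ⁺¹ 𝟙 = c Mᵏ d cancels against the one for M′ and d′.
  -- The quotient by l is an integer read off from the second graph.
  walk-level : ∀ k x → L ∣ (V ⊛ x) ∙ walk k
  walk-level zero    x = ∣-resp (sym (ones-moment 0 x)) (∣m⇒∣m*n _ ∣-refl)
  walk-level (suc k) x = divides (x ∙ power M′ k d′) (trans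
    (ℤ.*-cancelˡ-≡ C _ _ {{ℤ.≢-nonZero C≢0}} (begin
      C * ((V ⊛ x) ∙ power M k d)           ≡⟨ sym (∙-scaleʳ (V ⊛ x) C (power M k d)) ⟩
      (V ⊛ x) ∙ (λ i → C * power M k d i)   ≡⟨ ∙-cong {x = V ⊛ x} (λ _ → refl) (λ i → sym (degree-power M C d M𝟙≡cd k i)) ⟩
      (V ⊛ x) ∙ power M (suc k) 𝟙           ≡⟨ ones-moment (suc k) x ⟩
      L * (x ∙ power M′ (suc k) 𝟙)          ≡⟨ cong (L *_) (trans (∙-cong {x = x} (λ _ → refl) (degree-power M′ C d′ M′𝟙≡cd′ k))
                                                 (∙-scaleʳ x C (power M′ k d′))) ⟩
      L * (C * (x ∙ power M′ k d′))         ≡⟨ rotate L C (x ∙ power M′ k d′) ⟩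
      C * (L * (x ∙ power M′ k d′))         ∎))
    (ℤ.*-comm L (x ∙ power M′ k d′)))
    where
    open ≡-Reasoning
    rotate : ∀ l c e → l * (c * e) ≡ c * (l * e)
    rotate = solve-∀

  moment-level : ∀ k x → L * L ∣ (V ⊛ x) ∙ power M k (V ⊛ x)
  moment-level k x = ∣-resp (sym (moment k x x)) (∣m⇒∣m*n _ ∣-refl)

  column : Fin n → Vector ℤ n
  column i = V ⊛ (λ k → identity k i)

  column-norm : ∀ i → column i ∙ column i ≡ L * L
  column-norm i = trans (isometry (λ k → identity k i) (λ k → identity k i))
    (trans (cong (L * L *_) (trans (sum-identity (λ k → identity k i) i) (identity-diag i))) (ℤ.*-identityʳ (L * L)))

  unit-column : ∀ {p} → Prime p → p ℕ∣.∣ l → ∃ λ i → Nontrivial p (column i)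
  unit-column pr p∣l with primitivity pr p∣l
  ... | i , r , p∤v = i , r , λ p∣ → p∤v (∣-resp (sum-identity (V r) i) p∣)

  -- The walk after 𝟙 is M 𝟙 divided by `c`, so `c` appears in the first shift alone.
  shift-factor : ℕ → ℤ
  shift-factor zero    = C
  shift-factor (suc _) = 1ℤ

  walk-shift : ∀ k r → (M ⊛ walk k) r ≡ shift-factor k * walk (suc k) r
  walk-shift zero    r = M𝟙≡cd r
  walk-shift (suc k) r = sym (ℤ.*-identityˡ _)

  square-∣ : ∀ {p} → p ℕ∣.∣ l → ℤ.+ p * ℤ.+ p ∣ L * L
  square-∣ {p} p∣l = ∣-trans (*-monoʳ-∣ (ℤ.+ p) p∣L) (*-monoˡ-∣ L p∣L)
    where
    p∣L : ℤ.+ p ∣ L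
    p∣L = ∣ᵤ⇒∣ p∣l

  column∙walk : ∀ i k → L ∣ column i ∙ walk k
  column∙walk i k = walk-level k (λ j → identity j i)

  column-moment : ∀ {p} → p ℕ∣.∣ l → ∀ i k → ℤ.+ p * ℤ.+ p ∣ column i ∙ power M k (column i)
  column-moment p∣l i k = ∣-trans (square-∣ p∣l) (moment-level k (λ j → identity j i))

-- `OddLevel` needs all shift factors to be units, which fails at the first one if p divides `c`;
-- the rank condition settles that case. As p is not 2, it meets the determinant only through `z`.
odd-prime∤level : ∀ {m} (D : LevelData (suc m)) {z} h → detℤ (LevelData.walk-matrix D) ≡ z * ℤ.+ (2 ℕ.^ h) →
  ∀ {p} → Prime p → p ≢ 2 → ¬ ℤ.+ p * ℤ.+ p ∣ z →
  (p ℕ∣.∣ LevelData.c D → ∀ x → (∀ r → ℤ.+ p ∣ (LevelData.walk-matrix D ⊛ x) r) → ∀ k → ℤ.+ p ∣ x k) →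
  ¬ p ℕ∣.∣ LevelData.l D
odd-prime∤level {m} D {z} h det≡ {p} pr p≢2 pp∤z full-rank p∣l = OddLevel.impossible pr {M = M} {W = walk-matrix} M-sym
  (λ k → shift-factor (toℕ k)) (λ k → p∤shift-factor (toℕ k)) shift pp∤det {v} v≢0
  (λ k → p∣v∙walk (toℕ k)) p∣Mv∙walk (column-moment p∣l i 0) (column-moment p∣l i 1)
  where
  open LevelData D
  open SymmetricPowers M-sym
  open Walks M-sym a (ℤ.+ c) d M𝟙≡cd diagonal handshake
  W = walk-matrix
  i : Fin (suc m)
  i = proj₁ (unit-column pr p∣l)
  v : Vector ℤ (suc m)
  v = column i
  v≢0 : Nontrivial p v
  v≢0 = proj₂ (unit-column pr p∣l)
  p∣v∙walk : ∀ k → ℤ.+ p ∣ v ∙ walk k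
  p∣v∙walk k = ∣-trans (∣ᵤ⇒∣ p∣l) (column∙walk i k)
  -- For the last column this uses the walk one past the matrix, so orthogonality is needed for
  -- walks of every length.
  p∣Mv∙walk : ∀ k → ℤ.+ p ∣ (M ⊛ v) ∙ walk (toℕ k)
  p∣Mv∙walk k = ∣-resp (sym (trans (self-adjoint v (walk (toℕ k))) (trans (∙-cong {x = v} (λ _ → refl) (walk-shift (toℕ k)))
    (∙-scaleʳ v (shift-factor (toℕ k)) (walk (suc (toℕ k))))))) (∣n⇒∣m*n (shift-factor (toℕ k)) (p∣v∙walk (suc (toℕ k))))
  shift : ∀ (k : Fin m) r → (M ⊛ walk (toℕ (inject₁ k))) r ≡ shift-factor (toℕ k) * walk (suc (toℕ k)) r
  shift k r = trans (cong (λ k → (M ⊛ walk k) r) (Fin.toℕ-inject₁ k)) (walk-shift (toℕ k) r)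
  -- A matrix of full rank modulo p has no nonzero vector orthogonal to all its columns.
  p∤c : ¬ p ℕ∣.∣ c
  p∤c p∣c with orthogonal⇒dependent pr {suc m} {1} {suc m} (λ _ → v) (W ᵀ) (ℕ.n<1+n (suc m)) (λ _ k → p∣v∙walk (toℕ k))
  ... | inj₁ (y , (zero , p∤y) , p∣yv) = proj₂ v≢0 (∣*-cancelˡ pr p∤y (∣-resp (ℤ.+-identityʳ _) (p∣yv (proj₁ v≢0))))
  ... | inj₂ (x , (k , p∤x) , p∣xW)    = p∤x (full-rank p∣c x (λ r → ∣-resp (∙-comm x (W r)) (p∣xW r)) k)
  p∤shift-factor : ∀ k → ¬ ℤ.+ p ∣ shift-factor k
  p∤shift-factor zero    p∣ = p∤c (∣⇒∣ᵤ p∣)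
  p∤shift-factor (suc k) p∣ = ∤1 pr p∣
  pp∤det : ¬ ℤ.+ p * ℤ.+ p ∣ detℤ W
  pp∤det pp∣det = pp∤z (prime-square-cancel pr (prime∤2^ pr p≢2 h) (∣-resp (trans det≡ (ℤ.*-comm z (ℤ.+ (2 ℕ.^ h)))) pp∣det))

odd-order-level : ∀ h (D : LevelData (suc (h ℕ.* 2))) {z} →
  detℤ (LevelData.walk-matrix D) ≡ z * ℤ.+ (2 ℕ.^ h) → ¬ ℤ.+ 2 ∣ z → ¬ 2 ℕ∣.∣ LevelData.l D
odd-order-level h D {z} det≡ z-odd 2∣l with LevelData.unit-column D prime[2] 2∣l
... | i , r , 2∤v = 2∤v (OddOrder.odd-order-even-column h M-sym a (ℤ.+ c) d M𝟙≡cd diagonal handshake {z} det≡ z-odd {column i}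
  (λ k → ∣-trans (∣ᵤ⇒∣ 2∣l) (column∙walk i k)) (column-moment 2∣l i) r)
  where open LevelData D

twice-odd-without-odd-prime : ∀ {l} → 1 ≤ l → 2 ℕ∣.∣ l → ¬ 4 ℕ∣.∣ l →
                              (∀ {p} → Prime p → p ≢ 2 → ¬ p ℕ∣.∣ l) → l ≡ 2
twice-odd-without-odd-prime 1≤l (ℕ∣.divides zero refl)       4∤l p∤l = contradiction 1≤l λ ()
twice-odd-without-odd-prime 1≤l (ℕ∣.divides (suc zero) refl) 4∤l p∤l = refl
twice-odd-without-odd-prime 1≤l (ℕ∣.divides m@(suc (suc _)) refl) 4∤l p∤l
  with p , pr , p∣m ← prime-divisor {m} (ℕ.s≤s (ℕ.s≤s ℕ.z≤n))
  with p ℕ.≟ 2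
... | yes refl = contradiction (ℕ∣.*-monoˡ-∣ 2 p∣m) 4∤l
... | no p≢2   = contradiction (ℕ∣.∣m⇒∣m*n 2 p∣m) (p∤l pr p≢2)

even-order-level : ∀ h (D : LevelData (suc h ℕ.* 2)) {z} → 5 ≤ suc h ℕ.* 2 →
  LevelData.c D ≡ 1 ⊎ 2 ℕ∣.∣ LevelData.c D → detℤ (LevelData.walk-matrix D) ≡ z * ℤ.+ (2 ℕ.^ suc h) → ¬ ℤ.+ 2 ∣ z →
  (∀ {p} → Prime p → ¬ ℤ.+ p * ℤ.+ p ∣ z) →
  (∀ {p} → Prime p → p ≢ 2 → p ℕ∣.∣ LevelData.c D → ∀ x → (∀ r → ℤ.+ p ∣ (LevelData.walk-matrix D ⊛ x) r) → ∀ k → ℤ.+ p ∣ x k) →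
  ¬ 2 ℕ∣.∣ LevelData.l D
even-order-level h D {z} 5≤n parity-c det≡ z-odd z-squarefree full-rank 2∣l = cases parity-c
  where
  open LevelData D
  open Walks M-sym a (ℤ.+ c) d M𝟙≡cd diagonal handshake
  open EvenOrder h M-sym a (ℤ.+ c) d M𝟙≡cd diagonal handshake
  i : Fin (suc h ℕ.* 2)
  i = proj₁ (unit-column prime[2] 2∣l)
  v : Vector ℤ (suc h ℕ.* 2)
  v = column i
  v≢0 : Nontrivial 2 v
  v≢0 = proj₂ (unit-column prime[2] 2∣l)
  2∣v∙walk : ∀ k → ℤ.+ 2 ∣ v ∙ walk k
  2∣v∙walk k = ∣-trans (∣ᵤ⇒∣ 2∣l) (column∙walk i k)
  4∤l : ¬ 4 ℕ∣.∣ l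
  4∤l 4∣l = proj₂ v≢0 (quadruple-walks⇒even {z} det≡ z-odd v (λ k → ∣-trans (∣ᵤ⇒∣ 4∣l) (column∙walk i k)) (proj₁ v≢0))
  l≡2 : l ≡ 2
  l≡2 = twice-odd-without-odd-prime 1≤l 2∣l 4∤l λ pr p≢2 →
    odd-prime∤level D {z} (suc h) det≡ pr p≢2 (z-squarefree pr) (full-rank pr p≢2)
  cases : c ≡ 1 ⊎ 2 ℕ∣.∣ c → ⊥
  cases (inj₁ c≡1) = proj₂ v≢0 (even-order-even-column {z} det≡ z-odd {v} 2∣v∙walk (column-moment 2∣l i) (cong ℤ.+_ c≡1) (proj₁ v≢0))
  -- All entries of v are odd, so its norm 4 is at least n.
  cases (inj₂ 2∣c) = ℕ.<⇒≱ 5≤n (ℤ.drop‿+≤+ (subst (ℤ.+ (suc h ℕ.* 2) ℤ.≤_)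
    (trans (column-norm i) (cong (λ l → ℤ.+ l * ℤ.+ l) l≡2))
    (norm-lower-bound {v = v} λ r → ∤⇒≢0 (even-order-odd-column {z} det≡ z-odd {v} 2∣v∙walk (column-moment 2∣l i) (∣ᵤ⇒∣ 2∣c) v≢0 r))))

-- From rational to integral matrices

fromℤ : ℤ → ℚ
fromℤ z = z ℚ./ 1

-- `_/_` normalises by a gcd and is stuck on a variable; on the constructor form the operations
-- compute, which gives the homomorphism laws.
fromℤ-normal : ∀ z → fromℤ z ≡ mkℚ z 0 (Coprimality.sym (Coprimality.1-coprimeTo ℤ.∣ z ∣))
fromℤ-normal z = ℚ.↥p/↧p≡p (mkℚ z 0 _)

numerator-fromℤ : ∀ z → ℚ.numerator (fromℤ z) ≡ z
numerator-fromℤ z = cong ℚ.numerator (fromℤ-normal z)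

fromℤ-injective : ∀ {x y} → fromℤ x ≡ fromℤ y → x ≡ y
fromℤ-injective {x} {y} eq = trans (sym (numerator-fromℤ x)) (trans (cong ℚ.numerator eq) (numerator-fromℤ y))

fromℤ-* : ∀ x y → fromℤ (x * y) ≡ fromℤ x ℚ.* fromℤ y
fromℤ-* x y = sym (cong₂ ℚ._*_ (fromℤ-normal x) (fromℤ-normal y))

fromℤ-+ : ∀ x y → fromℤ (x + y) ≡ fromℤ x ℚ.+ fromℤ y
fromℤ-+ x y = sym (trans (cong₂ ℚ._+_ (fromℤ-normal x) (fromℤ-normal y))
  (cong₂ (λ a b → (a + b) ℚ./ 1) (ℤ.*-identityʳ x) (ℤ.*-identityʳ y)))

fromℤ-inverse : ∀ m → fromℤ (ℤ.+ suc m) ℚ.* (1ℤ ℚ./ suc m) ≡ 1ℚ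
fromℤ-inverse m = ℚ.toℚᵘ-injective (begin
  toℚᵘ (fromℤ (ℤ.+ suc m) ℚ.* (1ℤ ℚ./ suc m))                   ≈⟨ ℚ.toℚᵘ-homo-* (fromℤ (ℤ.+ suc m)) (1ℤ ℚ./ suc m) ⟩
  toℚᵘ (fromℤ (ℤ.+ suc m)) ℚᵘ.* toℚᵘ (1ℤ ℚ./ suc m)             ≈⟨ ℚᵘ.*-cong (ℚ.toℚᵘ-fromℚᵘ (ℚᵘ.mkℚᵘ (ℤ.+ suc m) 0))
                                                                     (ℚ.toℚᵘ-fromℚᵘ (ℚᵘ.mkℚᵘ 1ℤ m)) ⟩
  ℚᵘ.mkℚᵘ (ℤ.+ suc m) 0 ℚᵘ.* ℚᵘ.mkℚᵘ 1ℤ m                       ≈⟨ ℚᵘ.*≡* (cancel (ℤ.+ suc m)) ⟩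
  ℚᵘ.1ℚᵘ                                                        ∎)
  where
  open ℚᵘ.≃-Reasoning
  cancel : ∀ x → x * 1ℤ * 1ℤ ≡ 1ℤ * (1ℤ * x)
  cancel = solve-∀

sum-fromℤ : ∀ {n} {f : Fin n → ℚ} {g : Vector ℤ n} → (∀ i → f i ≡ fromℤ (g i)) → sumℚ f ≡ fromℤ (sum g)
sum-fromℤ {zero}  f≡g = refl
sum-fromℤ {suc n} {f} {g} f≡g = trans (cong₂ ℚ._+_ (f≡g zero) (sum-fromℤ (f≡g ∘ suc))) (sym (fromℤ-+ (g zero) _))

sumℚ-cong : ∀ {n} {f g : Fin n → ℚ} → (∀ i → f i ≡ g i) → sumℚ f ≡ sumℚ g
sumℚ-cong {zero}  f≡g = refl
sumℚ-cong {suc n} f≡g = cong₂ ℚ._+_ (f≡g zero) (sumℚ-cong (f≡g ∘ suc))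

*-distribˡ-sumℚ : ∀ {n} r (f : Fin n → ℚ) → sumℚ (λ i → r ℚ.* f i) ≡ r ℚ.* sumℚ f
*-distribˡ-sumℚ {zero}  r f = sym (ℚ.*-zeroʳ r)
*-distribˡ-sumℚ {suc n} r f = trans (cong (r ℚ.* f zero ℚ.+_) (*-distribˡ-sumℚ r (f ∘ suc)))
  (sym (ℚ.*-distribˡ-+ r (f zero) (sumℚ (f ∘ suc))))

sumℤ≡sum : ∀ {n} (f : Vector ℤ n) → sumℤ f ≡ sum f
sumℤ≡sum {zero}  f = refl
sumℤ≡sum {suc n} f = cong (f zero +_) (sumℤ≡sum (f ∘ suc))

sign-fromℤ : ∀ k → signℚ k ≡ fromℤ (sign k)
sign-fromℤ zero          = refl
sign-fromℤ (suc zero)    = refl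
sign-fromℤ (suc (suc k)) = trans (sign-fromℤ k) (cong fromℤ (sym (ℤ.neg-involutive (sign k))))

det-fromℤ : ∀ {n} {A : Mat n} {B : Matrix n n} → (∀ i j → A i j ≡ fromℤ (B i j)) → det A ≡ fromℤ (detℤ B)
det-fromℤ {zero}  A≡B = refl
det-fromℤ {suc n} {A} {B} A≡B = sum-fromℤ {g = λ j → sign (toℕ j) * (B zero j * detℤ (minor B zero j))} λ j → trans
  (cong₂ ℚ._*_ (sign-fromℤ (toℕ j)) (trans (cong₂ ℚ._*_ (A≡B zero j) (det-fromℤ {B = minor B zero j} λ r c → A≡B (suc r) (punchIn j c)))
    (sym (fromℤ-* (B zero j) (detℤ (minor B zero j))))))
  (sym (fromℤ-* (sign (toℕ j)) (B zero j * detℤ (minor B zero j))))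

δ-fromℤ : ∀ {n} (i j : Fin n) → δ i j ≡ fromℤ (identity i j)
δ-fromℤ i j with i Fin.≟ j
... | yes refl = cong fromℤ (sym (identity-diag i))
... | no i≢j   = cong fromℤ (sym (identity-off i≢j))

-- The integral matrix of a graph

module IntegerGraph {n} (G : Graph n) (a b : ℤ) where

  adjacency : Matrix n n
  adjacency i j with adj G i j
  ... | true  = 1ℤ
  ... | false = 0ℤ

  adjacency-fromℤ : ∀ i j → adjMat G i j ≡ fromℤ (adjacency i j)
  adjacency-fromℤ i j with adj G i j
  ... | true  = refl
  ... | false = refl

  adjacency-sym : Symmetric adjacency
  adjacency-sym i j rewrite adj-sym G i j = refl

  adjacency-diag : ∀ i → adjacency i i ≡ 0ℤ
  adjacency-diag i rewrite irrefl G i = refl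

  degrees : Vector ℤ n
  degrees i = sum (adjacency i)

  matrix : Matrix n n
  matrix i j = a * (identity i j * degrees i) + b * adjacency i j

  matrix-sym : Symmetric matrix
  matrix-sym i j = cong₂ (λ x y → a * x + b * y) diagonal-part (adjacency-sym i j)
    where
    diagonal-part : identity i j * degrees i ≡ identity j i * degrees j
    diagonal-part with i Fin.≟ j
    ... | yes refl = refl
    ... | no i≢j   = cong₂ (λ x y → x * y) (identity-off i≢j) refl ⟨ trans ⟩
                       sym (cong₂ (λ x y → x * y) (identity-off (i≢j ∘ sym)) refl)

  matrix-diag : ∀ i → matrix i i ≡ a * degrees i
  matrix-diag i = trans (cong₂ (λ x y → a * (x * degrees i) + b * y) (identity-diag i) (adjacency-diag i))
    (simplify a b (degrees i))
    where
    simplify : ∀ a b d → a * (1ℤ * d) + b * 0ℤ ≡ a * d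
    simplify = solve-∀

  matrix-𝟙 : ∀ {c} → a + b ≡ c → ∀ r → (matrix ⊛ 𝟙) r ≡ c * degrees r
  matrix-𝟙 {c} a+b≡c r = begin
    sum (λ j → matrix r j * 1ℤ)
      ≡⟨ sum-cong-≗ (λ j → expand a b (identity r j) (degrees r) (adjacency r j)) ⟩
    sum (λ j → a * (degrees r * identity r j) + b * adjacency r j)
      ≡⟨ sum-linear a b (λ j → degrees r * identity r j) (adjacency r) ⟩
    a * sum (λ j → degrees r * identity r j) + b * degrees r
      ≡⟨ cong (λ x → a * x + b * degrees r) (trans (sum-cong-≗ λ j → cong (degrees r *_) (identity-sym r j))
           (sum-identity (λ _ → degrees r) r)) ⟩
    a * degrees r + b * degrees r
      ≡⟨ trans (sym (ℤ.*-distribʳ-+ (degrees r) a b)) (cong (_* degrees r) a+b≡c) ⟩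
    c * degrees r ∎
    where
    open ≡-Reasoning
    expand : ∀ a b i d e → (a * (i * d) + b * e) * 1ℤ ≡ a * (d * i) + b * e
    expand = solve-∀

  -- `quadratic-parity` for the adjacency matrix at 𝟙, where the zero diagonal leaves nothing to
  -- subtract.
  handshake : ℤ.+ 2 ∣ 𝟙 ∙ degrees
  handshake = ∣-resp (begin
    𝟙 ∙ (adjacency ⊛ 𝟙) + - sum (λ i → adjacency i i * 1ℤ)
      ≡⟨ cong₂ (λ x y → x + - y) (∙-cong {x = 𝟙 {n}} (λ _ → refl) λ i → sum-cong-≗ λ j → ℤ.*-identityʳ (adjacency i j))
           (sum-zero λ i → cong (_* 1ℤ) (adjacency-diag i)) ⟩
    𝟙 ∙ degrees + 0ℤ
      ≡⟨ ℤ.+-identityʳ (𝟙 ∙ degrees) ⟩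
    𝟙 ∙ degrees ∎)
    (quadratic-parity adjacency-sym 𝟙)
    where open ≡-Reasoning

  module _ (α : ℚ) (c : ℕ) (cα≡a : ℕtoℚ c ℚ.* α ≡ fromℤ a) (c[1-α]≡b : ℕtoℚ c ℚ.* (1ℚ ℚ.- α) ≡ fromℤ b) where

    coefficient-sum : a + b ≡ ℤ.+ c
    coefficient-sum = fromℤ-injective (begin
      fromℤ (a + b)                                       ≡⟨ fromℤ-+ a b ⟩
      fromℤ a ℚ.+ fromℤ b                                 ≡⟨ sym (cong₂ ℚ._+_ cα≡a c[1-α]≡b) ⟩
      ℕtoℚ c ℚ.* α ℚ.+ ℕtoℚ c ℚ.* (1ℚ ℚ.- α)              ≡⟨ sym (ℚ.*-distribˡ-+ (ℕtoℚ c) α (1ℚ ℚ.- α)) ⟩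
      ℕtoℚ c ℚ.* (α ℚ.+ (1ℚ ℚ.- α))                       ≡⟨ cong (ℕtoℚ c ℚ.*_) (cancel α) ⟩
      ℕtoℚ c ℚ.* 1ℚ                                       ≡⟨ ℚ.*-identityʳ (ℕtoℚ c) ⟩
      ℕtoℚ c                                              ∎)
      where
      open ≡-Reasoning
      cancel : ∀ α → α ℚ.+ (1ℚ ℚ.- α) ≡ 1ℚ
      cancel α = trans (cong (α ℚ.+_) (ℚ.+-comm 1ℚ (ℚ.- α))) (trans (sym (ℚ.+-assoc α (ℚ.- α) 1ℚ))
        (trans (cong (ℚ._+ 1ℚ) (ℚ.+-inverseʳ α)) (ℚ.+-identityˡ 1ℚ)))

    matrix-fromℤ : ∀ i j → Ac α c G i j ≡ fromℤ (matrix i j)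
    matrix-fromℤ i j = begin
      ℕtoℚ c ℚ.* (α ℚ.* degMat G i j ℚ.+ (1ℚ ℚ.- α) ℚ.* adjMat G i j)
        ≡⟨ ℚ.*-distribˡ-+ (ℕtoℚ c) (α ℚ.* degMat G i j) ((1ℚ ℚ.- α) ℚ.* adjMat G i j) ⟩
      ℕtoℚ c ℚ.* (α ℚ.* degMat G i j) ℚ.+ ℕtoℚ c ℚ.* ((1ℚ ℚ.- α) ℚ.* adjMat G i j)
        ≡⟨ sym (cong₂ ℚ._+_ (ℚ.*-assoc (ℕtoℚ c) α (degMat G i j)) (ℚ.*-assoc (ℕtoℚ c) (1ℚ ℚ.- α) (adjMat G i j))) ⟩
      ℕtoℚ c ℚ.* α ℚ.* degMat G i j ℚ.+ ℕtoℚ c ℚ.* (1ℚ ℚ.- α) ℚ.* adjMat G i j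
        ≡⟨ cong₂ ℚ._+_
             (cong₂ ℚ._*_ cα≡a (trans (cong₂ ℚ._*_ (δ-fromℤ i j) (sum-fromℤ (adjacency-fromℤ i)))
               (sym (fromℤ-* (identity i j) (degrees i)))))
             (cong₂ ℚ._*_ c[1-α]≡b (adjacency-fromℤ i j)) ⟩
      fromℤ a ℚ.* fromℤ (identity i j * degrees i) ℚ.+ fromℤ b ℚ.* fromℤ (adjacency i j)
        ≡⟨ sym (cong₂ ℚ._+_ (fromℤ-* a (identity i j * degrees i)) (fromℤ-* b (adjacency i j))) ⟩
      fromℤ (a * (identity i j * degrees i)) ℚ.+ fromℤ (b * adjacency i j)
        ≡⟨ sym (fromℤ-+ (a * (identity i j * degrees i)) (b * adjacency i j)) ⟩
      fromℤ (matrix i j) ∎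
      where open ≡-Reasoning

    power-fromℤ : ∀ k r → pow▷ (Ac α c G) k ones r ≡ fromℤ (power matrix k 𝟙 r)
    power-fromℤ zero    r = refl
    power-fromℤ (suc k) r = sum-fromℤ λ j → trans (cong₂ ℚ._*_ (matrix-fromℤ r j) (power-fromℤ k j))
      (sym (fromℤ-* (matrix r j) (power matrix k 𝟙 j)))

    module _ (1≤c : 1 ≤ c) where

      open Walks matrix-sym a (ℤ.+ c) degrees (matrix-𝟙 coefficient-sum) matrix-diag handshake

      divℕ-fromℤ : ∀ {c} → 1 ≤ c → ∀ x → divℕ (fromℤ (ℤ.+ c * x)) c ≡ fromℤ x
      divℕ-fromℤ {suc m} _ x = begin
        fromℤ (ℤ.+ suc m * x) ℚ.* (1ℤ ℚ./ suc m)              ≡⟨ cong (λ y → fromℤ y ℚ.* (1ℤ ℚ./ suc m)) (ℤ.*-comm (ℤ.+ suc m) x) ⟩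
        fromℤ (x * ℤ.+ suc m) ℚ.* (1ℤ ℚ./ suc m)              ≡⟨ cong (ℚ._* (1ℤ ℚ./ suc m)) (fromℤ-* x (ℤ.+ suc m)) ⟩
        fromℤ x ℚ.* fromℤ (ℤ.+ suc m) ℚ.* (1ℤ ℚ./ suc m)      ≡⟨ ℚ.*-assoc (fromℤ x) (fromℤ (ℤ.+ suc m)) (1ℤ ℚ./ suc m) ⟩
        fromℤ x ℚ.* (fromℤ (ℤ.+ suc m) ℚ.* (1ℤ ℚ./ suc m))    ≡⟨ cong (fromℤ x ℚ.*_) (fromℤ-inverse m) ⟩
        fromℤ x ℚ.* 1ℚ                                        ≡⟨ ℚ.*-identityʳ (fromℤ x) ⟩
        fromℤ x                                               ∎
        where open ≡-Reasoning

      -- Division by `c` is exact because M 𝟙 is `c` times the degree vector; this is the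
      -- integrality of the walk matrix.
      walk-fromℤ : ∀ i k → W̃ α c G i k ≡ fromℤ (walk (toℕ k) i)
      walk-fromℤ i zero    = refl
      walk-fromℤ i (suc k) = trans (cong (λ x → divℕ x c) (trans (power-fromℤ (suc (toℕ k)) i)
          (cong fromℤ (degree-power matrix (ℤ.+ c) degrees (matrix-𝟙 coefficient-sum) (toℕ k) i))))
        (divℕ-fromℤ 1≤c (power matrix (toℕ k) degrees i))

halve : ∀ n → ∃ λ h → n ≡ h ℕ.* 2 ⊎ n ≡ suc (h ℕ.* 2)
halve zero = 0 , inj₁ refl
halve (suc n) with halve n
... | h , inj₁ n≡ = h , inj₂ (cong suc n≡)
... | h , inj₂ n≡ = suc h , inj₁ (cong suc n≡)

odd-prime : ∀ {p} → Prime p → p ≢ 2 → Odd p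
odd-prime pr p≢2 2∣p with prime⇒irreducible pr 2∣p
... | inj₁ ()
... | inj₂ refl = p≢2 refl

level-odd : ∀ {n} (D : LevelData n) {z} → n ≥ 5 → ¬ (Even n × Odd (LevelData.c D) × LevelData.c D ≥ 3) →
  detℤ (LevelData.walk-matrix D) ≡ z * ℤ.+ (2 ℕ.^ (n ℕ./ 2)) → ¬ ℤ.+ 2 ∣ z → (∀ {p} → Prime p → ¬ ℤ.+ p * ℤ.+ p ∣ z) →
  (∀ {p} → Prime p → p ≢ 2 → p ℕ∣.∣ LevelData.c D → ∀ x → (∀ r → ℤ.+ p ∣ (LevelData.walk-matrix D ⊛ x) r) → ∀ k → ℤ.+ p ∣ x k) →
  Odd (LevelData.l D)
level-odd {n} D {z} n≥5 not-exceptional det≡ 2∤z squarefree rank with halve n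
... | zero , inj₁ refl = contradiction n≥5 λ ()
... | suc h , inj₁ refl = even-order-level h D {z} n≥5
  (even-order-parity (LevelData.1≤c D) λ (c-odd , c≥3) → not-exceptional (ℕ∣.divides (suc h) refl , c-odd , c≥3))
  (trans det≡ (cong (λ k → z * ℤ.+ (2 ℕ.^ k)) (m*n/n≡m (suc h) 2))) 2∤z squarefree rank
... | h , inj₂ refl = odd-order-level h D {z}
  (trans det≡ (cong (λ k → z * ℤ.+ (2 ℕ.^ k)) (trans (+-distrib-/-∣ʳ 1 {h ℕ.* 2} {2} (ℕ∣.divides h refl)) (m*n/n≡m h 2)))) 2∤z

-- The integral matrix V = l U

module ScaledOrthogonal {n} (U : Mat n) (l : ℕ) (1≤l : 1 ≤ l) (lU : IntegralMat (scale (ℕtoℚ l) U)) where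

  open ≡-Reasoning

  private
    L : ℚ
    L = ℕtoℚ l

  V : Matrix n n
  V i j = proj₁ (lU i j)

  V-fromℤ : ∀ i j → fromℤ (V i j) ≡ L ℚ.* U i j
  V-fromℤ i j = sym (proj₂ (lU i j))

  private
    -- Each factor carries one l. With `f` a column of U this gives Vᵀ V, and with `f` a row of Uᵀ A
    -- it gives (Vᵀ M) V.
    scaled-sum : ∀ (f : Fin n → ℚ) (y : Vector ℤ n) → (∀ k → fromℤ (y k) ≡ L ℚ.* f k) → ∀ j →
                 fromℤ (y ∙ (λ k → V k j)) ≡ L ℚ.* L ℚ.* sumℚ (λ k → f k ℚ.* U k j)
    scaled-sum f y y≡ j = begin
      fromℤ (sum λ k → y k * V k j)                      ≡⟨ sym (sum-fromℤ λ k → sym (fromℤ-* (y k) (V k j))) ⟩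
      sumℚ (λ k → fromℤ (y k) ℚ.* fromℤ (V k j))         ≡⟨ sumℚ-cong (λ k → trans (cong₂ ℚ._*_ (y≡ k) (V-fromℤ k j))
                                                              (ℚ-*.interchange L (f k) L (U k j))) ⟩
      sumℚ (λ k → L ℚ.* L ℚ.* (f k ℚ.* U k j))           ≡⟨ *-distribˡ-sumℚ (L ℚ.* L) (λ k → f k ℚ.* U k j) ⟩
      L ℚ.* L ℚ.* sumℚ (λ k → f k ℚ.* U k j)             ∎

    unscale : ∀ {x q} y → fromℤ x ≡ L ℚ.* L ℚ.* q → q ≡ fromℤ y → x ≡ ℤ.+ l * ℤ.+ l * y
    unscale {x} {q} y x≡ q≡ = fromℤ-injective (trans x≡ (trans (cong₂ ℚ._*_ (sym (fromℤ-* (ℤ.+ l) (ℤ.+ l))) q≡)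
      (sym (fromℤ-* (ℤ.+ l * ℤ.+ l) y))))

  gram-scaled : Orthogonal U → ∀ i j → (V ᵀ ⊗ V) i j ≡ ℤ.+ l * ℤ.+ l * identity i j
  gram-scaled UU i j = unscale (identity i j) (scaled-sum (λ k → U k i) (λ k → V k i) (λ k → V-fromℤ k i) j) (trans (UU i j) (δ-fromℤ i j))

  sums-scaled : (∀ i → (U ▷ ones) i ≡ ones i) → ∀ r → (V ⊛ 𝟙) r ≡ ℤ.+ l * 𝟙 {n} r
  sums-scaled U𝟙 r = fromℤ-injective (begin
    fromℤ (sum λ j → V r j * 1ℤ)             ≡⟨ sym (sum-fromℤ {g = λ j → V r j * 1ℤ} λ j → trans (cong (ℚ._* 1ℚ) (sym (V-fromℤ r j))) (sym (fromℤ-* (V r j) 1ℤ))) ⟩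
    sumℚ (λ j → L ℚ.* U r j ℚ.* 1ℚ)          ≡⟨ sumℚ-cong (λ j → ℚ.*-assoc L (U r j) 1ℚ) ⟩
    sumℚ (λ j → L ℚ.* (U r j ℚ.* 1ℚ))        ≡⟨ *-distribˡ-sumℚ L (λ j → U r j ℚ.* 1ℚ) ⟩
    L ℚ.* sumℚ (λ j → U r j ℚ.* 1ℚ)          ≡⟨ cong (L ℚ.*_) (U𝟙 r) ⟩
    L ℚ.* 1ℚ                                 ≡⟨ sym (fromℤ-* (ℤ.+ l) 1ℤ) ⟩
    fromℤ (ℤ.+ l * 1ℤ)                       ∎)

  conjugate-scaled : ∀ {A B : Mat n} {M M′ : Matrix n n} → (∀ i j → A i j ≡ fromℤ (M i j)) → (∀ i j → B i j ≡ fromℤ (M′ i j)) →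
    (∀ i j → ((transpose U · A) · U) i j ≡ B i j) → ∀ i j → ((V ᵀ ⊗ M) ⊗ V) i j ≡ ℤ.+ l * ℤ.+ l * M′ i j
  conjugate-scaled {A} {B} {M} {M′} A≡M B≡M′ UAU i j = unscale (M′ i j) (scaled-sum ((transpose U · A) i) ((V ᵀ ⊗ M) i) left j) (trans (UAU i j) (B≡M′ i j))
    where
    left : ∀ k → fromℤ ((V ᵀ ⊗ M) i k) ≡ L ℚ.* (transpose U · A) i k
    left k = begin
      fromℤ (sum λ m → V m i * M m k)              ≡⟨ sym (sum-fromℤ λ m → trans
                                                        (cong₂ ℚ._*_ (sym (V-fromℤ m i)) (A≡M m k)) (sym (fromℤ-* (V m i) (M m k)))) ⟩
      sumℚ (λ m → L ℚ.* U m i ℚ.* A m k)           ≡⟨ sumℚ-cong (λ m → ℚ.*-assoc L (U m i) (A m k)) ⟩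
      sumℚ (λ m → L ℚ.* (U m i ℚ.* A m k))         ≡⟨ *-distribˡ-sumℚ L (λ m → U m i ℚ.* A m k) ⟩
      L ℚ.* (transpose U · A) i k                  ∎

  -- If p divided both l and l U then (l / p) U would already be integral.
  minimal⇒primitive : (∀ k → 1 ≤ k → IntegralMat (scale (ℕtoℚ k) U) → l ≤ k) →
    ∀ {p} → Prime p → p ℕ∣.∣ l → ∃ λ i → Nontrivial p (λ r → V r i)
  minimal⇒primitive minimal {p} pr (ℕ∣.divides k l≡kp)
    with Fin.any? (λ i → Fin.any? λ r → ¬? (ℤ.+ p ∣? V r i))
  ... | yes found = found
  ... | no none   = contradiction (minimal k (1≤k k l≡kp) integral) (ℕ.<⇒≱ k<l)
    where
    1≤k : ∀ k → l ≡ k ℕ.* p → 1 ≤ k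
    1≤k zero    l≡0 = contradiction l≡0 (ℕ.>⇒≢ 1≤l)
    1≤k (suc k) _   = ℕ.s≤s ℕ.z≤n
    k<l : k ℕ.< l
    k<l = subst (k ℕ.<_) (sym l≡kp) (ℕ.m<m*n k p {{ℕ.>-nonZero (1≤k k l≡kp)}} (ℕ.nonTrivial⇒n>1 p {{prime⇒nonTrivial pr}}))
    p∣V : ∀ r i → ℤ.+ p ∣ V r i
    p∣V r i = decidable-stable (ℤ.+ p ∣? V r i) λ p∤ → none (i , r , p∤)
    cancel : ∀ {p} → Prime p → ∀ {x y} → fromℤ (ℤ.+ p) ℚ.* x ≡ fromℤ (ℤ.+ p) ℚ.* y → x ≡ y
    cancel {zero}  pr _ = contradiction pr ¬prime[0]
    cancel {suc m} pr {x} {y} px≡py = trans (sym (unit x)) (trans (cong ((1ℤ ℚ./ suc m) ℚ.*_) px≡py) (unit y))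
      where
      unit : ∀ x → (1ℤ ℚ./ suc m) ℚ.* (fromℤ (ℤ.+ suc m) ℚ.* x) ≡ x
      unit x = trans (sym (ℚ.*-assoc (1ℤ ℚ./ suc m) (fromℤ (ℤ.+ suc m)) x))
        (trans (cong (ℚ._* x) (trans (ℚ.*-comm (1ℤ ℚ./ suc m) (fromℤ (ℤ.+ suc m))) (fromℤ-inverse m))) (ℚ.*-identityˡ x))
    integral : IntegralMat (scale (ℕtoℚ k) U)
    integral i j = quotient (p∣V i j) , cancel pr (begin
      fromℤ (ℤ.+ p) ℚ.* (ℕtoℚ k ℚ.* U i j)             ≡⟨ sym (ℚ.*-assoc (fromℤ (ℤ.+ p)) (ℕtoℚ k) (U i j)) ⟩
      fromℤ (ℤ.+ p) ℚ.* ℕtoℚ k ℚ.* U i j               ≡⟨ cong (ℚ._* U i j) (trans (sym (fromℤ-* (ℤ.+ p) (ℤ.+ k)))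
                                                            (cong fromℤ (trans (sym (ℤ.pos-* p k)) (cong ℤ.+_ (trans (ℕ.*-comm p k) (sym l≡kp)))))) ⟩
      L ℚ.* U i j                                      ≡⟨ sym (V-fromℤ i j) ⟩
      fromℤ (V i j)                                    ≡⟨ cong fromℤ (trans (_∣_.equality (p∣V i j)) (ℤ.*-comm (quotient (p∣V i j)) (ℤ.+ p))) ⟩
      fromℤ (ℤ.+ p * quotient (p∣V i j))               ≡⟨ fromℤ-* (ℤ.+ p) (quotient (p∣V i j)) ⟩
      fromℤ (ℤ.+ p) ℚ.* fromℤ (quotient (p∣V i j))     ∎)

theorem3p2 : (α : ℚ) → 0ℚ ≤ℚ α → α <ℚ 1ℚ →
    (c : ℕ) → IsCα α c →
    (n : ℕ) → n ≥ 5 →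
    (G : Graph n) → Connected G → InF α c G →
    (U : Mat n) → InΓ α c G U →
    (l : ℕ) → IsLevel U l →
    ¬ (Even n × Odd c × c ≥ 3) →
    Odd l
theorem3p2 α _ _ c ((1≤c , (a , cα≡a) , (b , c[1-α]≡b)) , _) n n≥5 G _ ((z , det≡ , z-odd , z-squarefree) , full-rank)
  U (UU , U𝟙 , H , UAU) l (1≤l , lU , minimal) not-exceptional =
  level-odd levelData n≥5 not-exceptional detW 2∤z squarefree rank
  where
  open ScaledOrthogonal U l 1≤l lU
  a+b≡c : a + b ≡ ℤ.+ c
  a+b≡c = IntegerGraph.coefficient-sum G a b α c cα≡a c[1-α]≡b

  levelData : LevelData n
  levelData = record
    { M = IntegerGraph.matrix G a b ; M′ = IntegerGraph.matrix H a b
    ; M-sym = IntegerGraph.matrix-sym G a b ; a = a ; c = c ; 1≤c = 1≤c ; d = IntegerGraph.degrees G a b ; d′ = IntegerGraph.degrees H a b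
    ; M𝟙≡cd = IntegerGraph.matrix-𝟙 G a b a+b≡c ; M′𝟙≡cd′ = IntegerGraph.matrix-𝟙 H a b a+b≡c ; diagonal = IntegerGraph.matrix-diag G a b ; handshake = IntegerGraph.handshake G a b
    ; V = V ; l = l ; 1≤l = 1≤l ; VV≡l² = gram-scaled UU ; V𝟙≡l = sums-scaled U𝟙
    ; VMV≡l²M′ = conjugate-scaled {Ac α c G} {Ac α c H} {IntegerGraph.matrix G a b} {IntegerGraph.matrix H a b}
        (IntegerGraph.matrix-fromℤ G a b α c cα≡a c[1-α]≡b) (IntegerGraph.matrix-fromℤ H a b α c cα≡a c[1-α]≡b) UAU
    ; primitivity = minimal⇒primitive minimal
    }

  W : Matrix n n
  W = LevelData.walk-matrix levelData

  detW : detℤ W ≡ z * ℤ.+ (2 ℕ.^ (n ℕ./ 2))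
  detW = fromℤ-injective (trans (sym (det-fromℤ {B = W} (IntegerGraph.walk-fromℤ G a b α c cα≡a c[1-α]≡b 1≤c))) (trans det≡
    (sym (fromℤ-* z (ℤ.+ (2 ℕ.^ (n ℕ./ 2)))))))

  2∤z : ¬ ℤ.+ 2 ∣ z
  2∤z 2∣z = z-odd (∣⇒∣ᵤ 2∣z)

  squarefree : ∀ {p} → Prime p → ¬ ℤ.+ p * ℤ.+ p ∣ z
  squarefree {p} pr pp∣z = z-squarefree p (ℕ.nonTrivial⇒n>1 p {{prime⇒nonTrivial pr}})
    (subst (ℕ∣._∣ ℤ.∣ z ∣) (ℤ.abs-* (ℤ.+ p) (ℤ.+ p)) (∣⇒∣ᵤ pp∣z))

  rank : ∀ {p} → Prime p → p ≢ 2 → p ℕ∣.∣ c → ∀ x → (∀ r → ℤ.+ p ∣ (W ⊛ x) r) → ∀ k → ℤ.+ p ∣ x k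
  -- The rank condition reads entries through their numerators, and the numerator of an integer is
  -- the integer itself.
  rank pr p≢2 p∣c x p∣Wx k = ∣ᵤ⇒∣ (full-rank _ pr (odd-prime pr p≢2) p∣c x
    (λ r → ∣⇒∣ᵤ (∣-resp (sym (trans (sumℤ≡sum (λ k → ℚ.numerator (W̃ α c G r k) * x k)) (sum-cong-≗ λ k → cong (_* x k)
      (trans (cong ℚ.numerator (IntegerGraph.walk-fromℤ G a b α c cα≡a c[1-α]≡b 1≤c r k)) (numerator-fromℤ (W r k)))))) (p∣Wx r))) k)
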